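{- Let $a$ be a positive even integer, $R = \mathbb{Z}[x,y,z]/(x^{2a},y^{2a},z^{2a})$ with its standard grading, and $m := 3a-2$. Let $\rho$ be the ring automorphism of $R$ with $x\mapsto y\mapsto z\mapsto x$ and $\sigma$ the ring automorphism swapping $y\leftrightarrow z$ and fixing $x$. Let $R^{C_3}=\{f\in R: \rho(f)=f\}$, $R^{C_2,- }=\{f\in R:\sigma(f)=-f\}$, and let $N_r = R^{C_3}\cap R^{C_2,- }\cap R_r$ (free $\mathbb{Z}$-modules). Multiplication by $x+y+z$ restricts to a $\mathbb{Z}$-linear map $N_m \to N_{m+1}$ between free $\mathbb{Z}$-modules of equal rank. Then its determinant (well defined up to sign) equals, up to sign, the number of cyclically symmetric transpose complementary plane partitions fitting in an $a \times a \times a$ box.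
   Context: A plane partition fitting in an $a\times a\times a$ box is an array $(\pi_{i,j})_{1\le i,j\le a}$ of integers in $\{0,\dots,a\}$ weakly decreasing along rows and columns; it corresponds to the set of unit cubes $S=\{(i,j,k)\in\{1,\dots,a\}^3: k\le \pi_{i,j}\}$. It is cyclically symmetric if $S$ is invariant under $(i,j,k)\mapsto(j,k,i)$, and transpose complementary if $\pi_{j,i} = a - \pi_{a+1-i,\,a+1-j}$ for all $1\le i,j\le a$. -}

module Defs where

open import Data.Nat as ℕ using (ℕ; zero; suc; _∸_; _<ᵇ_)
open import Data.Integer as ℤ using (ℤ; 0ℤ; 1ℤ; -_; ∣_∣)
open import Data.Bool using (Bool; true; false; if_then_else_; _∧_)
open import Data.Fin using (Fin; zero; suc; toℕ; punchIn; opposite)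
open import Data.Vec using (Vec; lookup)
open import Data.List using (List; length)
open import Data.List.Membership.Propositional using (_∈_)
open import Data.List.Relation.Unary.Unique.Propositional using (Unique)
open import Data.Product using (Σ; _×_)
open import Data.Empty using (⊥)
open import Function.Bundles using (_⇔_)
open import Relation.Binary.PropositionalEquality using (_≡_)

-- Elements of ℤ[x,y,z]/(x^{2a},y^{2a},z^{2a}) are represented by their
-- coefficient functions  (i , j , k) ↦ coefficient of x^i y^j z^k,
-- required to vanish outside the box  i,j,k < 2a  (canonical representatives).

Poly : Set
Poly = ℕ → ℕ → ℕ → ℤ

_≈_ : Poly → Poly → Set
f ≈ g = ∀ i j k → f i j k ≡ g i j k

zeroP : Poly
zeroP _ _ _ = 0ℤ

negP : Poly → Poly
negP f i j k = - f i j k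

inBox : ℕ → ℕ → ℕ → ℕ → Bool
inBox a i j k = (i <ᵇ 2 ℕ.* a) ∧ (j <ᵇ 2 ℕ.* a) ∧ (k <ᵇ 2 ℕ.* a)

InR : ℕ → Poly → Set
InR a f = ∀ i j k → inBox a i j k ≡ false → f i j k ≡ 0ℤ

-- ρ : x ↦ y ↦ z ↦ x ; ρ(x^i y^j z^k) = y^i z^j x^k
ρ : Poly → Poly
ρ f p q r = f q r p

σ : Poly → Poly
σ f p q r = f p r q

Homog : ℕ → Poly → Set
Homog r f = ∀ i j k → (i ℕ.+ j ℕ.+ k ≡ r → ⊥) → f i j k ≡ 0ℤ

InN : ℕ → ℕ → Poly → Set
InN a r f = InR a f × (ρ f ≈ f) × (σ f ≈ negP f) × Homog r f

-- multiplication by x + y + z in R (then truncated to the box,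
-- i.e. reduced modulo x^{2a}, y^{2a}, z^{2a})
prev : (ℕ → ℤ) → ℕ → ℤ
prev g zero    = 0ℤ
prev g (suc n) = g n

mulL : ℕ → Poly → Poly
mulL a f i j k =
  if inBox a i j k
  then prev (λ i' → f i' j k) i ℤ.+ prev (λ j' → f i j' k) j ℤ.+ prev (λ k' → f i j k') k
  else 0ℤ

sumFin : (n : ℕ) → (Fin n → ℤ) → ℤ
sumFin zero    g = 0ℤ
sumFin (suc n) g = g zero ℤ.+ sumFin n (λ t → g (suc t))

lin : {n : ℕ} → (Fin n → ℤ) → (Fin n → Poly) → Poly
lin {n} c B i j k = sumFin n (λ t → c t ℤ.* B t i j k)

IsBasis : (a r n : ℕ) → (Fin n → Poly) → Set
IsBasis a r n B =
  (∀ t → InN a r (B t))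
  × (∀ (c : Fin n → ℤ) → lin c B ≈ zeroP → ∀ t → c t ≡ 0ℤ)
  × (∀ f → InN a r f → Σ (Fin n → ℤ) λ c → f ≈ lin c B)

sign : ℕ → ℤ
sign zero          = 1ℤ
sign (suc zero)    = - 1ℤ
sign (suc (suc n)) = sign n

det : (n : ℕ) → (Fin n → Fin n → ℤ) → ℤ
det zero    M = 1ℤ
det (suc n) M =
  sumFin (suc n) λ j →
    sign (toℕ j) ℤ.* M zero j ℤ.* det n (λ r s → M (suc r) (punchIn j s))

-- Plane partitions in an a×a×a box, 0-based indices:
-- entry (i,j) ↦ π_{i+1,j+1}.

Matrix : ℕ → Set
Matrix a = Vec (Vec ℕ a) a

entry : {a : ℕ} → Matrix a → Fin a → Fin a → ℕ
entry π i j = lookup (lookup π i) j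

IsPlanePartition : (a : ℕ) → Matrix a → Set
IsPlanePartition a π =
  (∀ i j → entry π i j ℕ.≤ a)
  × (∀ i i' j → toℕ i ℕ.≤ toℕ i' → entry π i' j ℕ.≤ entry π i j)
  × (∀ i j j' → toℕ j ℕ.≤ toℕ j' → entry π i j' ℕ.≤ entry π i j)

-- unit cube (i+1, j+1, k+1) belongs to S
InS : {a : ℕ} → Matrix a → Fin a → Fin a → Fin a → Set
InS π i j k = suc (toℕ k) ℕ.≤ entry π i j

CyclicallySymmetric : (a : ℕ) → Matrix a → Set
CyclicallySymmetric a π = ∀ i j k → InS π i j k ⇔ InS π j k i

TransposeComplementary : (a : ℕ) → Matrix a → Set
TransposeComplementary a π =
  ∀ i j → entry π j i ≡ a ∸ entry π (opposite i) (opposite j)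

IsCSTC : (a : ℕ) → Matrix a → Set
IsCSTC a π = IsPlanePartition a π × CyclicallySymmetric a π × TransposeComplementary a π

NumberIs : {A : Set} → (A → Set) → ℕ → Set
NumberIs {A} P k =
  Σ (List A) λ L → Unique L × (∀ x → (x ∈ L) ⇔ P x) × length L ≡ k

{-# OPTIONS --safe #-}

-- Let a = 2c.  N_r consists of the alternating polynomials, with basis the alternating monomials with
-- exponents i > j > k.  Between degrees 3a - 2 and 3a - 1 the matrix of multiplication by x + y + z is
-- the bipartite adjacency matrix of a region of the honeycomb graph (a sixth of a hexagon).
--
-- Sort the vertices by j and expand the determinant row by row.  The edges changing j select in every
-- row a set of positions; consecutive sets interlace, their sizes 1, 2, ..., c, c - 1, ..., 1, 0 are
-- forced, and they determine the perfect matching.  After scaling the basis vectors by (-1)^k the sign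
-- of a matching depends on these sizes only, so up to sign the determinant counts the chains of
-- interlacing sets.
--
-- The sets of a chain are the (shifted) diagonals of the upper-left c × c block of a cyclically
-- symmetric transpose complementary plane partition.  The entries of that block are characterised by
-- monotonicity and a - min(i,j) ≤ π(i,j) ≤ a (indices from 0), and the block determines the partition:
-- among the three coordinates of a unit cube two lie on the same side of c, so that rotation and, if
-- needed, complementation move the cube over the block.
module Submission where

-- `ρ` and `σ` generate all permutations of x, y, z, so N_r is the part on which they act by the
-- sign character. As ℤ has no 2-torsion, a coefficient with a repeated exponent vanishes; this
-- leaves i > j > k. With i < 4c, the degrees 6c - 2 and 6c - 1 force c ≤ j < 3c. The degree
-- determines i, so a vertex is just a pair made from j and k. The scaling by (-1)^k has a local
-- reason. A white at k may take the black at k - 1 or at k of its row. When both are present they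
-- occupy adjacent columns, so their cofactor signs are opposite; the entry -1 on the z-edge
-- compensates this. The statement admits arbitrary bases over ℤ. Their coefficient matrices against
-- the monomial basis are invertible over ℤ, and they intertwine the given matrix with the adjacency
-- matrix. The multiplicativity of determinants required for this also shows that all bases have the
-- same size. The bounds in the interlacing relations (first black and last white of a row) become
-- the bounds on the entries of the c × c block.

open import Defs
open import Data.Bool using (Bool; true; false)
open import Data.Empty using (⊥; ⊥-elim)
open import Data.Integer as ℤ using (ℤ; 0ℤ; 1ℤ; -_; ∣_∣)
import Data.Integer.Properties as ℤ
open import Data.List using (List; []; _∷_; _++_; map; length; [_])
import Data.List.Properties as L
open import Data.Nat as ℕ using (ℕ; zero; suc; z≤n; s≤s; _≤_; _<_)
import Data.Nat.Properties as ℕ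
open import Data.Product using (Σ; _×_; _,_; proj₁; proj₂)
open import Function using (_∘_; id)
open import Relation.Binary.PropositionalEquality hiding ([_]; J)
open import Relation.Nullary using (yes; no; ¬_)

-- Linear inequalities for the exponents, and the Boolean order test.

module LinearArithmetic where

  open import Data.Nat using (_+_; _*_; _<ᵇ_)
  open import Data.Nat.Tactic.RingSolver using (solve; solve-∀)

  -- Proves a linear inequality from a sum of hypotheses A ≤ B; the equation is a semiring identity.
  lin≤ : ∀ {A B X Y} → A ≤ B → X + B ≡ Y + A → X ≤ Y
  lin≤ {A} {B} {X} {Y} p e = ℕ.+-cancelʳ-≤ A X Y (ℕ.≤-trans (ℕ.+-monoʳ-≤ X p) (ℕ.≤-reflexive e))

  infixr 5 _⊕_
  _⊕_ : ∀ {a b c d} → a ≤ b → c ≤ d → a + c ≤ b + d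
  _⊕_ = ℕ.+-mono-≤

  eq≤ : ∀ {a b : ℕ} → a ≡ b → a ≤ b
  eq≤ = ℕ.≤-reflexive

  eq≥ : ∀ {a b : ℕ} → a ≡ b → b ≤ a
  eq≥ = ℕ.≤-reflexive ∘ sym

  shrink-count : ∀ s b → s + s + b + suc s ≡ s + s + 1 + (b + s)
  shrink-count = solve-∀

  grow-count : ∀ q w lo → suc (q + q) + (w + lo) ≡ q + q + 0 + w + suc lo
  grow-count = solve-∀

  white-count : ∀ q lo → suc lo + (q + q + 0) ≡ lo + suc (q + q)
  white-count = solve-∀

  -- Here `c′ + r` is an exponent of y, `4 * suc c′` is 2a, `6 * c′ + 4` is 3a - 2, and `d` is 0 for
  -- blacks and 1 for whites.
  module Bounds (c′ d : ℕ) where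

    small : ∀ r k → k + (r + r) < 4 * suc c′ + d → (c′ + r) + k ≤ d + (6 * c′ + 4)
    small r k h = lin≤ (h ⊕ z≤n {r + c′ + 1}) (solve (c′ ∷ d ∷ r ∷ k ∷ []))

    j<i : ∀ i r k → k + (r + r) < 4 * suc c′ + d → i + (c′ + r) + k ≡ d + (6 * c′ + 4) → c′ + r < i
    j<i i r k h e = lin≤ (h ⊕ eq≥ e) (solve (c′ ∷ d ∷ r ∷ k ∷ i ∷ []))

    i<2a : ∀ i r k → c′ + d < r + k → i + (c′ + r) + k ≡ d + (6 * c′ + 4) → i < 2 * (suc c′ + suc c′)
    i<2a i r k h e = lin≤ (h ⊕ eq≤ e) (solve (c′ ∷ d ∷ r ∷ k ∷ i ∷ []))

    shrink₁ : ∀ q s k → q + suc s ≡ suc c′ + suc c′ → suc s ≤ suc c′ → k < s + s + d → d ≤ 1 → k < c′ + suc q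
    shrink₁ q s k e s≤ h d≤1 = lin≤ (h ⊕ d≤1 ⊕ eq≥ e ⊕ s≤ ⊕ s≤ ⊕ s≤ ⊕ z≤n {1}) (solve (c′ ∷ q ∷ s ∷ k ∷ d ∷ []))

    shrink₂ : ∀ q s k → q + suc s ≡ suc c′ + suc c′ → k < s + s + d → k + (suc q + suc q) < 4 * suc c′ + d
    shrink₂ q s k e h = lin≤ (h ⊕ eq≤ e ⊕ eq≤ e) (solve (c′ ∷ q ∷ s ∷ k ∷ d ∷ []))

    shrink₃ : ∀ q s k → q + suc s ≡ suc c′ + suc c′ → suc s ≤ suc c′ → d ≤ 1 → c′ + d < suc q + k
    shrink₃ q s k e s≤ d≤1 = lin≤ (eq≥ e ⊕ s≤ ⊕ d≤1 ⊕ z≤n {k}) (solve (c′ ∷ q ∷ s ∷ k ∷ d ∷ []))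

    c≤j : ∀ i j k → k < j → i < 2 * (suc c′ + suc c′) → i + j + k ≡ d + (6 * c′ + 4) → suc c′ ≤ j
    c≤j i j k h₁ h₂ e = ℕ.*-cancelˡ-≤ 2 (lin≤ (h₁ ⊕ h₂ ⊕ eq≥ e ⊕ z≤n {d}) (solve (c′ ∷ d ∷ i ∷ j ∷ k ∷ [])))

    lower : ∀ i q lo k → q + lo ≡ c′ → i < 2 * (suc c′ + suc c′) → i + (suc c′ + q) + k ≡ d + (6 * c′ + 4) → lo + d ≤ k
    lower i q lo k e′ h e = lin≤ (h ⊕ eq≥ e ⊕ eq≤ e′) (solve (c′ ∷ d ∷ i ∷ q ∷ k ∷ lo ∷ []))

    upper : ∀ q lo k → q + lo ≡ c′ → k < suc c′ + q → k < lo + suc (q + q)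
    upper q lo k e h = lin≤ (h ⊕ eq≥ e) (solve (c′ ∷ q ∷ k ∷ lo ∷ []))

    late : ∀ i x k → d ≤ 1 → suc c′ + (suc c′ + x) < i → i + (suc c′ + (suc c′ + x)) + k ≡ d + (6 * c′ + 4) → suc x ≤ suc c′
    late i x k d≤1 h e = ℕ.*-cancelˡ-≤ 2 (lin≤ (h ⊕ eq≤ e ⊕ d≤1 ⊕ z≤n {k}) (solve (c′ ∷ d ∷ i ∷ x ∷ k ∷ [])))

    last : ∀ i x s k → suc x + s ≡ suc c′ → suc c′ + (suc c′ + x) < i → i + (suc c′ + (suc c′ + x)) + k ≡ d + (6 * c′ + 4) → k < s + s + d
    last i x s k e′ h e = lin≤ (h ⊕ eq≤ e ⊕ eq≥ e′ ⊕ eq≥ e′) (solve (c′ ∷ d ∷ i ∷ x ∷ k ∷ s ∷ []))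

  module GrowBounds (q lo d : ℕ) where

    grow₁ : ∀ k → k < lo + suc (q + q) → k < q + lo + suc q
    grow₁ k h = lin≤ h (solve (q ∷ lo ∷ k ∷ []))

    grow₂ : ∀ k → k < lo + suc (q + q) → k + (suc q + suc q) < 4 * suc (q + lo) + d
    grow₂ k h = lin≤ (h ⊕ z≤n {1 + 3 * lo + d}) (solve (q ∷ lo ∷ k ∷ d ∷ []))

    grow₃ : ∀ k → lo + d ≤ k → q + lo + d < suc q + k
    grow₃ k h = lin≤ h (solve (q ∷ lo ∷ k ∷ d ∷ []))

  <⇒<ᵇ-true : ∀ {m n} → m < n → (m <ᵇ n) ≡ true
  <⇒<ᵇ-true {zero}  {suc n} _       = refl
  <⇒<ᵇ-true {suc m} {suc n} (s≤s p) = <⇒<ᵇ-true p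

  <ᵇ-true⇒< : ∀ {m n} → (m <ᵇ n) ≡ true → m < n
  <ᵇ-true⇒< {zero}  {suc n} _ = s≤s z≤n
  <ᵇ-true⇒< {suc m} {suc n} e = s≤s (<ᵇ-true⇒< {m} e)

  ≥⇒<ᵇ-false : ∀ {m n} → n ≤ m → (m <ᵇ n) ≡ false
  ≥⇒<ᵇ-false {m}     z≤n     = refl
  ≥⇒<ᵇ-false {suc m} (s≤s p) = ≥⇒<ᵇ-false p

  <ᵇ-false⇒≥ : ∀ {m n} → (m <ᵇ n) ≡ false → n ≤ m
  <ᵇ-false⇒≥ {m}     {zero}  _ = z≤n
  <ᵇ-false⇒≥ {suc m} {suc n} e = s≤s (<ᵇ-false⇒≥ {m} e)

-- Alternating multilinear functions, multiplicativity of determinants, comparison of ranks.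

module Determinants where

  open import Data.Integer using (_+_; _*_; _-_)
  open import Data.Integer.Tactic.RingSolver using (solve-∀)
  open import Data.Fin using (Fin; zero; suc; toℕ; punchIn)
  open import Data.List using (tabulate; allFin)
  open import Data.List.Relation.Binary.Pointwise as PW using (Pointwise; []; _∷_)
  open ≡-Reasoning

  shift : ∀ {A : Set} (xs : List A) x ys → (xs ++ [ x ]) ++ ys ≡ xs ++ x ∷ ys
  shift xs x ys = L.++-assoc xs [ x ] ys

  sign-suc : ∀ n → sign (suc n) ≡ - sign n
  sign-suc zero          = refl
  sign-suc (suc zero)    = refl
  sign-suc (suc (suc n)) = sign-suc n

  sign-+ : ∀ m n → sign (m ℕ.+ n) ≡ sign m * sign n
  sign-+ zero n = sym (ℤ.*-identityˡ (sign n))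
  sign-+ (suc m) n = begin
    sign (suc (m ℕ.+ n)) ≡⟨ sign-suc (m ℕ.+ n) ⟩
    - sign (m ℕ.+ n) ≡⟨ cong -_ (sign-+ m n) ⟩
    - (sign m * sign n) ≡⟨ ℤ.neg-distribˡ-* (sign m) (sign n) ⟩
    - sign m * sign n ≡⟨ cong (_* sign n) (sign-suc m) ⟨
    sign (suc m) * sign n ∎

  module _ {B : Set} where

    -- Signed expansion of one row v over a list of columns; h evaluates the remaining columns.
    lap : (List B → ℤ) → (B → ℤ) → List B → ℤ
    lap h v []       = 0ℤ
    lap h v (b ∷ bs) = v b * h bs - lap (h ∘ (b ∷_)) v bs

    detL : List (B → ℤ) → List B → ℤ
    detL []       []       = 1ℤ
    detL []       (_ ∷ _)  = 0ℤ
    detL (v ∷ vs) bs       = lap (detL vs) v bs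

    lap-cong : ∀ {h h′ v v′} → (∀ bs → h bs ≡ h′ bs) → (∀ b → v b ≡ v′ b) → ∀ bs → lap h v bs ≡ lap h′ v′ bs
    lap-cong p q []       = refl
    lap-cong p q (b ∷ bs) = cong₂ _-_ (cong₂ _*_ (q b) (p bs)) (lap-cong (p ∘ (b ∷_)) q bs)

    lap-zero : ∀ {h} v → (∀ bs → h bs ≡ 0ℤ) → ∀ bs → lap h v bs ≡ 0ℤ
    lap-zero v p [] = refl
    lap-zero v p (b ∷ bs) = cong₂ _-_ (trans (cong (v b *_) (p bs)) (ℤ.*-zeroʳ (v b))) (lap-zero v (p ∘ (b ∷_)) bs)

    lap-linearʰ : ∀ x y {h h₁ h₂} v → (∀ bs → h bs ≡ x * h₁ bs + y * h₂ bs) →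
                  ∀ bs → lap h v bs ≡ x * lap h₁ v bs + y * lap h₂ v bs
    lap-linearʰ x y v p [] = sym (cong₂ _+_ (ℤ.*-zeroʳ x) (ℤ.*-zeroʳ y))
    lap-linearʰ x y {h} {h₁} {h₂} v p (b ∷ bs)
      rewrite p bs | lap-linearʰ x y v (p ∘ (b ∷_)) bs
      = alg x y (v b) (h₁ bs) (h₂ bs) (lap (h₁ ∘ (b ∷_)) v bs) (lap (h₂ ∘ (b ∷_)) v bs)
      where
      alg : ∀ x y v h₁ h₂ l₁ l₂ →
            v * (x * h₁ + y * h₂) - (x * l₁ + y * l₂) ≡ x * (v * h₁ - l₁) + y * (v * h₂ - l₂)
      alg = solve-∀

    lap-linearᵛ : ∀ x y h {v v₁ v₂} → (∀ b → v b ≡ x * v₁ b + y * v₂ b) →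
                  ∀ bs → lap h v bs ≡ x * lap h v₁ bs + y * lap h v₂ bs
    lap-linearᵛ x y h p [] = sym (cong₂ _+_ (ℤ.*-zeroʳ x) (ℤ.*-zeroʳ y))
    lap-linearᵛ x y h {v} {v₁} {v₂} p (b ∷ bs)
      rewrite p b | lap-linearᵛ x y (h ∘ (b ∷_)) p bs
      = alg x y (v₁ b) (v₂ b) (h bs) (lap (h ∘ (b ∷_)) v₁ bs) (lap (h ∘ (b ∷_)) v₂ bs)
      where
      alg : ∀ x y v₁ v₂ h l₁ l₂ →
            (x * v₁ + y * v₂) * h - (x * l₁ + y * l₂) ≡ x * (v₁ * h - l₁) + y * (v₂ * h - l₂)
      alg = solve-∀

    -- After the first column `b` is split off, linearity separates the inner expansion into two
    -- parts: one cancels the leading term, the other is again a double expansion along `v`, over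
    -- fewer columns.
    lap-lap : ∀ h v bs → lap (lap h v) v bs ≡ 0ℤ
    lap-lap h v [] = refl
    lap-lap h v (b ∷ bs) = begin
      v b * lap h v bs - lap (λ r → v b * h r - lap (h ∘ (b ∷_)) v r) v bs
        ≡⟨ cong (λ z → v b * lap h v bs - z) (lap-linearʰ (v b) (- 1ℤ) v (λ r → lem (v b * h r) (lap (h ∘ (b ∷_)) v r)) bs) ⟩
      v b * lap h v bs - (v b * lap h v bs + - 1ℤ * lap (lap (h ∘ (b ∷_)) v) v bs)
        ≡⟨ cong (λ z → v b * lap h v bs - (v b * lap h v bs + - 1ℤ * z)) (lap-lap (h ∘ (b ∷_)) v bs) ⟩
      v b * lap h v bs - (v b * lap h v bs + - 1ℤ * 0ℤ)
        ≡⟨ lem₂ (v b * lap h v bs) ⟩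
      0ℤ ∎
      where
      lem : ∀ p q → p - q ≡ p + - 1ℤ * q
      lem = solve-∀
      lem₂ : ∀ p → p - (p + - 1ℤ * 0ℤ) ≡ 0ℤ
      lem₂ = solve-∀

    _≐_ : List (B → ℤ) → List (B → ℤ) → Set
    _≐_ = Pointwise (λ v w → ∀ b → v b ≡ w b)

    ≐-refl : ∀ {vs} → vs ≐ vs
    ≐-refl = PW.refl (λ _ → refl)

    comb : ℤ → (B → ℤ) → ℤ → (B → ℤ) → B → ℤ
    comb x v y w b = x * v b + y * w b

    -- Rows are functions, so `F-cong` replaces extensionality. `F-alt` speaks of neighbouring rows
    -- only; antisymmetry and the case of distant equal rows follow from it.
    record Alternating (F : List (B → ℤ) → ℤ) : Set where
      field
        F-cong   : ∀ {vs ws} → vs ≐ ws → F vs ≡ F ws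
        F-linear : ∀ xs ys x v y w →
                   F (xs ++ comb x v y w ∷ ys) ≡ x * F (xs ++ v ∷ ys) + y * F (xs ++ w ∷ ys)
        F-alt    : ∀ xs v ys → F (xs ++ v ∷ v ∷ ys) ≡ 0ℤ

    detL-cong : ∀ {vs ws} → vs ≐ ws → ∀ bs → detL vs bs ≡ detL ws bs
    detL-cong []       []      = refl
    detL-cong []       (_ ∷ _) = refl
    detL-cong (p ∷ ps) bs      = lap-cong (detL-cong ps) p bs

    detL-linear : ∀ xs ys x v y w bs →
      detL (xs ++ comb x v y w ∷ ys) bs ≡ x * detL (xs ++ v ∷ ys) bs + y * detL (xs ++ w ∷ ys) bs
    detL-linear []        ys x v y w bs = lap-linearᵛ x y (detL ys) (λ _ → refl) bs
    detL-linear (u ∷ xs)  ys x v y w bs = lap-linearʰ x y u (detL-linear xs ys x v y w) bs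

    detL-alt : ∀ xs v ys bs → detL (xs ++ v ∷ v ∷ ys) bs ≡ 0ℤ
    detL-alt []       v ys bs = lap-lap (detL ys) v bs
    detL-alt (u ∷ xs) v ys bs = lap-zero u (detL-alt xs v ys) bs

    detL-alternating : ∀ bs → Alternating (λ vs → detL vs bs)
    detL-alternating bs = record
      { F-cong   = λ p → detL-cong p bs
      ; F-linear = λ xs ys x v y w → detL-linear xs ys x v y w bs
      ; F-alt    = λ xs v ys → detL-alt xs v ys bs
      }

  module _ {B C : Set} where

    lap-map : ∀ (φ : C → B) {h h′} (v : B → ℤ) → (∀ cs → h (map φ cs) ≡ h′ cs) →
              ∀ cs → lap h v (map φ cs) ≡ lap h′ (v ∘ φ) cs
    lap-map φ v p []       = refl
    lap-map φ v p (c ∷ cs) = cong₂ _-_ (cong (v (φ c) *_) (p cs)) (lap-map φ v (p ∘ (c ∷_)) cs)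

    detL-map : ∀ (φ : C → B) vs cs → detL vs (map φ cs) ≡ detL (map (_∘ φ) vs) cs
    detL-map φ []       []      = refl
    detL-map φ []       (_ ∷ _) = refl
    detL-map φ (v ∷ vs) cs      = lap-map φ v (detL-map φ vs) cs

  module _ {B : Set} where

    sumL : List B → (B → ℤ) → ℤ
    sumL []       g = 0ℤ
    sumL (b ∷ bs) g = g b + sumL bs g

    sumL-++ : ∀ bs cs g → sumL (bs ++ cs) g ≡ sumL bs g + sumL cs g
    sumL-++ []       cs g = sym (ℤ.+-identityˡ _)
    sumL-++ (b ∷ bs) cs g = trans (cong (g b +_) (sumL-++ bs cs g)) (sym (ℤ.+-assoc (g b) _ _))

    sumL-cong : ∀ bs {f g : B → ℤ} → (∀ b → f b ≡ g b) → sumL bs f ≡ sumL bs g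
    sumL-cong []       p = refl
    sumL-cong (b ∷ bs) p = cong₂ _+_ (p b) (sumL-cong bs p)

    module AlternatingProperties {F : List (B → ℤ) → ℤ} (alt : Alternating F) where
      open Alternating alt

      F-congAt : ∀ xs {v w} ys → (∀ b → v b ≡ w b) → F (xs ++ v ∷ ys) ≡ F (xs ++ w ∷ ys)
      F-congAt xs ys p = F-cong (PW.++⁺ ≐-refl (p ∷ ≐-refl))

      -- Polarisation: two neighbouring rows, both equal to v + w, are expanded by linearity, and
      -- the two diagonal terms vanish.
      F-swap : ∀ xs v w ys → F (xs ++ v ∷ w ∷ ys) ≡ - F (xs ++ w ∷ v ∷ ys)
      F-swap xs v w ys = lem _ _ (begin
        F (xs ++ v ∷ w ∷ ys) + F (xs ++ w ∷ v ∷ ys)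
          ≡⟨ alg (F (xs ++ v ∷ w ∷ ys)) (F (xs ++ w ∷ v ∷ ys)) ⟩
        (1ℤ * 0ℤ + 1ℤ * F (xs ++ v ∷ w ∷ ys)) + (1ℤ * F (xs ++ w ∷ v ∷ ys) + 1ℤ * 0ℤ)
          ≡⟨ cong₂ (λ p q → (1ℤ * p + 1ℤ * F (xs ++ v ∷ w ∷ ys)) + (1ℤ * F (xs ++ w ∷ v ∷ ys) + 1ℤ * q)) (sym (F-alt xs v ys)) (sym (F-alt xs w ys)) ⟩
        (1ℤ * F (xs ++ v ∷ v ∷ ys) + 1ℤ * F (xs ++ v ∷ w ∷ ys)) + (1ℤ * F (xs ++ w ∷ v ∷ ys) + 1ℤ * F (xs ++ w ∷ w ∷ ys))
          ≡⟨ cong₂ _+_ (second v) (second w) ⟨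
        F (xs ++ v ∷ s ∷ ys) + F (xs ++ w ∷ s ∷ ys)
          ≡⟨ cong₂ _+_ (ℤ.*-identityˡ (F (xs ++ v ∷ s ∷ ys))) (ℤ.*-identityˡ (F (xs ++ w ∷ s ∷ ys))) ⟨
        1ℤ * F (xs ++ v ∷ s ∷ ys) + 1ℤ * F (xs ++ w ∷ s ∷ ys)
          ≡⟨ F-linear xs (s ∷ ys) 1ℤ v 1ℤ w ⟨
        F (xs ++ s ∷ s ∷ ys)
          ≡⟨ F-alt xs s ys ⟩
        0ℤ ∎)
        where
        s = comb 1ℤ v 1ℤ w
        second : ∀ u → F (xs ++ u ∷ s ∷ ys) ≡ 1ℤ * F (xs ++ u ∷ v ∷ ys) + 1ℤ * F (xs ++ u ∷ w ∷ ys)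
        second u = subst₂ _≡_ (cong F (shift xs u _))
                     (cong₂ (λ p q → 1ℤ * F p + 1ℤ * F q) (shift xs u _) (shift xs u _))
                     (F-linear (xs ++ [ u ]) ys 1ℤ v 1ℤ w)
        alg : ∀ p q → p + q ≡ (1ℤ * 0ℤ + 1ℤ * p) + (1ℤ * q + 1ℤ * 0ℤ)
        alg = solve-∀
        lem : ∀ p q → p + q ≡ 0ℤ → p ≡ - q
        lem p q e = begin
          p ≡⟨ l₁ p q ⟩
          (p + q) - q ≡⟨ cong (_- q) e ⟩
          0ℤ - q ≡⟨ ℤ.+-identityˡ (- q) ⟩
          - q ∎
          where
          l₁ : ∀ p q → p ≡ (p + q) - q
          l₁ = solve-∀

      F-repeat : ∀ xs v ys zs → F (xs ++ v ∷ ys ++ v ∷ zs) ≡ 0ℤ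
      F-repeat xs v []       zs = F-alt xs v zs
      F-repeat xs v (y ∷ ys) zs = begin
        F (xs ++ v ∷ y ∷ ys ++ v ∷ zs) ≡⟨ F-swap xs v y _ ⟩
        - F (xs ++ y ∷ v ∷ ys ++ v ∷ zs) ≡⟨ cong (-_ ∘ F) (shift xs y _) ⟨
        - F ((xs ++ [ y ]) ++ v ∷ ys ++ v ∷ zs) ≡⟨ cong -_ (F-repeat (xs ++ [ y ]) v ys zs) ⟩
        0ℤ ∎

      F-move : ∀ xs v ys zs → F (xs ++ v ∷ ys ++ zs) ≡ sign (length ys) * F (xs ++ ys ++ v ∷ zs)
      F-move xs v []       zs = sym (ℤ.*-identityˡ _)
      F-move xs v (y ∷ ys) zs = begin
        F (xs ++ v ∷ y ∷ ys ++ zs) ≡⟨ F-swap xs v y _ ⟩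
        - F (xs ++ y ∷ v ∷ ys ++ zs) ≡⟨ cong (-_ ∘ F) (shift xs y _) ⟨
        - F ((xs ++ [ y ]) ++ v ∷ ys ++ zs) ≡⟨ cong -_ (F-move (xs ++ [ y ]) v ys zs) ⟩
        - (sign (length ys) * F ((xs ++ [ y ]) ++ ys ++ v ∷ zs)) ≡⟨ cong (λ z → - (sign (length ys) * F z)) (shift xs y _) ⟩
        - (sign (length ys) * F (xs ++ y ∷ ys ++ v ∷ zs)) ≡⟨ ℤ.neg-distribˡ-* (sign (length ys)) _ ⟩
        - sign (length ys) * F (xs ++ y ∷ ys ++ v ∷ zs) ≡⟨ cong (_* F (xs ++ y ∷ ys ++ v ∷ zs)) (sign-suc (length ys)) ⟨
        sign (suc (length ys)) * F (xs ++ y ∷ ys ++ v ∷ zs) ∎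

      module Expansion (e : B → B → ℤ) where

        rowSum : List B → (B → ℤ) → B → ℤ
        rowSum bs v c = sumL bs (λ b → v b * e b c)

        F-rowSum : ∀ xs ys v bs → F (xs ++ rowSum bs v ∷ ys) ≡ sumL bs (λ b → v b * F (xs ++ e b ∷ ys))
        F-rowSum xs ys v [] = begin
          F (xs ++ (λ _ → 0ℤ) ∷ ys) ≡⟨ F-congAt xs ys (λ _ → refl) ⟩
          F (xs ++ comb 0ℤ v 0ℤ v ∷ ys) ≡⟨ F-linear xs ys 0ℤ v 0ℤ v ⟩
          0ℤ ∎
        F-rowSum xs ys v (b ∷ bs) = begin
          F (xs ++ (λ c → v b * e b c + rowSum bs v c) ∷ ys)
            ≡⟨ F-congAt xs ys (λ c → cong (v b * e b c +_) (sym (ℤ.*-identityˡ _))) ⟩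
          F (xs ++ comb (v b) (e b) 1ℤ (rowSum bs v) ∷ ys)
            ≡⟨ F-linear xs ys (v b) (e b) 1ℤ (rowSum bs v) ⟩
          v b * F (xs ++ e b ∷ ys) + 1ℤ * F (xs ++ rowSum bs v ∷ ys)
            ≡⟨ cong (v b * F (xs ++ e b ∷ ys) +_) (trans (ℤ.*-identityˡ _) (F-rowSum xs ys v bs)) ⟩
          sumL (b ∷ bs) (λ b → v b * F (xs ++ e b ∷ ys)) ∎

        -- The columns ps are those already consumed by rows equal to unit vectors.
        Spans : List B → List B → Set
        Spans ps cs = ∀ v c → v c ≡ rowSum (ps ++ cs) v c

        rowSum-shift : ∀ ps qs b rs v c → rowSum ((ps ++ [ b ]) ++ qs ++ rs) v c ≡ rowSum (ps ++ qs ++ b ∷ rs) v c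
        rowSum-shift ps qs b rs v c
          rewrite sumL-++ (ps ++ [ b ]) (qs ++ rs) (λ b → v b * e b c)
                | sumL-++ ps [ b ] (λ b → v b * e b c)
                | sumL-++ qs rs (λ b → v b * e b c)
                | sumL-++ ps (qs ++ b ∷ rs) (λ b → v b * e b c)
                | sumL-++ qs (b ∷ rs) (λ b → v b * e b c)
          = alg (sumL ps _) (v b * e b c) (sumL qs _) (sumL rs _)
          where
          alg : ∀ p b q r → (p + (b + 0ℤ)) + (q + r) ≡ p + (q + (b + r))
          alg = solve-∀

        -- The first row of `vs` is written in unit vectors. A column of `ps` repeats an earlier row
        -- and drops out (`used`); a column of `cs` is consumed, and one row and one column fewer
        -- remain. Collecting the terms gives the Laplace expansion.
        uniqueness : ∀ ps vs cs → Spans ps cs → length vs ≡ length cs →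
                     F (map e ps ++ vs) ≡ detL vs cs * F (map e ps ++ map e cs)

        -- `qs` are the columns already passed over. The unit row `e b` has to move behind all of
        -- `map e qs` to restore the order of the columns, which is the origin of the alternating
        -- signs.
        expand : ∀ ps v vs qs rs → (∀ v c → v c ≡ rowSum (ps ++ qs ++ rs) v c) →
                 suc (length vs) ≡ length (qs ++ rs) →
                 sumL rs (λ b → v b * F (map e ps ++ e b ∷ vs)) ≡
                 lap (detL vs ∘ (qs ++_)) v rs * (sign (length qs) * F (map e ps ++ map e (qs ++ rs)))

        used : ∀ ps (v : B → ℤ) vs qs → sumL qs (λ b → v b * F (map e ps ++ map e qs ++ e b ∷ vs)) ≡ 0ℤ

        uniqueness ps [] [] sp len = sym (ℤ.*-identityˡ _)
        uniqueness ps (v ∷ vs) cs sp len = begin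
          F (map e ps ++ v ∷ vs)
            ≡⟨ F-congAt (map e ps) vs (sp v) ⟩
          F (map e ps ++ rowSum (ps ++ cs) v ∷ vs)
            ≡⟨ F-rowSum (map e ps) vs v (ps ++ cs) ⟩
          sumL (ps ++ cs) (λ b → v b * F (map e ps ++ e b ∷ vs))
            ≡⟨ sumL-++ ps cs _ ⟩
          sumL ps (λ b → v b * F (map e ps ++ e b ∷ vs)) + sumL cs (λ b → v b * F (map e ps ++ e b ∷ vs))
            ≡⟨ cong₂ _+_ (used [] v vs ps) (expand ps v vs [] cs sp len) ⟩
          0ℤ + lap (detL vs) v cs * (1ℤ * F (map e ps ++ map e cs))
            ≡⟨ alg (lap (detL vs) v cs) _ ⟩
          lap (detL vs) v cs * F (map e ps ++ map e cs) ∎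
          where
          alg : ∀ p q → 0ℤ + p * (1ℤ * q) ≡ p * q
          alg = solve-∀

        expand ps v vs qs [] sp len = refl
        expand ps v vs qs (b ∷ rs) sp len = begin
          v b * F (map e ps ++ e b ∷ vs) + sumL rs (λ b → v b * F (map e ps ++ e b ∷ vs))
            ≡⟨ cong₂ _+_ (cong (v b *_) first) rest ⟩
          v b * (detL vs (qs ++ rs) * (s * G)) + l * ((- s) * G)
            ≡⟨ alg (v b) (detL vs (qs ++ rs)) s G l ⟩
          (v b * detL vs (qs ++ rs) - l) * (s * G) ∎
          where
          s = sign (length qs)
          G = F (map e ps ++ map e (qs ++ b ∷ rs))
          l = lap (detL vs ∘ (qs ++_) ∘ (b ∷_)) v rs
          alg : ∀ v d s G l → v * (d * (s * G)) + l * ((- s) * G) ≡ (v * d - l) * (s * G)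
          alg = solve-∀
          first : F (map e ps ++ e b ∷ vs) ≡ detL vs (qs ++ rs) * (s * G)
          first = begin
            F (map e ps ++ e b ∷ vs)
              ≡⟨ cong F (trans (cong (_++ vs) (L.map-++ e ps [ b ])) (shift (map e ps) (e b) vs)) ⟨
            F (map e (ps ++ [ b ]) ++ vs)
              ≡⟨ uniqueness (ps ++ [ b ]) vs (qs ++ rs) (λ v c → trans (sp v c) (sym (rowSum-shift ps qs b rs v c)))
                   (ℕ.suc-injective (trans len (trans (L.length-++ qs) (trans (ℕ.+-suc (length qs) (length rs)) (cong suc (sym (L.length-++ qs))))))) ⟩
            detL vs (qs ++ rs) * F (map e (ps ++ [ b ]) ++ map e (qs ++ rs))
              ≡⟨ cong (λ z → detL vs (qs ++ rs) * F z) (trans (cong (_++ map e (qs ++ rs)) (L.map-++ e ps [ b ])) (trans (shift (map e ps) (e b) _) (cong (λ z → map e ps ++ e b ∷ z) (L.map-++ e qs rs)))) ⟩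
            detL vs (qs ++ rs) * F (map e ps ++ e b ∷ map e qs ++ map e rs)
              ≡⟨ cong (detL vs (qs ++ rs) *_) (F-move (map e ps) (e b) (map e qs) (map e rs)) ⟩
            detL vs (qs ++ rs) * (sign (length (map e qs)) * F (map e ps ++ map e qs ++ e b ∷ map e rs))
              ≡⟨ cong₂ (λ n z → detL vs (qs ++ rs) * (sign n * F (map e ps ++ z))) (L.length-map e qs) (sym (L.map-++ e qs (b ∷ rs))) ⟩
            detL vs (qs ++ rs) * (s * G) ∎
          rest : sumL rs (λ b → v b * F (map e ps ++ e b ∷ vs)) ≡ l * ((- s) * G)
          rest = begin
            sumL rs (λ b → v b * F (map e ps ++ e b ∷ vs))
              ≡⟨ expand ps v vs (qs ++ [ b ]) rs (λ v c → trans (sp v c) (cong (λ z → rowSum (ps ++ z) v c) (sym (shift qs b rs))))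
                   (trans len (cong length (sym (shift qs b rs)))) ⟩
            lap (detL vs ∘ ((qs ++ [ b ]) ++_)) v rs * (sign (length (qs ++ [ b ])) * F (map e ps ++ map e ((qs ++ [ b ]) ++ rs)))
              ≡⟨ cong₂ _*_ (lap-cong (λ z → cong (detL vs) (shift qs b z)) (λ _ → refl) rs)
                   (cong₂ _*_ (trans (cong sign (trans (L.length-++ qs) (ℕ.+-comm (length qs) 1))) (sign-suc (length qs)))
                      (cong (λ z → F (map e ps ++ map e z)) (shift qs b rs))) ⟩
            l * ((- s) * G) ∎

        used ps v vs [] = refl
        used ps v vs (b ∷ qs) = cong₂ _+_
          (trans (cong (v b *_) (F-repeat (map e ps) (e b) (map e qs) vs)) (ℤ.*-zeroʳ (v b)))
          (trans (sumL-cong qs (λ c → cong (λ z → v c * F z) (sym (trans (cong (_++ _) (L.map-++ e ps [ b ])) (shift (map e ps) (e b) _)))))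
             (used (ps ++ [ b ]) v vs qs))

  sumFin-cong : ∀ n {f g : Fin n → ℤ} → (∀ i → f i ≡ g i) → sumFin n f ≡ sumFin n g
  sumFin-cong zero    p = refl
  sumFin-cong (suc n) p = cong₂ _+_ (p zero) (sumFin-cong n (p ∘ suc))

  sumFin-zero : ∀ n → sumFin n (λ _ → 0ℤ) ≡ 0ℤ
  sumFin-zero zero    = refl
  sumFin-zero (suc n) = trans (ℤ.+-identityˡ _) (sumFin-zero n)

  sumFin-+ : ∀ n (f g : Fin n → ℤ) → sumFin n (λ i → f i + g i) ≡ sumFin n f + sumFin n g
  sumFin-+ zero    f g = refl
  sumFin-+ (suc n) f g rewrite sumFin-+ n (f ∘ suc) (g ∘ suc) =
    alg (f zero) (g zero) (sumFin n (f ∘ suc)) (sumFin n (g ∘ suc))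
    where
    alg : ∀ a b c d → (a + b) + (c + d) ≡ (a + c) + (b + d)
    alg = solve-∀

  sumFin-*ˡ : ∀ n x (f : Fin n → ℤ) → sumFin n (λ i → x * f i) ≡ x * sumFin n f
  sumFin-*ˡ zero    x f = sym (ℤ.*-zeroʳ x)
  sumFin-*ˡ (suc n) x f = trans (cong (x * f zero +_) (sumFin-*ˡ n x (f ∘ suc))) (sym (ℤ.*-distribˡ-+ x (f zero) _))

  sumFin-*ʳ : ∀ n x (f : Fin n → ℤ) → sumFin n (λ i → f i * x) ≡ sumFin n f * x
  sumFin-*ʳ n x f = trans (sumFin-cong n (λ i → ℤ.*-comm (f i) x)) (trans (sumFin-*ˡ n x f) (ℤ.*-comm x _))

  sumFin-neg : ∀ n (f : Fin n → ℤ) → sumFin n (λ i → - f i) ≡ - sumFin n f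
  sumFin-neg zero    f = refl
  sumFin-neg (suc n) f = trans (cong (- f zero +_) (sumFin-neg n (f ∘ suc))) (sym (ℤ.neg-distrib-+ (f zero) _))

  sumFin-swap : ∀ m n (f : Fin m → Fin n → ℤ) →
                sumFin m (λ i → sumFin n (f i)) ≡ sumFin n (λ j → sumFin m (λ i → f i j))
  sumFin-swap zero    n f = sym (sumFin-zero n)
  sumFin-swap (suc m) n f = trans (cong (sumFin n (f zero) +_) (sumFin-swap m n (f ∘ suc)))
                                  (sym (sumFin-+ n (f zero) _))

  sumL-tabulate : ∀ {B : Set} n (f : Fin n → B) g → sumL (tabulate f) g ≡ sumFin n (g ∘ f)
  sumL-tabulate zero    f g = refl
  sumL-tabulate (suc n) f g = cong (g (f zero) +_) (sumL-tabulate n (f ∘ suc) g)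

  δ : ∀ {n} → Fin n → Fin n → ℤ
  δ zero    zero    = 1ℤ
  δ zero    (suc _) = 0ℤ
  δ (suc _) zero    = 0ℤ
  δ (suc i) (suc j) = δ i j

  δ-refl : ∀ {n} (i : Fin n) → δ i i ≡ 1ℤ
  δ-refl zero    = refl
  δ-refl (suc i) = δ-refl i

  δ-≢ : ∀ {n} {i j : Fin n} → i ≢ j → δ i j ≡ 0ℤ
  δ-≢ {i = zero}  {zero}  p = ⊥-elim (p refl)
  δ-≢ {i = zero}  {suc j} p = refl
  δ-≢ {i = suc i} {zero}  p = refl
  δ-≢ {i = suc i} {suc j} p = δ-≢ (p ∘ cong suc)

  sumFin-δˡ : ∀ n (v : Fin n → ℤ) c → sumFin n (λ b → v b * δ b c) ≡ v c
  sumFin-δˡ (suc n) v zero = begin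
    v zero * 1ℤ + sumFin n (λ b → v (suc b) * 0ℤ)
      ≡⟨ cong₂ _+_ (ℤ.*-identityʳ (v zero)) (trans (sumFin-cong n (λ b → ℤ.*-zeroʳ (v (suc b)))) (sumFin-zero n)) ⟩
    v zero + 0ℤ ≡⟨ ℤ.+-identityʳ (v zero) ⟩
    v zero ∎
  sumFin-δˡ (suc n) v (suc c) = begin
    v zero * 0ℤ + sumFin n (λ b → v (suc b) * δ b c) ≡⟨ cong₂ _+_ (ℤ.*-zeroʳ (v zero)) (sumFin-δˡ n (v ∘ suc) c) ⟩
    0ℤ + v (suc c) ≡⟨ ℤ.+-identityˡ (v (suc c)) ⟩
    v (suc c) ∎

  δ-sym : ∀ {n} (i j : Fin n) → δ i j ≡ δ j i
  δ-sym zero    zero    = refl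
  δ-sym zero    (suc _) = refl
  δ-sym (suc _) zero    = refl
  δ-sym (suc i) (suc j) = δ-sym i j

  sumFin-δʳ : ∀ n (v : Fin n → ℤ) c → sumFin n (λ b → δ c b * v b) ≡ v c
  sumFin-δʳ n v c = trans (sumFin-cong n (λ b → trans (ℤ.*-comm (δ c b) (v b)) (cong (v b *_) (δ-sym c b)))) (sumFin-δˡ n v c)

  -- Deleting a later column keeps `f zero` in front, and the change of sign from one column to the
  -- next becomes the subtraction in `lap`.
  sumFin-lap : ∀ {B : Set} n h (v : B → ℤ) (f : Fin (suc n) → B) →
               sumFin (suc n) (λ j → sign (toℕ j) * v (f j) * h (tabulate (f ∘ punchIn j))) ≡ lap h v (tabulate f)
  sumFin-lap zero h v f = alg (v (f zero)) (h [])
    where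
    alg : ∀ x y → 1ℤ * x * y + 0ℤ ≡ x * y - 0ℤ
    alg = solve-∀
  sumFin-lap (suc n) h v f = cong₂ _+_ (cong (_* h (tabulate (f ∘ suc))) (ℤ.*-identityˡ (v (f zero)))) (begin
    sumFin (suc n) (λ j → sign (suc (toℕ j)) * v (f (suc j)) * h′ j)
      ≡⟨ sumFin-cong (suc n) (λ j → trans (cong (λ z → z * v (f (suc j)) * h′ j) (sign-suc (toℕ j))) (alg (sign (toℕ j)) (v (f (suc j))) (h′ j))) ⟩
    sumFin (suc n) (λ j → - (sign (toℕ j) * v (f (suc j)) * h′ j))
      ≡⟨ sumFin-neg (suc n) (λ j → sign (toℕ j) * v (f (suc j)) * h′ j) ⟩
    - sumFin (suc n) (λ j → sign (toℕ j) * v (f (suc j)) * h′ j)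
      ≡⟨ cong -_ (sumFin-lap n (h ∘ (f zero ∷_)) v (f ∘ suc)) ⟩
    - lap (h ∘ (f zero ∷_)) v (tabulate (f ∘ suc)) ∎)
    where
    h′ : Fin (suc n) → ℤ
    h′ j = h (f zero ∷ tabulate (f ∘ suc ∘ punchIn j))
    alg : ∀ s x y → - s * x * y ≡ - (s * x * y)
    alg = solve-∀

  det-detL : ∀ {B : Set} n (w : Fin n → B → ℤ) (f : Fin n → B) →
             det n (λ s t → w s (f t)) ≡ detL (tabulate w) (tabulate f)
  det-detL zero    w f = refl
  det-detL (suc n) w f = trans
    (sumFin-cong (suc n) (λ j → cong (sign (toℕ j) * w zero (f j) *_) (det-detL n (w ∘ suc) (f ∘ punchIn j))))
    (sumFin-lap n (detL (tabulate (w ∘ suc))) (w zero) f)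

  tabulate-≐ : ∀ {B : Set} n {w w′ : Fin n → B → ℤ} → (∀ i b → w i b ≡ w′ i b) → tabulate w ≐ tabulate w′
  tabulate-≐ zero    p = []
  tabulate-≐ (suc n) p = p zero ∷ tabulate-≐ n (p ∘ suc)

  det-cong : ∀ n {M M′ : Fin n → Fin n → ℤ} → (∀ i j → M i j ≡ M′ i j) → det n M ≡ det n M′
  det-cong n {M} {M′} p = begin
    det n M ≡⟨ det-detL n M id ⟩
    detL (tabulate M) (allFin n) ≡⟨ detL-cong (tabulate-≐ n p) (allFin n) ⟩
    detL (tabulate M′) (allFin n) ≡⟨ det-detL n M′ id ⟨
    det n M′ ∎

  _⊡_ : ∀ {m n k} → (Fin m → Fin n → ℤ) → (Fin n → Fin k → ℤ) → Fin m → Fin k → ℤ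
  _⊡_ {n = n} A B i j = sumFin n (λ k → A i k * B k j)

  -- As a function of the rows of `A`, the left-hand side is alternating. By `uniqueness` it is
  -- `det n A` times its value at the identity, which is `det n B`.
  det-⊡ : ∀ n (A B : Fin n → Fin n → ℤ) → det n (A ⊡ B) ≡ det n A * det n B
  det-⊡ n A B = begin
    det n (A ⊡ B) ≡⟨ det-detL n (A ⊡ B) id ⟩
    detL (tabulate (A ⊡ B)) cs ≡⟨ cong (λ z → detL z cs) (L.map-tabulate A rowB) ⟨
    F (tabulate A) ≡⟨ uniqueness [] (tabulate A) cs spans (trans (L.length-tabulate A) (sym (L.length-tabulate id))) ⟩
    detL (tabulate A) cs * F (map δ cs) ≡⟨ cong₂ _*_ (sym (det-detL n A id)) unit ⟩
    det n A * det n B ∎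
    where
    cs = allFin n
    rowB : (Fin n → ℤ) → Fin n → ℤ
    rowB v j = sumFin n (λ k → v k * B k j)
    F : List (Fin n → ℤ) → ℤ
    F vs = detL (map rowB vs) cs
    F-alternating : Alternating F
    F-alternating = record
      { F-cong = λ p → detL-cong (PW.map⁺ rowB rowB (PW.map (λ q j → sumFin-cong n (λ k → cong (_* B k j) (q k))) p)) cs
      ; F-linear = λ xs ys x v y w → begin
          detL (map rowB (xs ++ comb x v y w ∷ ys)) cs
            ≡⟨ cong (λ z → detL z cs) (L.map-++ rowB xs _) ⟩
          detL (map rowB xs ++ rowB (comb x v y w) ∷ map rowB ys) cs
            ≡⟨ AlternatingProperties.F-congAt (detL-alternating cs) (map rowB xs) (map rowB ys) (row-linear x v y w) ⟩
          detL (map rowB xs ++ comb x (rowB v) y (rowB w) ∷ map rowB ys) cs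
            ≡⟨ detL-linear (map rowB xs) (map rowB ys) x (rowB v) y (rowB w) cs ⟩
          x * detL (map rowB xs ++ rowB v ∷ map rowB ys) cs + y * detL (map rowB xs ++ rowB w ∷ map rowB ys) cs
            ≡⟨ cong₂ (λ p q → x * detL p cs + y * detL q cs) (L.map-++ rowB xs _) (L.map-++ rowB xs _) ⟨
          x * detL (map rowB (xs ++ v ∷ ys)) cs + y * detL (map rowB (xs ++ w ∷ ys)) cs ∎
      ; F-alt = λ xs v ys → trans (cong (λ z → detL z cs) (L.map-++ rowB xs _))
                                  (detL-alt (map rowB xs) (rowB v) (map rowB ys) cs)
      }
      where
      row-linear : ∀ x v y w j → rowB (comb x v y w) j ≡ comb x (rowB v) y (rowB w) j
      row-linear x v y w j = begin
        sumFin n (λ k → (x * v k + y * w k) * B k j)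
          ≡⟨ sumFin-cong n (λ k → alg x (v k) y (w k) (B k j)) ⟩
        sumFin n (λ k → x * (v k * B k j) + y * (w k * B k j))
          ≡⟨ sumFin-+ n (λ k → x * (v k * B k j)) (λ k → y * (w k * B k j)) ⟩
        sumFin n (λ k → x * (v k * B k j)) + sumFin n (λ k → y * (w k * B k j))
          ≡⟨ cong₂ _+_ (sumFin-*ˡ n x (λ k → v k * B k j)) (sumFin-*ˡ n y (λ k → w k * B k j)) ⟩
        x * rowB v j + y * rowB w j ∎
        where
        alg : ∀ x v y w b → (x * v + y * w) * b ≡ x * (v * b) + y * (w * b)
        alg = solve-∀
    open AlternatingProperties F-alternating using (module Expansion)
    open Expansion δ using (uniqueness; Spans)
    spans : Spans [] cs
    spans v c = sym (trans (sumL-tabulate n id (λ b → v b * δ b c)) (sumFin-δˡ n v c))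
    unit : F (map δ cs) ≡ det n B
    unit = begin
      detL (map rowB (map δ cs)) cs ≡⟨ cong (λ z → detL (map rowB z) cs) (L.map-tabulate id δ) ⟩
      detL (map rowB (tabulate δ)) cs ≡⟨ cong (λ z → detL z cs) (L.map-tabulate δ rowB) ⟩
      detL (tabulate (rowB ∘ δ)) cs ≡⟨ detL-cong (tabulate-≐ n (λ i j → sumFin-δʳ n (λ k → B k j) i)) cs ⟩
      detL (tabulate B) cs ≡⟨ det-detL n B id ⟨
      det n B ∎

  det-zeroRow : ∀ n (M : Fin (suc n) → Fin (suc n) → ℤ) → (∀ j → M zero j ≡ 0ℤ) → det (suc n) M ≡ 0ℤ
  det-zeroRow n M p = trans
    (sumFin-cong (suc n) (λ j → trans (cong (λ z → sign (toℕ j) * z * d j) (p j)) (cong (_* d j) (ℤ.*-zeroʳ (sign (toℕ j))))))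
    (sumFin-zero (suc n))
    where
    d : Fin (suc n) → ℤ
    d j = det n (λ r s → M (suc r) (punchIn j s))

  det-δ : ∀ n → det n δ ≡ 1ℤ
  det-δ zero = refl
  det-δ (suc n) = begin
    1ℤ * 1ℤ * det n δ + sumFin n (λ j → sign (suc (toℕ j)) * 0ℤ * d (suc j))
      ≡⟨ cong₂ (λ p q → 1ℤ * 1ℤ * p + q) (det-δ n) (trans (sumFin-cong n (λ j → cong (_* d (suc j)) (ℤ.*-zeroʳ (sign (suc (toℕ j)))))) (sumFin-zero n)) ⟩
    1ℤ * 1ℤ * 1ℤ + 0ℤ ≡⟨⟩
    1ℤ ∎
    where
    d : Fin (suc n) → ℤ
    d j = det n (λ r s → δ (suc r) (punchIn j s))

  det-unit : ∀ n (A B : Fin n → Fin n → ℤ) → (∀ i j → (A ⊡ B) i j ≡ δ i j) → ∣ det n A ∣ ≡ 1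
  det-unit n A B p = ℕ.m*n≡1⇒m≡1 ∣ det n A ∣ ∣ det n B ∣ (begin
    ∣ det n A ∣ ℕ.* ∣ det n B ∣ ≡⟨ ℤ.abs-* (det n A) (det n B) ⟨
    ∣ det n A * det n B ∣ ≡⟨ cong ∣_∣ (det-⊡ n A B) ⟨
    ∣ det n (A ⊡ B) ∣ ≡⟨ cong ∣_∣ (trans (det-cong n p) (det-δ n)) ⟩
    1 ∎)

  pad : ∀ {m n} → m ℕ.≤ n → (Fin m → ℤ) → Fin n → ℤ
  pad z≤n     f _       = 0ℤ
  pad (s≤s p) f zero    = f zero
  pad (s≤s p) f (suc i) = pad p (f ∘ suc) i

  sumFin-pad : ∀ {m n} (p : m ℕ.≤ n) (f g : Fin m → ℤ) →
               sumFin n (λ i → pad p f i * pad p g i) ≡ sumFin m (λ i → f i * g i)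
  sumFin-pad {n = n} z≤n f g = sumFin-zero n
  sumFin-pad (s≤s p)     f g = cong (f zero * g zero +_) (sumFin-pad p (f ∘ suc) (g ∘ suc))

  -- If n < m, a zero column (for `A`) and a zero row (for `B`) pad both factors to square matrices
  -- with the same product. Then the identity would have determinant 0.
  ⊡-δ⇒≤ : ∀ m n (A : Fin m → Fin n → ℤ) (B : Fin n → Fin m → ℤ) →
           (∀ i j → (A ⊡ B) i j ≡ δ i j) → m ℕ.≤ n
  ⊡-δ⇒≤ m n A B p with m ℕ.≤? n
  ... | yes m≤n = m≤n
  ... | no  m≰n with ℕ.≰⇒> m≰n
  ⊡-δ⇒≤ (suc m) n A B p | no _ | s≤s n≤m = ⊥-elim (1≢0 (begin
    1 ≡⟨ cong ∣_∣ (det-δ (suc m)) ⟨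
    ∣ det (suc m) δ ∣ ≡⟨ cong ∣_∣ (det-cong (suc m) (λ i j → trans (prod i j) (p i j))) ⟨
    ∣ det (suc m) (Â ⊡ B̂) ∣ ≡⟨ cong ∣_∣ (det-⊡ (suc m) Â B̂) ⟩
    ∣ det (suc m) Â * det (suc m) B̂ ∣ ≡⟨ cong (λ z → ∣ det (suc m) Â * z ∣) (det-zeroRow m B̂ (λ _ → refl)) ⟩
    ∣ det (suc m) Â * 0ℤ ∣ ≡⟨ cong ∣_∣ (ℤ.*-zeroʳ (det (suc m) Â)) ⟩
    0 ∎))
    where
    1≢0 : 1 ≢ 0
    1≢0 ()
    Â B̂ : Fin (suc m) → Fin (suc m) → ℤ
    Â i zero    = 0ℤ
    Â i (suc k) = pad n≤m (A i) k
    B̂ zero    j = 0ℤ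
    B̂ (suc k) j = pad n≤m (λ k → B k j) k
    prod : ∀ i j → (Â ⊡ B̂) i j ≡ (A ⊡ B) i j
    prod i j = trans (ℤ.+-identityˡ _) (sumFin-pad n≤m (A i) (λ k → B k j))

-- The signed adjacency matrix of the region, and its expansion along one row of vertices.

module RowExpansion where

  open Determinants
  open import Data.Maybe using (Maybe; just; nothing; maybe′)
  open import Data.Integer using (_+_; _*_; _-_)
  open import Data.Integer.Tactic.RingSolver using (solve-∀)
  open import Data.List.Relation.Unary.All as All using (All; []; _∷_)
  import Data.List.Relation.Unary.All.Properties as All
  open import Data.Unit using (⊤; tt)
  open ≡-Reasoning

  ind : ℕ → ℕ → ℤ
  ind zero    zero    = 1ℤ
  ind zero    (suc _) = 0ℤ
  ind (suc _) zero    = 0ℤ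
  ind (suc m) (suc n) = ind m n

  ind-refl : ∀ n → ind n n ≡ 1ℤ
  ind-refl zero    = refl
  ind-refl (suc n) = ind-refl n

  ind-≢ : ∀ {m n} → m ≢ n → ind m n ≡ 0ℤ
  ind-≢ {zero}  {zero}  p = ⊥-elim (p refl)
  ind-≢ {zero}  {suc n} p = refl
  ind-≢ {suc m} {zero}  p = refl
  ind-≢ {suc m} {suc n} p = ind-≢ (p ∘ cong suc)

  Vertex : Set
  Vertex = ℕ × ℕ

  -- Multiplication by x + y + z on alternating monomials.  The minus sign comes from scaling the basis
  -- vector at (r , k) by (-1)^k, which makes all perfect matchings contribute with the same sign.
  adj : Vertex → Vertex → ℤ
  adj (r , k) (r′ , k′) = ind r r′ * ind k k′ + ind r (suc r′) * ind k k′ - ind r r′ * ind k (suc k′)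

  adj-x : ∀ r k → adj (r , k) (r , k) ≡ 1ℤ
  adj-x r k rewrite ind-refl r | ind-refl k | ind-≢ {r} {suc r} (ℕ.<⇒≢ (ℕ.n<1+n r)) | ind-≢ {k} {suc k} (ℕ.<⇒≢ (ℕ.n<1+n k)) = refl

  adj-y : ∀ r k → adj (suc r , k) (r , k) ≡ 1ℤ
  adj-y r k rewrite ind-refl r | ind-refl k | ind-≢ {suc r} {r} (ℕ.>⇒≢ (ℕ.n<1+n r)) = refl

  adj-z : ∀ r k → adj (r , suc k) (r , k) ≡ - 1ℤ
  adj-z r k rewrite ind-refl r | ind-refl k | ind-≢ {suc k} {k} (ℕ.>⇒≢ (ℕ.n<1+n k)) | ind-≢ {r} {suc r} (ℕ.<⇒≢ (ℕ.n<1+n r)) = refl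

  adj-far : ∀ {r r′} k k′ → r ≢ r′ → r ≢ suc r′ → adj (r , k) (r′ , k′) ≡ 0ℤ
  adj-far {r} {r′} k k′ p q rewrite ind-≢ p | ind-≢ q = refl

  adj-row : ∀ r {k k′} → k ≢ k′ → k ≢ suc k′ → adj (r , k) (r , k′) ≡ 0ℤ
  adj-row r {k} {k′} p q rewrite ind-≢ p | ind-≢ q | ℤ.*-zeroʳ (ind r r) | ℤ.*-zeroʳ (ind r (suc r)) = refl

  adj-up : ∀ r {k k′} → k ≢ k′ → adj (suc r , k) (r , k′) ≡ 0ℤ
  adj-up r {k} {k′} p rewrite ind-≢ p | ind-≢ {suc r} {r} (ℕ.>⇒≢ (ℕ.n<1+n r)) | ℤ.*-zeroʳ (ind r r) = refl

  module _ {B : Set} where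

    lap-skip : ∀ h (v : B → ℤ) {xs} ys → All (λ b → v b ≡ 0ℤ) xs →
               lap h v (xs ++ ys) ≡ sign (length xs) * lap (h ∘ (xs ++_)) v ys
    lap-skip h v ys [] = sym (ℤ.*-identityˡ _)
    lap-skip h v {x ∷ xs} ys (p ∷ ps) rewrite p | lap-skip (h ∘ (x ∷_)) v ys ps | sign-suc (length xs) =
      alg (sign (length xs)) (lap (h ∘ (x ∷_) ∘ (xs ++_)) v ys)
      where
      alg : ∀ s l → 0ℤ - s * l ≡ - s * l
      alg = solve-∀

    lap-none : ∀ h (v : B → ℤ) {xs} → All (λ b → v b ≡ 0ℤ) xs → lap h v xs ≡ 0ℤ
    lap-none h v [] = refl
    lap-none h v {x ∷ xs} (p ∷ ps) rewrite p | lap-none (h ∘ (x ∷_)) v ps = refl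

    -- Discards the partial matchings that leave a black without any remaining white neighbour.
    detL-isolated : ∀ {vs} (u : B) → All (λ v → v u ≡ 0ℤ) vs → ∀ pre post → detL vs (pre ++ u ∷ post) ≡ 0ℤ
    detL-isolated u []       []      post = refl
    detL-isolated u []       (_ ∷ _) post = refl
    detL-isolated u (_∷_ {v} {vs} p ps) pre post = go (detL vs) (detL-isolated u ps) pre
      where
      go : ∀ h → (∀ pre post → h (pre ++ u ∷ post) ≡ 0ℤ) → ∀ pre → lap h v (pre ++ u ∷ post) ≡ 0ℤ
      go h z []        rewrite p | lap-zero v (z []) post = refl
      go h z (x ∷ pre) rewrite z pre post | go (h ∘ (x ∷_)) (z ∘ (x ∷_)) pre | ℤ.*-zeroʳ (v x) = refl

  detA : List Vertex → List Vertex → ℤ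
  detA ws = detL (map adj ws)

  run : ℕ → ℕ → List ℕ
  run k zero    = []
  run k (suc n) = k ∷ run (suc k) n

  run-≥ : ∀ k n → All (k ≤_) (run k n)
  run-≥ k zero    = []
  run-≥ k (suc n) = ℕ.≤-refl ∷ All.map (ℕ.≤-trans (ℕ.n≤1+n k)) (run-≥ (suc k) n)

  -- Sets of free blacks are increasing lists scanned from the left, so only the head can sit at the
  -- current position.
  match : ℕ → List ℕ → Maybe (List ℕ)
  match k []      = nothing
  match k (u ∷ U) with u ℕ.≟ k
  ... | yes _ = just U
  ... | no  _ = nothing

  Above : ℕ → List ℕ → Set
  Above k []      = ⊤
  Above k (u ∷ U) = k ≤ u × Above (suc u) U

  above-all : ∀ {k} U → Above k U → All (k ≤_) U
  above-all []      _       = []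
  above-all (u ∷ U) (p , a) = p ∷ All.map (ℕ.≤-trans (ℕ.≤-trans p (ℕ.n≤1+n u))) (above-all U a)

  match-just : ∀ {k} U {U′} → match k U ≡ just U′ → U ≡ k ∷ U′
  match-just {k} (u ∷ U) e with u ℕ.≟ k
  match-just {k} (u ∷ U) refl | yes refl = refl

  match-hit : ∀ k U → match k (k ∷ U) ≡ just U
  match-hit k U with k ℕ.≟ k
  ... | yes _ = refl
  ... | no ¬p = ⊥-elim (¬p refl)

  match-nothing : ∀ {k} U → match k U ≡ nothing → Above k U → Above (suc k) U
  match-nothing [] e a = tt
  match-nothing {k} (u ∷ U) e (p , a) with u ℕ.≟ k
  match-nothing {k} (u ∷ U) e (p , a) | no ¬q = ℕ.≤∧≢⇒< p (¬q ∘ sym) , a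

  -- Whites and blacks of one row alternate.  A white at k is joined to the blacks at k - 1 and k of its
  -- row and to the black at k of the previous row.  Given the set U of blacks of the previous row that
  -- are still free, `unused` and `used` list the possible sets of blacks of the row left free for the next one;
  -- n is the number of remaining (white, black) pairs and the flag says whether a further white ends the row.
  unused : Bool → ℕ → ℕ → List ℕ → List (List ℕ)
  used   : Bool → ℕ → ℕ → List ℕ → List (List ℕ)

  endUnused : Bool → ℕ → List ℕ → List (List ℕ)
  endUnused false k []      = [ [ k ] ]
  endUnused false k (_ ∷ _) = []
  endUnused true  k U with match (suc k) U
  ... | just []      = [ [ k ] ]
  ... | just (_ ∷ _) = []
  ... | nothing with U
  ...   | []    = [ [] ]
  ...   | _ ∷ _ = []

  endUsed : Bool → ℕ → List ℕ → List (List ℕ)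
  endUsed false k []      = [ [] ]
  endUsed false k (_ ∷ _) = []
  endUsed true  k U with match k U
  ... | just []      = [ [] ]
  ... | just (_ ∷ _) = []
  ... | nothing      = []

  unused e k zero    U = endUnused e k U
  -- If the black at `suc k` of the previous row is free, the white at `suc k` is its last neighbour
  -- and must take it, so `k` stays free. Otherwise the white takes `suc k`, which leaves `k` free,
  -- or it takes `k`.
  unused e k (suc n) U =
    maybe′ (λ U′ → map (k ∷_) (unused e (suc k) n U′))
           (map (k ∷_) (used e (suc (suc k)) n U) ++ unused e (suc k) n U)
           (match (suc k) U)

  used e k zero    U = endUsed e k U
  used e k (suc n) U = maybe′ (unused e k n) (used e (suc k) n U) (match k U)

  extra : Bool → ℕ
  extra false = 0
  extra true  = 1

  sign-odd : ∀ θ m → sign (θ ℕ.* suc m) ≡ sign θ * sign (θ ℕ.* m)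
  sign-odd θ m = trans (cong sign (ℕ.*-suc θ m)) (sign-+ θ (θ ℕ.* m))

  sign² : ∀ n → sign n * sign n ≡ 1ℤ
  sign² zero          = refl
  sign² (suc zero)    = refl
  sign² (suc (suc n)) = sign² n

  sign-even : ∀ θ m → sign (θ ℕ.* suc (suc m)) ≡ sign (θ ℕ.* m)
  sign-even θ m = begin
    sign (θ ℕ.* suc (suc m)) ≡⟨ trans (sign-odd θ (suc m)) (cong (sign θ *_) (sign-odd θ m)) ⟩
    sign θ * (sign θ * sign (θ ℕ.* m)) ≡⟨ ℤ.*-assoc (sign θ) (sign θ) _ ⟨
    sign θ * sign θ * sign (θ ℕ.* m) ≡⟨ cong (_* sign (θ ℕ.* m)) (sign² θ) ⟩
    1ℤ * sign (θ ℕ.* m) ≡⟨ ℤ.*-identityˡ _ ⟩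
    sign (θ ℕ.* m) ∎

  sumL-map : ∀ {X Y : Set} (g : X → Y) xs f → sumL (map g xs) f ≡ sumL xs (f ∘ g)
  sumL-map g []       f = refl
  sumL-map g (x ∷ xs) f = cong (f (g x) +_) (sumL-map g xs f)

  -- `ws` and `bs` are the vertices beyond row `suc q`. Since they touch neither the blacks of row
  -- `q` nor the whites of row `suc q`, the free blacks of row `q` have to be matched within row
  -- `suc q`.
  module Row (q : ℕ) (ws bs : List Vertex)
             (q-far : ∀ u → All (λ w → adj w (q , u) ≡ 0ℤ) ws)
             (bs-far : ∀ k → All (λ b → adj (suc q , k) b ≡ 0ℤ) bs) where

    up row : List ℕ → List Vertex
    up  = map (q ,_)
    row = map (suc q ,_)

    -- The column order during the expansion: free blacks of the previous row, blacks of this row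
    -- already left free, and everything not yet reached.
    front : List ℕ → List ℕ → List Vertex → List Vertex
    front U V X = up U ++ row V ++ X

    result : List ℕ → List (List ℕ) → ℤ
    result V Vs = sumL Vs (λ V′ → detA ws (row V ++ row V′ ++ bs))

    result-shift : ∀ V k Vs → result (V ++ [ k ]) Vs ≡ result V (map (k ∷_) Vs)
    result-shift V k Vs = sym (trans (sumL-map (k ∷_) Vs _)
      (sumL-cong Vs (λ V′ → cong (detA ws) (sym (trans (cong (_++ row V′ ++ bs) (L.map-++ _ V [ k ])) (L.++-assoc (row V) (row [ k ]) _))))))

    front-shift : ∀ U V k X → front U (V ++ [ k ]) X ≡ front U V ((suc q , k) ∷ X)
    front-shift U V k X = cong (up U ++_) (trans (cong (_++ X) (L.map-++ _ V [ k ])) (L.++-assoc (row V) (row [ k ]) X))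

    length-snoc : ∀ (V : List ℕ) k → length (V ++ [ k ]) ≡ suc (length V)
    length-snoc V k = trans (L.length-++ V) (ℕ.+-comm (length V) 1)

    whites : ℕ → ℕ → List Vertex
    whites k n = row (run k n) ++ ws

    white-isolated : ∀ k n → All (λ w → adj w (q , k) ≡ 0ℤ) (whites (suc k) n)
    white-isolated k n = All.++⁺ (All.map⁺ (All.map (λ p → adj-up q (ℕ.>⇒≢ p)) (run-≥ (suc k) n))) (q-far k)

    isolated : ∀ {ws′} u → All (λ w → adj w (q , u) ≡ 0ℤ) ws′ → ∀ X → detA ws′ ((q , u) ∷ X) ≡ 0ℤ
    isolated u p X = detL-isolated (q , u) (All.map⁺ p) [] X

    Behind : ℕ → List ℕ → Set
    Behind k V = All (λ v → suc v < k) V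

    front-far : ∀ {k} U V → Above (suc k) U → Behind k V → All (λ b → adj (suc q , k) b ≡ 0ℤ) (up U ++ row V)
    front-far U V a b = All.++⁺
      (All.map⁺ (All.map (λ p → adj-up q (ℕ.<⇒≢ p)) (above-all U a)))
      (All.map⁺ (All.map (λ p → adj-row (suc q) (ℕ.>⇒≢ (ℕ.<-trans (ℕ.n<1+n _) p)) (ℕ.>⇒≢ p)) b))

    length-front : ∀ U V → length (up U ++ row V) ≡ length U ℕ.+ length V
    length-front U V = trans (L.length-++ (up U)) (cong₂ ℕ._+_ (L.length-map _ U) (L.length-map _ V))

    lap-front : ∀ h {k} U V X → Above (suc k) U → Behind k V →
      lap h (adj (suc q , k)) (front U V X) ≡
      sign (length U ℕ.+ length V) * lap (h ∘ front U V) (adj (suc q , k)) X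
    lap-front h {k} U V X a b = begin
      lap h (adj (suc q , k)) (front U V X)
        ≡⟨ cong (lap h _) (L.++-assoc (up U) (row V) X) ⟨
      lap h (adj (suc q , k)) ((up U ++ row V) ++ X)
        ≡⟨ lap-skip h _ X (front-far U V a b) ⟩
      sign (length (up U ++ row V)) * lap (h ∘ ((up U ++ row V) ++_)) (adj (suc q , k)) X
        ≡⟨ cong₂ (λ n l → sign n * l) (length-front U V) (lap-cong (λ Y → cong h (L.++-assoc (up U) (row V) Y)) (λ _ → refl) X) ⟩
      sign (length U ℕ.+ length V) * lap (h ∘ front U V) (adj (suc q , k)) X ∎

    later-far : ∀ k n → All (λ b → adj (suc q , k) b ≡ 0ℤ) (row (run (suc k) n) ++ bs)
    later-far k n = All.++⁺ (All.map⁺ (All.map (λ p → adj-row (suc q) (ℕ.<⇒≢ p) (ℕ.<⇒≢ (ℕ.<-trans p (ℕ.n<1+n _)))) (run-≥ (suc k) n))) (bs-far k)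

    -- The black at `k` of the previous row has no white neighbour after this one, so every other
    -- term contains an isolated column.
    hit : ∀ k n U V X → lap (detA (whites (suc k) n)) (adj (suc q , k)) (front (k ∷ U) V X) ≡ detA (whites (suc k) n) (front U V X)
    hit k n U V X = begin
      adj (suc q , k) (q , k) * h (front U V X) - lap (h ∘ ((q , k) ∷_)) (adj (suc q , k)) (front U V X)
        ≡⟨ cong₂ (λ p l → p * h (front U V X) - l) (adj-y q k) (lap-zero (adj (suc q , k)) (isolated k (white-isolated k n)) (front U V X)) ⟩
      1ℤ * h (front U V X) - 0ℤ
        ≡⟨ alg (h (front U V X)) ⟩
      h (front U V X) ∎
      where
      h = detA (whites (suc k) n)
      alg : ∀ x → 1ℤ * x - 0ℤ ≡ x
      alg = solve-∀

    miss-used : ∀ h k n → lap h (adj (suc q , k)) ((suc q , k) ∷ row (run (suc k) n) ++ bs) ≡ h (row (run (suc k) n) ++ bs)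
    miss-used h k n rewrite adj-x (suc q) k | lap-none (h ∘ ((suc q , k) ∷_)) (adj (suc q , k)) (later-far k n) = alg (h (row (run (suc k) n) ++ bs))
      where
      alg : ∀ x → 1ℤ * x - 0ℤ ≡ x
      alg = solve-∀

    -- The blacks `k` and `suc k` are adjacent columns with opposite cofactor signs; the entry -1 at
    -- `k` gives both terms the same sign.
    miss-unused : ∀ h k n → let X = row (run (suc (suc k)) n) ++ bs in
      lap h (adj (suc q , suc k)) ((suc q , k) ∷ (suc q , suc k) ∷ X) ≡
      - (h ((suc q , suc k) ∷ X) + h ((suc q , k) ∷ X))
    miss-unused h k n rewrite adj-z (suc q) k | miss-used (h ∘ ((suc q , k) ∷_)) (suc k) n = alg (h ((suc q , suc k) ∷ row (run (suc (suc k)) n) ++ bs)) (h ((suc q , k) ∷ row (run (suc (suc k)) n) ++ bs))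
      where
      alg : ∀ x y → - 1ℤ * x - y ≡ - (x + y)
      alg = solve-∀

    behind-suc : ∀ {k V} → Behind k V → Behind (suc k) V
    behind-suc = All.map (λ p → ℕ.<-trans p (ℕ.n<1+n _))

    behind-snoc : ∀ {k V} → Behind (suc k) V → Behind (suc (suc k)) (V ++ [ k ])
    behind-snoc b = All.++⁺ (behind-suc b) (ℕ.n<1+n _ ∷ [])

    result-[] : ∀ V V′ → result V [ V′ ] ≡ detA ws (row V ++ row V′ ++ bs)
    result-[] V V′ = ℤ.+-identityʳ _

    private
      sign-zero : ∀ θ x → x ≡ sign (θ ℕ.* 0) * x
      sign-zero θ x rewrite ℕ.*-zeroʳ θ = sym (ℤ.*-identityˡ x)

      twice : ∀ n e u → suc (suc (n ℕ.+ (e ℕ.+ u))) ≡ suc (n ℕ.+ (e ℕ.+ suc u))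
      twice n e u = cong suc (trans (sym (ℕ.+-suc n (e ℕ.+ u))) (cong (n ℕ.+_) (sym (ℕ.+-suc e u))))

      sign-two : ∀ θ x → x ≡ sign (θ ℕ.* 2) * x
      sign-two θ x rewrite sign-even θ 0 = sign-zero θ x

      vanish : ∀ s {x} → x ≡ 0ℤ → x ≡ s * 0ℤ
      vanish s p = trans p (sym (ℤ.*-zeroʳ s))

    unused-step : ∀ θ m A x y {a b} → θ ≡ suc A → x ≡ sign (θ ℕ.* m) * a → y ≡ sign (θ ℕ.* m) * b →
                  sign A * (- (x + y)) ≡ sign (θ ℕ.* suc m) * (b + a)
    unused-step θ m A x y {a} {b} refl refl refl
      rewrite sign-odd (suc A) m | sign-suc A = alg (sign A) (sign (suc A ℕ.* m)) a b
      where
      alg : ∀ s t a b → s * (- (t * a + t * b)) ≡ - s * t * (b + a)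
      alg = solve-∀

    used-step : ∀ θ m A x {a} → θ ≡ A → x ≡ sign (θ ℕ.* m) * a → sign A * x ≡ sign (θ ℕ.* suc m) * a
    used-step θ m A x {a} refl refl rewrite sign-odd A m = sym (ℤ.*-assoc (sign A) (sign (A ℕ.* m)) a)

    -- `θ` counts the blacks of `U` and `V` and the pending black `k`. It is constant along the row,
    -- for a hit takes one element from `U` and leaves one more black of the row free. A white that
    -- takes a black of its own row contributes `sign θ` and lowers `n + extra e + length U` by one;
    -- a hit contributes no sign and lowers it by two. Hence the sign is independent of all choices.
    detA-unused : ∀ e n k U V → Above (suc k) U → Behind (suc k) V → ∀ θ → θ ≡ suc (length U ℕ.+ length V) →
      detA (whites (suc k) (n ℕ.+ extra e)) (front U V ((suc q , k) ∷ row (run (suc k) n) ++ bs)) ≡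
      sign (θ ℕ.* (n ℕ.+ (extra e ℕ.+ length U))) * result V (unused e k n U)

    detA-used : ∀ e n k U V → Above k U → Behind k V → ∀ θ → θ ≡ length U ℕ.+ length V →
      detA (whites k (n ℕ.+ extra e)) (front U V (row (run k n) ++ bs)) ≡
      sign (θ ℕ.* (n ℕ.+ (extra e ℕ.+ length U))) * result V (used e k n U)

    detA-unused e (suc n) k U V a b θ eq with match (suc k) U in m
    ... | nothing = begin
      lap h (adj (suc q , suc k)) (front U V ((suc q , k) ∷ (suc q , suc k) ∷ X))
        ≡⟨ lap-front h U V _ a′ b ⟩
      sign A * lap (h ∘ front U V) (adj (suc q , suc k)) ((suc q , k) ∷ (suc q , suc k) ∷ X)
        ≡⟨ cong (sign A *_) (miss-unused (h ∘ front U V) k n) ⟩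
      sign A * (- (h (front U V ((suc q , suc k) ∷ X)) + h (front U V ((suc q , k) ∷ X))))
        ≡⟨ unused-step θ l A _ _ eq
             (detA-unused e n (suc k) U V a′ (behind-suc b) θ eq)
             (trans (cong h (sym (front-shift U V k X)))
                (detA-used e n (suc (suc k)) U (V ++ [ k ]) a′ (behind-snoc b) θ
                   (trans eq (trans (sym (ℕ.+-suc (length U) (length V))) (cong (length U ℕ.+_) (sym (length-snoc V k))))))) ⟩
      sign (θ ℕ.* suc l) * (result (V ++ [ k ]) (used e (suc (suc k)) n U) + result V (unused e (suc k) n U))
        ≡⟨ cong (sign (θ ℕ.* suc l) *_)
             (trans (cong (_+ result V (unused e (suc k) n U)) (result-shift V k (used e (suc (suc k)) n U)))
                    (sym (sumL-++ (map (k ∷_) (used e (suc (suc k)) n U)) _ _))) ⟩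
      sign (θ ℕ.* suc l) * result V (map (k ∷_) (used e (suc (suc k)) n U) ++ unused e (suc k) n U) ∎
      where
      h = detA (whites (suc (suc k)) (n ℕ.+ extra e))
      A = length U ℕ.+ length V
      l = n ℕ.+ (extra e ℕ.+ length U)
      X = row (run (suc (suc k)) n) ++ bs
      a′ = match-nothing U m a
    ... | just U′ with match-just U m
    detA-unused e (suc n) k .(suc k ∷ U′) V (_ , a′) b θ eq | just U′ | refl = begin
      lap h (adj (suc q , suc k)) (front (suc k ∷ U′) V ((suc q , k) ∷ (suc q , suc k) ∷ X))
        ≡⟨ hit (suc k) (n ℕ.+ extra e) U′ V _ ⟩
      h (front U′ V ((suc q , k) ∷ (suc q , suc k) ∷ X))
        ≡⟨ cong h (front-shift U′ V k _) ⟨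
      h (front U′ (V ++ [ k ]) ((suc q , suc k) ∷ X))
        ≡⟨ detA-unused e n (suc k) U′ (V ++ [ k ]) a′ (behind-snoc b) θ
             (trans eq (cong suc (trans (sym (ℕ.+-suc (length U′) (length V))) (cong (length U′ ℕ.+_) (sym (length-snoc V k)))))) ⟩
      sign (θ ℕ.* (n ℕ.+ (extra e ℕ.+ length U′))) * result (V ++ [ k ]) (unused e (suc k) n U′)
        ≡⟨ cong₂ _*_ (trans (sym (sign-even θ _)) (cong (λ z → sign (θ ℕ.* z)) (twice n (extra e) (length U′))))
             (result-shift V k (unused e (suc k) n U′)) ⟩
      sign (θ ℕ.* suc (n ℕ.+ (extra e ℕ.+ suc (length U′)))) * result V (map (k ∷_) (unused e (suc k) n U′)) ∎
      where
      h = detA (whites (suc (suc k)) (n ℕ.+ extra e))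
      X = row (run (suc (suc k)) n) ++ bs
    detA-unused false zero k []      V a b θ eq = trans (sym (result-[] V [ k ])) (sign-zero θ _)
    detA-unused false zero k (u ∷ U) V a b θ eq = vanish (sign (θ ℕ.* suc (length U))) (isolated u (q-far u) (front U V _))
    detA-unused true  zero k U       V a b θ eq with match (suc k) U in m
    ... | just U′ with match-just U m
    detA-unused true zero k .(suc k ∷ []) V a b θ eq | just [] | refl =
      trans (hit (suc k) 0 [] V _) (trans (sym (result-[] V [ k ])) (sign-two θ _))
    detA-unused true zero k .(suc k ∷ u ∷ U) V a b θ eq | just (u ∷ U) | refl =
      trans (hit (suc k) 0 (u ∷ U) V _) (vanish (sign (θ ℕ.* suc (suc (suc (length U))))) (isolated u (q-far u) (front U V _)))
    detA-unused true zero k [] V a b θ eq | nothing = begin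
      lap (detA ws) (adj (suc q , suc k)) (front [] V ((suc q , k) ∷ bs))
        ≡⟨ lap-front (detA ws) [] V _ tt b ⟩
      sign (length V) * (adj (suc q , suc k) (suc q , k) * detA ws (row V ++ bs) - lap (detA ws ∘ (row V ++_) ∘ ((suc q , k) ∷_)) (adj (suc q , suc k)) bs)
        ≡⟨ cong₂ (λ p l → sign (length V) * (p * detA ws (row V ++ bs) - l)) (adj-z (suc q) k) (lap-none _ _ (bs-far (suc k))) ⟩
      sign (length V) * (- 1ℤ * detA ws (row V ++ bs) - 0ℤ)
        ≡⟨ alg (sign (length V)) (detA ws (row V ++ bs)) ⟩
      (- sign (length V)) * result V [ [] ]
        ≡⟨ cong (_* result V [ [] ]) (trans (sym (sign-suc (length V))) (trans (cong sign (sym eq)) (cong sign (sym (ℕ.*-identityʳ θ))))) ⟩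
      sign (θ ℕ.* 1) * result V [ [] ] ∎
      where
      alg : ∀ s x → s * (- 1ℤ * x - 0ℤ) ≡ (- s) * (x + 0ℤ)
      alg = solve-∀
    detA-unused true zero k (u ∷ U) V a b θ eq | nothing = vanish (sign (θ ℕ.* suc (suc (length U)))) (begin
      lap (detA ws) (adj (suc q , suc k)) (front (u ∷ U) V ((suc q , k) ∷ bs))
        ≡⟨ lap-front (detA ws) (u ∷ U) V _ (match-nothing (u ∷ U) m a) b ⟩
      sign A * (adj (suc q , suc k) (suc q , k) * detA ws ((q , u) ∷ front U V bs) - lap (detA ws ∘ front (u ∷ U) V ∘ ((suc q , k) ∷_)) (adj (suc q , suc k)) bs)
        ≡⟨ cong₂ (λ p l → sign A * (adj (suc q , suc k) (suc q , k) * p - l)) (isolated u (q-far u) (front U V bs)) (lap-none _ _ (bs-far (suc k))) ⟩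
      sign A * (adj (suc q , suc k) (suc q , k) * 0ℤ - 0ℤ)
        ≡⟨ alg (sign A) (adj (suc q , suc k) (suc q , k)) ⟩
      0ℤ ∎)
      where
      A = length (u ∷ U) ℕ.+ length V
      alg : ∀ s x → s * (x * 0ℤ - 0ℤ) ≡ 0ℤ
      alg = solve-∀

    detA-used e (suc n) k U V a b θ eq with match k U in m
    ... | nothing = begin
      lap h (adj (suc q , k)) (front U V ((suc q , k) ∷ X))
        ≡⟨ lap-front h U V _ a′ b ⟩
      sign A * lap (h ∘ front U V) (adj (suc q , k)) ((suc q , k) ∷ X)
        ≡⟨ cong (sign A *_) (miss-used (h ∘ front U V) k n) ⟩
      sign A * h (front U V X)
        ≡⟨ used-step θ l A _ eq (detA-used e n (suc k) U V a′ (behind-suc b) θ eq) ⟩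
      sign (θ ℕ.* suc l) * result V (used e (suc k) n U) ∎
      where
      h = detA (whites (suc k) (n ℕ.+ extra e))
      A = length U ℕ.+ length V
      l = n ℕ.+ (extra e ℕ.+ length U)
      X = row (run (suc k) n) ++ bs
      a′ = match-nothing U m a
    ... | just U′ with match-just U m
    detA-used e (suc n) k .(k ∷ U′) V (_ , a′) b θ eq | just U′ | refl = begin
      lap (detA (whites (suc k) (n ℕ.+ extra e))) (adj (suc q , k)) (front (k ∷ U′) V ((suc q , k) ∷ X))
        ≡⟨ hit k (n ℕ.+ extra e) U′ V _ ⟩
      detA (whites (suc k) (n ℕ.+ extra e)) (front U′ V ((suc q , k) ∷ X))
        ≡⟨ detA-unused e n k U′ V a′ (behind-suc b) θ eq ⟩
      sign (θ ℕ.* (n ℕ.+ (extra e ℕ.+ length U′))) * result V (unused e k n U′)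
        ≡⟨ cong (_* result V (unused e k n U′)) (trans (sym (sign-even θ _)) (cong (λ z → sign (θ ℕ.* z)) (twice n (extra e) (length U′)))) ⟩
      sign (θ ℕ.* suc (n ℕ.+ (extra e ℕ.+ suc (length U′)))) * result V (unused e k n U′) ∎
      where
      X = row (run (suc k) n) ++ bs
    detA-used false zero k []      V a b θ eq = trans (sym (result-[] V [])) (sign-zero θ _)
    detA-used false zero k (u ∷ U) V a b θ eq = vanish (sign (θ ℕ.* suc (length U))) (isolated u (q-far u) (front U V _))
    detA-used true  zero k U       V a b θ eq with match k U in m
    ... | just U′ with match-just U m
    detA-used true zero k .(k ∷ []) V a b θ eq | just [] | refl =
      trans (hit k 0 [] V _) (trans (sym (result-[] V [])) (sign-two θ _))
    detA-used true zero k .(k ∷ u ∷ U) V a b θ eq | just (u ∷ U) | refl =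
      trans (hit k 0 (u ∷ U) V _) (vanish (sign (θ ℕ.* suc (suc (suc (length U))))) (isolated u (q-far u) (front U V _)))
    detA-used true zero k U V a b θ eq | nothing = vanish (sign (θ ℕ.* suc (length U))) (begin
      lap (detA ws) (adj (suc q , k)) (front U V bs)
        ≡⟨ lap-front (detA ws) U V _ (match-nothing U m a) b ⟩
      sign (length U ℕ.+ length V) * lap (detA ws ∘ front U V) (adj (suc q , k)) bs
        ≡⟨ cong (sign (length U ℕ.+ length V) *_) (lap-none _ _ (bs-far k)) ⟩
      sign (length U ℕ.+ length V) * 0ℤ
        ≡⟨ ℤ.*-zeroʳ (sign (length U ℕ.+ length V)) ⟩
      0ℤ ∎)

-- Interlacing sets, their enumeration, and the determinant as a count of chains.

module Interlacing where

  open Determinants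
  open RowExpansion
  open import Data.Maybe using (just; nothing)
  open import Data.Integer using (+_; _+_; _*_)
  open import Data.List using (concatMap)
  open import Data.List.Relation.Unary.All as All using (All; []; _∷_)
  import Data.List.Relation.Unary.All.Properties as All
  open import Data.List.Relation.Unary.Any using (here; there)
  open import Data.List.Membership.Propositional using (_∈_)
  open import Data.List.Membership.Propositional.Properties
  open import Data.List.Relation.Unary.Unique.Propositional using (Unique; []; _∷_)
  import Data.List.Relation.Unary.Unique.Propositional.Properties as Unique
  open import Data.Sum using (inj₁; inj₂)
  open import Data.Unit using (tt)

  -- The interlacing v₁ < u₁ ≤ v₂ < u₂ ≤ ... is strict on one side only: a white that takes the
  -- black `u` above it settles the pending black, which lies before `u`, and the black at `u` of
  -- its own row becomes the pending one.
  data Inter : Bool → ℕ → ℕ → List ℕ → List ℕ → Set where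
    grow   : ∀ {hi lo v} → lo ≤ v → v ≤ hi → Inter false hi lo [] [ v ]
    shrink : ∀ {hi lo} → Inter true hi lo [] []
    step   : ∀ {e hi lo u v U V} → lo ≤ v → v < u → u ≤ hi → Inter e hi u U V → Inter e hi lo (u ∷ U) (v ∷ V)

  -- The state of `used`: no black of the row is pending, so an element of `U` has to come before
  -- the next element of `V`.
  data After : Bool → ℕ → ℕ → List ℕ → List ℕ → Set where
    done : ∀ {hi k} → After false hi k [] []
    next : ∀ {e hi k u U V} → k ≤ u → u ≤ hi → Inter e hi u U V → After e hi k (u ∷ U) V

  inter-weaken : ∀ {e hi lo lo′ U V} → lo′ ≤ lo → Inter e hi lo U V → Inter e hi lo′ U V
  inter-weaken p (grow q r)     = grow (ℕ.≤-trans p q) r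
  inter-weaken p shrink         = shrink
  inter-weaken p (step q r s i) = step (ℕ.≤-trans p q) r s i

  after-weaken : ∀ {e hi k k′ U V} → k′ ≤ k → After e hi k U V → After e hi k′ U V
  after-weaken p done         = done
  after-weaken p (next q r i) = next (ℕ.≤-trans p q) r i

  above-weaken : ∀ {k k′} U → k′ ≤ k → Above k U → Above k′ U
  above-weaken []      p a       = tt
  above-weaken (u ∷ U) p (q , a) = ℕ.≤-trans p q , a

  inter-above : ∀ {e hi lo U V} → Inter e hi lo U V → Above lo V
  inter-above (grow p q)              = p , tt
  inter-above shrink                  = tt
  inter-above (step {V = V} p q r i)  = p , above-weaken V q (inter-above i)

  after-above : ∀ {e hi k U V} → After e hi k U V → Above k V
  after-above done                 = tt
  after-above (next {V = V} p q i) = above-weaken V p (inter-above i)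

  inter-length-grow : ∀ {hi lo U V} → Inter false hi lo U V → length V ≡ suc (length U)
  inter-length-grow (grow _ _)     = refl
  inter-length-grow (step _ _ _ i) = cong suc (inter-length-grow i)

  inter-length-shrink : ∀ {hi lo U V} → Inter true hi lo U V → length V ≡ length U
  inter-length-shrink shrink         = refl
  inter-length-shrink (step _ _ _ i) = cong suc (inter-length-shrink i)

  after-length : ∀ {hi k U V} → After true hi k U V → suc (length V) ≡ length U
  after-length (next _ _ i) = cong suc (inter-length-shrink i)

  private
    bump : ∀ {hi} k n e → suc hi ≡ k ℕ.+ (suc n ℕ.+ e) → suc hi ≡ suc k ℕ.+ (n ℕ.+ e)
    bump k n e eq = trans eq (ℕ.+-suc k (n ℕ.+ e))

    k≤hi : ∀ {hi} k n e → suc hi ≡ k ℕ.+ (suc n ℕ.+ e) → k ≤ hi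
    k≤hi k n e eq = ℕ.≤-pred (ℕ.≤-trans (s≤s (ℕ.m≤m+n k (n ℕ.+ e))) (ℕ.≤-reflexive (sym (bump k n e eq))))

  -- The whites ahead start at `suc k` (at `k` in `after-sound`), so the equation makes `hi` the
  -- position of the last white of the row.
  inter-sound : ∀ e hi n k U {V} → suc hi ≡ suc k ℕ.+ (n ℕ.+ extra e) → V ∈ unused e k n U → Inter e hi k U V
  after-sound : ∀ e hi n k U {V} → suc hi ≡ k ℕ.+ (n ℕ.+ extra e) → V ∈ used e k n U → After e hi k U V

  inter-sound e hi (suc n) k U eq p with match (suc k) U in m
  ... | just U′ with match-just U m | ∈-map⁻ (k ∷_) p
  ...   | refl | V′ , q , refl =
    step ℕ.≤-refl (ℕ.n<1+n k) (k≤hi (suc k) n (extra e) eq) (inter-sound e hi n (suc k) U′ (bump (suc k) n (extra e) eq) q)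
  inter-sound e hi (suc n) k U eq p | nothing with ∈-++⁻ (map (k ∷_) (used e (suc (suc k)) n U)) p
  ... | inj₂ q = inter-weaken (ℕ.n≤1+n k) (inter-sound e hi n (suc k) U (bump (suc k) n (extra e) eq) q)
  ... | inj₁ q with ∈-map⁻ (k ∷_) q
  ...   | V′ , q′ , refl with after-sound e hi n (suc (suc k)) U (bump (suc k) n (extra e) eq) q′
  ...     | done       = grow ℕ.≤-refl (ℕ.≤-trans (ℕ.n≤1+n k) (k≤hi (suc k) n 0 eq))
  ...     | next a b i = step ℕ.≤-refl (ℕ.≤-trans (ℕ.n≤1+n (suc k)) a) b i
  inter-sound false hi zero k [] eq (here refl) = grow ℕ.≤-refl (ℕ.≤-reflexive (sym (trans (ℕ.suc-injective eq) (ℕ.+-identityʳ k))))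
  inter-sound true hi zero k U eq p with match (suc k) U in m
  inter-sound true hi zero k U eq (here refl) | just [] with match-just U m
  ... | refl = step ℕ.≤-refl (ℕ.n<1+n k) (ℕ.≤-reflexive (sym (trans (ℕ.suc-injective eq) (ℕ.+-comm k 1)))) shrink
  inter-sound true hi zero k [] eq (here refl) | nothing = shrink

  after-sound e hi (suc n) k U eq p with match k U in m
  ... | nothing = after-weaken (ℕ.n≤1+n k) (after-sound e hi n (suc k) U (bump k n (extra e) eq) p)
  ... | just U′ with match-just U m
  ...   | refl = next ℕ.≤-refl (k≤hi k n (extra e) eq) (inter-sound e hi n k U′ (bump k n (extra e) eq) p)
  after-sound false hi zero k [] eq (here refl) = done
  after-sound true hi zero k U eq p with match k U in m
  after-sound true hi zero k U eq (here refl) | just [] with match-just U m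
  ... | refl = next ℕ.≤-refl (k≤hi k 0 0 eq) shrink

  inter-complete : ∀ e hi n k {U V} → suc hi ≡ suc k ℕ.+ (n ℕ.+ extra e) → Inter e hi k U V → V ∈ unused e k n U
  after-complete : ∀ e hi n k {U V} → suc hi ≡ k ℕ.+ (n ℕ.+ extra e) → After e hi k U V → V ∈ used e k n U

  inter-complete false hi (suc n) k eq (grow {v = v} p q) with k ℕ.≟ v
  ... | yes refl = ∈-++⁺ˡ (∈-map⁺ (k ∷_) (after-complete false hi n (suc (suc k)) (bump (suc k) n 0 eq) done))
  ... | no k≢v   = ∈-++⁺ʳ (map (k ∷_) (used false (suc (suc k)) n [])) (inter-complete false hi n (suc k) (bump (suc k) n 0 eq) (grow (ℕ.≤∧≢⇒< p k≢v) q))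
  inter-complete true hi (suc n) k eq shrink =
    ∈-++⁺ʳ (map (k ∷_) (used true (suc (suc k)) n [])) (inter-complete true hi n (suc k) (bump (suc k) n 1 eq) shrink)
  inter-complete e hi (suc n) k eq (step {u = u} {v} {U} {V} p q r i) with u ℕ.≟ suc k
  ... | yes refl with ℕ.≤-antisym p (ℕ.≤-pred q)
  ...   | refl = ∈-map⁺ (k ∷_) (inter-complete e hi n (suc k) (bump (suc k) n (extra e) eq) i)
  inter-complete e hi (suc n) k eq (step {u = u} {v} {U} {V} p q r i) | no u≢ with k ℕ.≟ v
  ... | yes refl = ∈-++⁺ˡ (∈-map⁺ (k ∷_) (after-complete e hi n (suc (suc k)) (bump (suc k) n (extra e) eq)
                     (next (ℕ.≤∧≢⇒< q (u≢ ∘ sym)) r i)))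
  ... | no k≢v   = ∈-++⁺ʳ (map (k ∷_) (used e (suc (suc k)) n (u ∷ U))) (inter-complete e hi n (suc k) (bump (suc k) n (extra e) eq)
                     (step (ℕ.≤∧≢⇒< p k≢v) q r i))
  inter-complete false hi zero k eq (grow p q) =
    here (cong [_] (ℕ.≤-antisym (ℕ.≤-trans q (ℕ.≤-reflexive (trans (ℕ.suc-injective eq) (ℕ.+-identityʳ k)))) p))
  inter-complete false hi zero k eq (step p q r i) =
    ⊥-elim (ℕ.1+n≰n (ℕ.≤-trans (s≤s p) (ℕ.≤-trans q (ℕ.≤-trans r (ℕ.≤-reflexive (trans (ℕ.suc-injective eq) (ℕ.+-identityʳ k)))))))
  inter-complete true hi zero k eq shrink = here refl
  inter-complete true hi zero k eq (step {u = u} {v} {U} p q r i) with trans (ℕ.suc-injective eq) (ℕ.+-comm k 1)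
  ... | refl with ℕ.≤-antisym r (ℕ.≤-trans (s≤s p) q)
  ...   | refl with ℕ.≤-antisym p (ℕ.≤-pred q)
  ...     | refl rewrite match-hit (suc k) U with i
  ...       | shrink         = here refl
  ...       | step p′ q′ r′ _ = ⊥-elim (ℕ.1+n≰n (ℕ.≤-trans (s≤s p′) (ℕ.≤-trans q′ r′)))

  after-complete e hi (suc n) k eq (next {u = u} p q i) with u ℕ.≟ k
  ... | yes refl = inter-complete e hi n k (bump k n (extra e) eq) i
  ... | no u≢k   = after-complete e hi n (suc k) (bump k n (extra e) eq) (next (ℕ.≤∧≢⇒< p (u≢k ∘ sym)) q i)
  after-complete false hi (suc n) k eq done = after-complete false hi n (suc k) (bump k n 0 eq) done
  after-complete false hi zero k eq done = here refl
  after-complete false hi zero k eq (next p q i) =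
    ⊥-elim (ℕ.1+n≰n (ℕ.≤-trans (ℕ.≤-reflexive (trans eq (ℕ.+-identityʳ k))) (ℕ.≤-trans p q)))
  after-complete true hi zero k eq (next {u = u} {U} p q i) with ℕ.suc-injective (trans eq (ℕ.+-comm k 1))
  ... | refl with ℕ.≤-antisym q p
  ...   | refl rewrite match-hit k U with i
  ...     | shrink         = here refl
  ...     | step p′ q′ r′ _ = ⊥-elim (ℕ.1+n≰n (ℕ.≤-trans (s≤s p′) (ℕ.≤-trans q′ r′)))

  unused-unique : ∀ e n k U → Unique (unused e k n U)
  used-unique   : ∀ e n k U → Unique (used e k n U)

  unused-unique e (suc n) k U with match (suc k) U
  ... | just U′ = Unique.map⁺ L.∷-injectiveʳ (unused-unique e n (suc k) U′)
  ... | nothing = Unique.++⁺ (Unique.map⁺ L.∷-injectiveʳ (used-unique e n (suc (suc k)) U)) (unused-unique e n (suc k) U) disjoint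
    where
    -- The sets of the second list have all their elements above `k`.
    disjoint : ∀ {V} → V ∈ map (k ∷_) (used e (suc (suc k)) n U) × V ∈ unused e (suc k) n U → ⊥
    disjoint (p , q) with ∈-map⁻ (k ∷_) p
    ... | V′ , _ , refl = ℕ.1+n≰n (proj₁ (inter-above (inter-sound e (suc k ℕ.+ (n ℕ.+ extra e)) n (suc k) U refl q)))
  unused-unique false zero k []      = [] ∷ []
  unused-unique false zero k (_ ∷ _) = []
  unused-unique true  zero k U with match (suc k) U
  ... | just []      = [] ∷ []
  ... | just (_ ∷ _) = []
  ... | nothing with U
  ...   | []    = [] ∷ []
  ...   | _ ∷ _ = []

  used-unique e (suc n) k U with match k U
  ... | just U′ = unused-unique e n k U′
  ... | nothing = used-unique e n (suc k) U
  used-unique false zero k []      = [] ∷ []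
  used-unique false zero k (_ ∷ _) = []
  used-unique true  zero k U with match k U
  ... | just []      = [] ∷ []
  ... | just (_ ∷ _) = []
  ... | nothing      = []

  Chain : Set
  Chain = List (List ℕ)

  prepend : (List ℕ → List Chain) → List (List ℕ) → List Chain
  prepend f = concatMap (λ V → map (V ∷_) (f V))

  ∈-prepend⁺ : ∀ f {Vs V C} → V ∈ Vs → C ∈ f V → V ∷ C ∈ prepend f Vs
  ∈-prepend⁺ f {V ∷ Vs} (here refl) q = ∈-++⁺ˡ (∈-map⁺ (V ∷_) q)
  ∈-prepend⁺ f {V ∷ Vs} (there p)   q = ∈-++⁺ʳ (map (V ∷_) (f V)) (∈-prepend⁺ f p q)

  ∈-prepend⁻ : ∀ f Vs {C} → C ∈ prepend f Vs → Σ (List ℕ) λ V → Σ Chain λ C′ → C ≡ V ∷ C′ × V ∈ Vs × C′ ∈ f V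
  ∈-prepend⁻ f (V ∷ Vs) p with ∈-++⁻ (map (V ∷_) (f V)) p
  ... | inj₁ q with ∈-map⁻ (V ∷_) q
  ...   | C′ , q′ , refl = V , C′ , refl , here refl , q′
  ∈-prepend⁻ f (V ∷ Vs) p | inj₂ q with ∈-prepend⁻ f Vs q
  ... | V′ , C′ , e , r , s = V′ , C′ , e , there r , s

  prepend-unique : ∀ f {Vs} → Unique Vs → (∀ V → Unique (f V)) → Unique (prepend f Vs)
  prepend-unique f {[]}     []       u = []
  prepend-unique f {V ∷ Vs} (p ∷ ps) u = Unique.++⁺ (Unique.map⁺ L.∷-injectiveʳ (u V)) (prepend-unique f ps u) disjoint
    where
    disjoint : ∀ {C} → C ∈ map (V ∷_) (f V) × C ∈ prepend f Vs → ⊥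
    disjoint (a , b) with ∈-map⁻ (V ∷_) a
    ... | C′ , _ , refl with ∈-prepend⁻ f Vs b
    ...   | .V , .C′ , refl , r , _ = All.lookup p r refl

  sumL-prepend : ∀ f g ε Vs → (∀ V → V ∈ Vs → g V ≡ ε * + length (f V)) → sumL Vs g ≡ ε * + length (prepend f Vs)
  sumL-prepend f g ε []       p = sym (ℤ.*-zeroʳ ε)
  sumL-prepend f g ε (V ∷ Vs) p = begin
    g V + sumL Vs g
      ≡⟨ cong₂ _+_ (p V (here refl)) (sumL-prepend f g ε Vs (λ V q → p V (there q))) ⟩
    ε * + length (f V) + ε * + length (prepend f Vs)
      ≡⟨ ℤ.*-distribˡ-+ ε (+ length (f V)) (+ length (prepend f Vs)) ⟨
    ε * + (length (f V) ℕ.+ length (prepend f Vs))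
      ≡⟨ cong (λ z → ε * + z) (trans (L.length-++ (map (V ∷_) (f V))) (cong (ℕ._+ length (prepend f Vs)) (L.length-map (V ∷_) (f V)))) ⟨
    ε * + length (prepend f (V ∷ Vs)) ∎
    where open ≡-Reasoning

  shrinkChains : ℕ → List ℕ → List Chain
  shrinkChains zero    []      = [ [] ]
  shrinkChains zero    (_ ∷ _) = []
  shrinkChains (suc s) U       = prepend (shrinkChains s) (used true 0 (s ℕ.+ s) U)

  -- In chains that start from `[]`, the second argument is both the number of rows passed and the
  -- size of `U`. The third counts the growing rows ahead; its predecessor is the position of the
  -- first black in the next row.
  growChains : ℕ → ℕ → ℕ → List ℕ → List Chain
  growChains c q zero     U = shrinkChains c U
  growChains c q (suc lo) U = prepend (growChains c (suc q) lo) (unused false lo (q ℕ.+ q) U)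

  data ShrinkChain : ℕ → List ℕ → Chain → Set where
    nil  : ShrinkChain 0 [] []
    cons : ∀ {s U V C} → After true (s ℕ.+ s) 0 U V → ShrinkChain s V C → ShrinkChain (suc s) U (V ∷ C)

  data GrowChain (c : ℕ) : ℕ → ℕ → List ℕ → Chain → Set where
    turn : ∀ {q U C} → ShrinkChain c U C → GrowChain c q 0 U C
    cons : ∀ {q lo U V C} → Inter false (lo ℕ.+ (q ℕ.+ q)) lo U V → GrowChain c (suc q) lo V C → GrowChain c q (suc lo) U (V ∷ C)

  private
    shrink-hi : ∀ s → suc (s ℕ.+ s) ≡ (s ℕ.+ s) ℕ.+ 1
    shrink-hi s = ℕ.+-comm 1 (s ℕ.+ s)

    grow-hi : ∀ lo q → suc (lo ℕ.+ (q ℕ.+ q)) ≡ suc lo ℕ.+ (q ℕ.+ q ℕ.+ 0)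
    grow-hi lo q = cong (λ z → suc (lo ℕ.+ z)) (sym (ℕ.+-identityʳ (q ℕ.+ q)))

  shrinkChains-unique : ∀ s U → Unique (shrinkChains s U)
  shrinkChains-unique zero    []      = [] ∷ []
  shrinkChains-unique zero    (_ ∷ _) = []
  shrinkChains-unique (suc s) U       = prepend-unique _ (used-unique true (s ℕ.+ s) 0 U) (shrinkChains-unique s)

  growChains-unique : ∀ c q g U → Unique (growChains c q g U)
  growChains-unique c q zero     U = shrinkChains-unique c U
  growChains-unique c q (suc lo) U = prepend-unique _ (unused-unique false (q ℕ.+ q) lo U) (growChains-unique c (suc q) lo)

  shrinkChains-sound : ∀ s U {C} → C ∈ shrinkChains s U → ShrinkChain s U C
  shrinkChains-sound zero    [] (here refl) = nil
  shrinkChains-sound (suc s) U p with ∈-prepend⁻ (shrinkChains s) (used true 0 (s ℕ.+ s) U) p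
  ... | V , C′ , refl , q , r = cons (after-sound true (s ℕ.+ s) (s ℕ.+ s) 0 U (shrink-hi s) q) (shrinkChains-sound s V r)

  shrinkChains-complete : ∀ {s U C} → ShrinkChain s U C → C ∈ shrinkChains s U
  shrinkChains-complete nil = here refl
  shrinkChains-complete (cons {s} a i) = ∈-prepend⁺ (shrinkChains s) (after-complete true (s ℕ.+ s) (s ℕ.+ s) 0 (shrink-hi s) a) (shrinkChains-complete i)

  growChains-sound : ∀ c q g U {C} → C ∈ growChains c q g U → GrowChain c q g U C
  growChains-sound c q zero     U p = turn (shrinkChains-sound c U p)
  growChains-sound c q (suc lo) U p with ∈-prepend⁻ (growChains c (suc q) lo) (unused false lo (q ℕ.+ q) U) p
  ... | V , C′ , refl , a , r = cons (inter-sound false _ (q ℕ.+ q) lo U (grow-hi lo q) a) (growChains-sound c (suc q) lo V r)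

  growChains-complete : ∀ {c q g U C} → GrowChain c q g U C → C ∈ growChains c q g U
  growChains-complete (turn i) = shrinkChains-complete i
  growChains-complete {c} (cons {q} {lo} a i) = ∈-prepend⁺ (growChains c (suc q) lo) (inter-complete false _ (q ℕ.+ q) lo (grow-hi lo q) a) (growChains-complete i)

  -- The position sets are parameters, so that whites and blacks, whose rows carry the same indices,
  -- share the lemmas about layouts.
  shrinkRows : (ℕ → List ℕ) → ℕ → ℕ → List Vertex
  shrinkRows S q zero    = []
  shrinkRows S q (suc s) = map (suc q ,_) (S s) ++ shrinkRows S (suc q) s

  growRows : (ℕ → List ℕ) → (ℕ → ℕ → List ℕ) → ℕ → ℕ → ℕ → List Vertex
  growRows S G c q zero     = shrinkRows S q c
  growRows S G c q (suc lo) = map (suc q ,_) (G q lo) ++ growRows S G c (suc q) lo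

  -- The summand `1`, like the `0` in `growWhite`, is a value of `extra`; in this form the lists
  -- agree definitionally with those of `Row`.
  shrinkWhite shrinkBlack : ℕ → List ℕ
  shrinkWhite s = run 0 (s ℕ.+ s ℕ.+ 1)
  shrinkBlack s = run 0 (s ℕ.+ s)

  growWhite growBlack : ℕ → ℕ → List ℕ
  growWhite q lo = run (suc lo) (q ℕ.+ q ℕ.+ 0)
  growBlack q lo = run lo (suc (q ℕ.+ q))

  shrinkWhites shrinkBlacks : ℕ → ℕ → List Vertex
  shrinkWhites = shrinkRows shrinkWhite
  shrinkBlacks = shrinkRows shrinkBlack

  growWhites growBlacks : ℕ → ℕ → ℕ → List Vertex
  growWhites = growRows shrinkWhite growWhite
  growBlacks = growRows shrinkBlack growBlack

  Below : ℕ → List Vertex → Set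
  Below q = All (λ v → q < proj₁ v)

  rows-below : ∀ q ks {vs} → Below (suc q) vs → Below q (map (suc q ,_) ks ++ vs)
  rows-below q ks b = All.++⁺ (All.map⁺ (All.universal (λ _ → ℕ.n<1+n q) ks)) (All.map (ℕ.<-trans (ℕ.n<1+n q)) b)

  shrinkRows-below : ∀ S q s → Below q (shrinkRows S q s)
  shrinkRows-below S q zero    = []
  shrinkRows-below S q (suc s) = rows-below q (S s) (shrinkRows-below S (suc q) s)

  growRows-below : ∀ S G c q g → Below q (growRows S G c q g)
  growRows-below S G c q zero     = shrinkRows-below S q c
  growRows-below S G c q (suc lo) = rows-below q (G q lo) (growRows-below S G c (suc q) lo)

  below-whites-far : ∀ {q ws} → Below (suc q) ws → ∀ u → All (λ w → adj w (q , u) ≡ 0ℤ) ws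
  below-whites-far b u = All.map (λ {w} p → adj-far (proj₂ w) u (ℕ.>⇒≢ (ℕ.<-trans (ℕ.n<1+n _) p)) (ℕ.>⇒≢ p)) b

  below-blacks-far : ∀ {q bs} → Below (suc q) bs → ∀ k → All (λ b → adj (suc q , k) b ≡ 0ℤ) bs
  below-blacks-far b k = All.map (λ {v} p → adj-far k (proj₂ v) (ℕ.<⇒≢ p) (ℕ.<⇒≢ (ℕ.<-trans p (ℕ.n<1+n _)))) b

  -- The sign of a matching depends only on the sizes of the sets of free blacks, which are forced.
  detA-shrink : ∀ s q ℓ → Σ ℕ λ ε → ∀ U → length U ≡ ℓ → Above 0 U →
    detA (shrinkWhites q s) (map (q ,_) U ++ shrinkBlacks q s) ≡ sign ε * + length (shrinkChains s U)
  detA-shrink zero q ℓ = 0 , λ { [] _ _ → refl ; (_ ∷ _) _ _ → refl }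
  detA-shrink (suc s) q ℓ = τ ℕ.+ ε , prf
    where
    IH = detA-shrink s (suc q) (ℕ.pred ℓ)
    ε = proj₁ IH
    τ = ℓ ℕ.* (s ℕ.+ s ℕ.+ suc ℓ)
    open Row q (shrinkWhites (suc q) s) (shrinkBlacks (suc q) s)
      (below-whites-far (shrinkRows-below shrinkWhite (suc q) s)) (below-blacks-far (shrinkRows-below shrinkBlack (suc q) s))
    prf : ∀ U → length U ≡ ℓ → Above 0 U → _
    prf U refl a = begin
      detA (whites 0 (s ℕ.+ s ℕ.+ 1)) (front U [] (row (run 0 (s ℕ.+ s)) ++ shrinkBlacks (suc q) s))
        ≡⟨ detA-used true (s ℕ.+ s) 0 U [] a [] ℓ (sym (ℕ.+-identityʳ (length U))) ⟩
      sign τ * result [] (used true 0 (s ℕ.+ s) U)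
        ≡⟨ cong (sign τ *_) (sumL-prepend (shrinkChains s) _ (sign ε) _ (λ V p →
             let af = after-sound true (s ℕ.+ s) (s ℕ.+ s) 0 U (shrink-hi s) p in
             proj₂ IH V (cong ℕ.pred (after-length af)) (after-above af))) ⟩
      sign τ * (sign ε * + length (shrinkChains (suc s) U))
        ≡⟨ ℤ.*-assoc (sign τ) (sign ε) _ ⟨
      sign τ * sign ε * + length (shrinkChains (suc s) U)
        ≡⟨ cong (_* + length (shrinkChains (suc s) U)) (sign-+ τ ε) ⟨
      sign (τ ℕ.+ ε) * + length (shrinkChains (suc s) U) ∎
      where open ≡-Reasoning

  detA-grow : ∀ c g q ℓ → Σ ℕ λ ε → ∀ U → length U ≡ ℓ → Above g U →
    detA (growWhites c q g) (map (q ,_) U ++ growBlacks c q g) ≡ sign ε * + length (growChains c q g U)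
  detA-grow c zero     q ℓ = detA-shrink c q ℓ
  detA-grow c (suc lo) q ℓ = τ ℕ.+ ε , prf
    where
    IH = detA-grow c lo (suc q) (suc ℓ)
    ε = proj₁ IH
    τ = suc ℓ ℕ.* (q ℕ.+ q ℕ.+ ℓ)
    open Row q (growWhites c (suc q) lo) (growBlacks c (suc q) lo)
      (below-whites-far (growRows-below shrinkWhite growWhite c (suc q) lo)) (below-blacks-far (growRows-below shrinkBlack growBlack c (suc q) lo))
    prf : ∀ U → length U ≡ ℓ → Above (suc lo) U → _
    prf U refl a = begin
      detA (whites (suc lo) (q ℕ.+ q ℕ.+ 0)) (front U [] ((suc q , lo) ∷ row (run (suc lo) (q ℕ.+ q)) ++ growBlacks c (suc q) lo))
        ≡⟨ detA-unused false (q ℕ.+ q) lo U [] a [] (suc ℓ) (cong suc (sym (ℕ.+-identityʳ (length U)))) ⟩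
      sign τ * result [] (unused false lo (q ℕ.+ q) U)
        ≡⟨ cong (sign τ *_) (sumL-prepend (growChains c (suc q) lo) _ (sign ε) _ (λ V p →
             let i = inter-sound false _ (q ℕ.+ q) lo U (grow-hi lo q) p in
             proj₂ IH V (inter-length-grow i) (inter-above i))) ⟩
      sign τ * (sign ε * + length (growChains c q (suc lo) U))
        ≡⟨ ℤ.*-assoc (sign τ) (sign ε) _ ⟨
      sign τ * sign ε * + length (growChains c q (suc lo) U)
        ≡⟨ cong (_* + length (growChains c q (suc lo) U)) (sign-+ τ ε) ⟨
      sign (τ ℕ.+ ε) * + length (growChains c q (suc lo) U) ∎
      where open ≡-Reasoning

  ∣sign∣ : ∀ n → ∣ sign n ∣ ≡ 1
  ∣sign∣ zero          = refl
  ∣sign∣ (suc zero)    = refl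
  ∣sign∣ (suc (suc n)) = ∣sign∣ n

  ∣detA∣ : ∀ c → ∣ detA (growWhites c 0 c) (growBlacks c 0 c) ∣ ≡ length (growChains c 0 c [])
  ∣detA∣ c with detA-grow c c 0 0
  ... | ε , p = begin
    ∣ detA (growWhites c 0 c) (growBlacks c 0 c) ∣ ≡⟨ cong ∣_∣ (p [] refl tt) ⟩
    ∣ sign ε * + n ∣ ≡⟨ ℤ.abs-* (sign ε) (+ n) ⟩
    ∣ sign ε ∣ ℕ.* n ≡⟨ cong (ℕ._* n) (∣sign∣ ε) ⟩
    1 ℕ.* n ≡⟨ ℕ.*-identityˡ n ⟩
    n ∎
    where
    open ≡-Reasoning
    n = length (growChains c 0 c [])

-- Alternating polynomials: the monomial basis, coefficient functionals, ranks and unimodularity.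

module AlternatingPolynomials where

  open LinearArithmetic using (<⇒<ᵇ-true; <ᵇ-true⇒<)
  open Determinants
  open RowExpansion
  open import Data.Bool.Properties using (∧-conicalˡ; ∧-conicalʳ)
  open import Data.Integer using (+_; _+_; _*_; _-_)
  open import Data.Integer.Tactic.RingSolver using (solve-∀)
  open import Data.Fin using (Fin)
  import Data.Fin.Properties as Fin
  open import Data.Sum using (inj₁; inj₂)
  open ≡-Reasoning

  Antisymmetric : Poly → Set
  Antisymmetric f = (ρ f ≈ f) × (σ f ≈ negP f)

  private
    x≡-x⇒x≡0 : ∀ x → x ≡ - x → x ≡ 0ℤ
    x≡-x⇒x≡0 (+ zero) p = refl
    x≡-x⇒x≡0 (+ suc n) ()

    neg-zero : ∀ {x y} → x ≡ - y → x ≡ 0ℤ → y ≡ 0ℤ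
    neg-zero {x} {y} p q = trans (sym (ℤ.neg-involutive y)) (cong -_ (trans (sym p) q))

  -- Rotations and the transposition sort any exponents up to sign, and a repeated exponent gives x
  -- ≡ - x.
  antisymmetric-zero : ∀ {d} → Antisymmetric d → (∀ p q r → q < p → r < q → d p q r ≡ 0ℤ) → ∀ p q r → d p q r ≡ 0ℤ
  antisymmetric-zero {d} (cyc , anti) dec p q r = go (ℕ.≤-total q p) (ℕ.≤-total r q) (ℕ.≤-total r p)
    where
    sorted : ∀ p q r → q ≤ p → r ≤ q → d p q r ≡ 0ℤ
    sorted p q r a b with q ℕ.≟ p
    ... | yes refl = trans (sym (cyc p p r)) (trans (sym (cyc p r p)) (x≡-x⇒x≡0 _ (anti r p p)))
    ... | no q≢p with r ℕ.≟ q
    ...   | yes refl = x≡-x⇒x≡0 _ (anti p r r)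
    ...   | no r≢q = dec p q r (ℕ.≤∧≢⇒< a q≢p) (ℕ.≤∧≢⇒< b r≢q)
    go : _ → _ → _ → d p q r ≡ 0ℤ
    go (inj₁ q≤p) (inj₁ r≤q) _          = sorted p q r q≤p r≤q
    go (inj₁ q≤p) (inj₂ q≤r) (inj₁ r≤p) = neg-zero (anti p q r) (sorted p r q r≤p q≤r)
    go (inj₁ q≤p) (inj₂ q≤r) (inj₂ p≤r) = trans (cyc r p q) (sorted r p q p≤r q≤p)
    go (inj₂ p≤q) _          (inj₁ r≤p) = neg-zero (anti p q r) (trans (cyc q p r) (sorted q p r p≤q r≤p))
    go (inj₂ p≤q) (inj₁ r≤q) (inj₂ p≤r) = trans (sym (cyc p q r)) (sorted q r p r≤q p≤r)
    go (inj₂ p≤q) (inj₂ q≤r) (inj₂ p≤r) = neg-zero (anti p q r) (trans (cyc q p r) (trans (cyc r q p) (sorted r q p q≤r p≤q)))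

  antisymmetric-ext : ∀ {f g} → Antisymmetric f → Antisymmetric g →
                      (∀ p q r → q < p → r < q → f p q r ≡ g p q r) → f ≈ g
  antisymmetric-ext {f} {g} (fc , fa) (gc , ga) dec p q r =
    ℤ.i-j≡0⇒i≡j (f p q r) (g p q r) (antisymmetric-zero {λ p q r → f p q r - g p q r}
      ( (λ p q r → cong₂ _-_ (fc p q r) (gc p q r))
      , (λ p q r → trans (cong₂ _-_ (fa p q r) (ga p q r)) (alg (f p q r) (g p q r))))
      (λ p q r a b → ℤ.i≡j⇒i-j≡0 (dec p q r a b)) p q r)
    where
    alg : ∀ x y → - x - - y ≡ - (x - y)
    alg = solve-∀

  alternate : Poly → Poly
  alternate g p q r = g p q r + g q r p + g r p q - g p r q - g r q p - g q p r

  alternate-antisymmetric : ∀ g → Antisymmetric (alternate g)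
  alternate-antisymmetric g =
      (λ p q r → alg₁ (g p q r) (g q r p) (g r p q) (g p r q) (g r q p) (g q p r))
    , (λ p q r → alg₂ (g p q r) (g q r p) (g r p q) (g p r q) (g r q p) (g q p r))
    where
    alg₁ : ∀ a b c d e f → b + c + a - f - d - e ≡ a + b + c - d - e - f
    alg₁ = solve-∀
    alg₂ : ∀ a b c d e f → d + e + f - a - b - c ≡ - (a + b + c - d - e - f)
    alg₂ = solve-∀

  alternate-zero : ∀ g p q r → g p q r ≡ 0ℤ → g q r p ≡ 0ℤ → g r p q ≡ 0ℤ → g p r q ≡ 0ℤ → g r q p ≡ 0ℤ → g q p r ≡ 0ℤ →
                   alternate g p q r ≡ 0ℤ
  alternate-zero g p q r a b c d e f rewrite a | b | c | d | e | f = refl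

  -- No rearrangement of weakly decreasing exponents other than the identity can satisfy the strict
  -- inequalities of the support.
  alternate-sorted : ∀ g → (∀ p q r → ¬ (q < p × r < q) → g p q r ≡ 0ℤ) →
                     ∀ p q r → q ≤ p → r ≤ q → alternate g p q r ≡ g p q r
  alternate-sorted g supp p q r a b
    rewrite supp q r p (λ { (_ , x) → ℕ.<⇒≱ x (ℕ.≤-trans b a) })
          | supp r p q (λ { (x , _) → ℕ.<⇒≱ x (ℕ.≤-trans b a) })
          | supp p r q (λ { (_ , x) → ℕ.<⇒≱ x b })
          | supp r q p (λ { (x , _) → ℕ.<⇒≱ x b })
          | supp q p r (λ { (x , _) → ℕ.<⇒≱ x a })
    = alg (g p q r)
    where
    alg : ∀ x → x + 0ℤ + 0ℤ - 0ℤ - 0ℤ - 0ℤ ≡ x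
    alg = solve-∀

  inBox-true : ∀ a {i j k} → i < 2 ℕ.* a → j < 2 ℕ.* a → k < 2 ℕ.* a → inBox a i j k ≡ true
  inBox-true a p q r rewrite <⇒<ᵇ-true p | <⇒<ᵇ-true q | <⇒<ᵇ-true r = refl

  inBox-false : ∀ a i j k → ¬ (i < 2 ℕ.* a × j < 2 ℕ.* a × k < 2 ℕ.* a) → inBox a i j k ≡ false
  inBox-false a i j k p with inBox a i j k in e
  ... | false = refl
  ... | true  = ⊥-elim (p
    ( <ᵇ-true⇒< {i} (∧-conicalˡ _ _ e)
    , <ᵇ-true⇒< {j} (∧-conicalˡ _ _ (∧-conicalʳ (i ℕ.<ᵇ 2 ℕ.* a) _ e))
    , <ᵇ-true⇒< {k} (∧-conicalʳ (j ℕ.<ᵇ 2 ℕ.* a) _ (∧-conicalʳ (i ℕ.<ᵇ 2 ℕ.* a) _ e))))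

  lin-InN : ∀ {a D n} {B : Fin n → Poly} c → (∀ t → InN a D (B t)) → InN a D (lin c B)
  lin-InN {n = n} {B} c p =
      (λ i j k e → zeros (λ t → proj₁ (p t) i j k e))
    , (λ i j k → sumFin-cong n (λ t → cong (c t *_) (proj₁ (proj₂ (p t)) i j k)))
    , (λ i j k → trans (sumFin-cong n (λ t → trans (cong (c t *_) (proj₁ (proj₂ (proj₂ (p t))) i j k))
                         (sym (ℤ.neg-distribʳ-* (c t) (B t i j k))))) (sumFin-neg n (λ t → c t * B t i j k)))
    , (λ i j k e → zeros (λ t → proj₂ (proj₂ (proj₂ (p t))) i j k e))
    where
    zeros : ∀ {i j k} → (∀ t → B t i j k ≡ 0ℤ) → lin c B i j k ≡ 0ℤ
    zeros z = trans (sumFin-cong n (λ t → trans (cong (c t *_) (z t)) (ℤ.*-zeroʳ (c t)))) (sumFin-zero n)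

  InN-antisymmetric : ∀ a D {f} → InN a D f → Antisymmetric f
  InN-antisymmetric a D (_ , cyc , anti , _) = cyc , anti

  -- I, J, K list the exponents of all strictly decreasing monomials of degree D in the box.
  record Exponents (a D n : ℕ) : Set where
    field
      I J K     : Fin n → ℕ
      J<I       : ∀ t → J t < I t
      K<J       : ∀ t → K t < J t
      I<2a      : ∀ t → I t < 2 ℕ.* a
      degree    : ∀ t → I t ℕ.+ J t ℕ.+ K t ≡ D
      complete  : ∀ i j k → j < i → k < j → i < 2 ℕ.* a → i ℕ.+ j ℕ.+ k ≡ D →
                  Σ (Fin n) λ t → i ≡ I t × j ≡ J t × k ≡ K t
      injective : ∀ {s t} → J s ≡ J t → K s ≡ K t → s ≡ t

    -- The sign is the scaling built into `adj`. `monomial` carries it too, so these functionals are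
    -- dual to `basis`.
    coef : Fin n → Poly → ℤ
    coef t f = sign (K t) * f (I t) (J t) (K t)

    monomial : Fin n → Poly
    monomial t p q r = sign (K t) * (ind p (I t) * (ind q (J t) * ind r (K t)))

    basis : Fin n → Poly
    basis t = alternate (monomial t)

    monomial-off : ∀ t p q r → ¬ (p ≡ I t × q ≡ J t × r ≡ K t) → monomial t p q r ≡ 0ℤ
    monomial-off t p q r ¬e with p ℕ.≟ I t | q ℕ.≟ J t | r ℕ.≟ K t
    ... | yes x | yes y | yes z = ⊥-elim (¬e (x , y , z))
    ... | no x | _ | _ rewrite ind-≢ x = ℤ.*-zeroʳ (sign (K t))
    ... | yes _ | no y | _ rewrite ind-≢ y | ℤ.*-zeroʳ (ind p (I t)) = ℤ.*-zeroʳ (sign (K t))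
    ... | yes _ | yes _ | no z rewrite ind-≢ z | ℤ.*-zeroʳ (ind q (J t)) | ℤ.*-zeroʳ (ind p (I t)) = ℤ.*-zeroʳ (sign (K t))

    monomial-on : ∀ s t → monomial s (I t) (J t) (K t) ≡ sign (K s) * δ s t
    monomial-on s t with s Fin.≟ t
    ... | yes refl rewrite ind-refl (I s) | ind-refl (J s) | ind-refl (K s) | δ-refl s = refl
    ... | no s≢t rewrite δ-≢ s≢t = trans (monomial-off s (I t) (J t) (K t) (λ { (_ , y , z) → s≢t (injective (sym y) (sym z)) })) (sym (ℤ.*-zeroʳ (sign (K s))))

    basis-sorted : ∀ t p q r → q ≤ p → r ≤ q → basis t p q r ≡ monomial t p q r
    basis-sorted t = alternate-sorted (monomial t) λ p q r ¬s →
      monomial-off t p q r (λ { (refl , refl , refl) → ¬s (J<I t , K<J t) })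

    basis-on : ∀ s t → basis s (I t) (J t) (K t) ≡ sign (K s) * δ s t
    basis-on s t = trans (basis-sorted s _ _ _ (ℕ.<⇒≤ (J<I t)) (ℕ.<⇒≤ (K<J t))) (monomial-on s t)

    basis-InN : ∀ t → InN a D (basis t)
    basis-InN t = inR , proj₁ anti , proj₂ anti , homog
      where
      anti = alternate-antisymmetric (monomial t)
      J<2a = ℕ.<-trans (J<I t) (I<2a t)
      K<2a = ℕ.<-trans (K<J t) J<2a
      inR : InR a (basis t)
      inR i j k e = alternate-zero (monomial t) i j k
        (off i j k λ { refl refl refl → box (I<2a t) J<2a K<2a })
        (off j k i λ { refl refl refl → box K<2a (I<2a t) J<2a })
        (off k i j λ { refl refl refl → box J<2a K<2a (I<2a t) })
        (off i k j λ { refl refl refl → box (I<2a t) K<2a J<2a })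
        (off k j i λ { refl refl refl → box K<2a J<2a (I<2a t) })
        (off j i k λ { refl refl refl → box J<2a (I<2a t) K<2a })
        where
        off : ∀ p q r → (p ≡ I t → q ≡ J t → r ≡ K t → ⊥) → monomial t p q r ≡ 0ℤ
        off p q r f = monomial-off t p q r λ { (x , y , z) → f x y z }
        box : i < 2 ℕ.* a → j < 2 ℕ.* a → k < 2 ℕ.* a → ⊥
        box x y z with trans (sym e) (inBox-true a x y z)
        ... | ()
      homog : Homog D (basis t)
      homog i j k ne = alternate-zero (monomial t) i j k
        (off i j k refl) (off j k i (rot i j k)) (off k i j (sym (rot k i j)))
        (off i k j (swp i j k)) (off k j i (trans (swp i j k) (rot i k j))) (off j i k (cong (ℕ._+ k) (ℕ.+-comm i j)))
        where
        off : ∀ p q r → i ℕ.+ j ℕ.+ k ≡ p ℕ.+ q ℕ.+ r → monomial t p q r ≡ 0ℤ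
        off p q r e = monomial-off t p q r λ { (refl , refl , refl) → ne (trans e (degree t)) }
        rot : ∀ x y z → x ℕ.+ y ℕ.+ z ≡ y ℕ.+ z ℕ.+ x
        rot x y z = trans (ℕ.+-assoc x y z) (ℕ.+-comm x (y ℕ.+ z))
        swp : ∀ x y z → x ℕ.+ y ℕ.+ z ≡ x ℕ.+ z ℕ.+ y
        swp x y z = trans (ℕ.+-assoc x y z) (trans (cong (x ℕ.+_) (ℕ.+-comm y z)) (sym (ℕ.+-assoc x z y)))

    signed-δ : ∀ (c : Fin n → ℤ) t → sumFin n (λ s → c s * basis s (I t) (J t) (K t)) ≡ c t * sign (K t)
    signed-δ c t = begin
      sumFin n (λ s → c s * basis s (I t) (J t) (K t))
        ≡⟨ sumFin-cong n (λ s → trans (cong (c s *_) (basis-on s t)) (sym (ℤ.*-assoc (c s) (sign (K s)) (δ s t)))) ⟩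
      sumFin n (λ s → c s * sign (K s) * δ s t)
        ≡⟨ sumFin-δˡ n (λ s → c s * sign (K s)) t ⟩
      c t * sign (K t) ∎

    cancel-sign : ∀ k x → x * sign k * sign k ≡ x
    cancel-sign k x = trans (ℤ.*-assoc x (sign k) (sign k)) (trans (cong (x *_) (sign² k)) (ℤ.*-identityʳ x))

    -- The functionals `coef` supply the coordinates. By `antisymmetric-ext` agreement matters only
    -- at strictly decreasing exponents; these lie outside the box, have the wrong degree, or are
    -- listed.
    isBasis : IsBasis a D n basis
    isBasis = basis-InN , independent , spanning
      where
      independent : ∀ c → lin c basis ≈ zeroP → ∀ t → c t ≡ 0ℤ
      independent c e t = begin
        c t ≡⟨ cancel-sign (K t) (c t) ⟨
        c t * sign (K t) * sign (K t) ≡⟨ cong (_* sign (K t)) (trans (sym (signed-δ c t)) (e (I t) (J t) (K t))) ⟩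
        0ℤ * sign (K t) ≡⟨⟩
        0ℤ ∎
      spanning : ∀ f → InN a D f → Σ (Fin n → ℤ) λ c → f ≈ lin c basis
      spanning f f∈N = c , antisymmetric-ext (InN-antisymmetric a D f∈N) (InN-antisymmetric a D l∈N) agree
        where
        c = λ t → coef t f
        l∈N : InN a D (lin c basis)
        l∈N = lin-InN {a} {D} c basis-InN
        agree : ∀ p q r → q < p → r < q → f p q r ≡ lin c basis p q r
        agree p q r a′ b′ with p ℕ.<? 2 ℕ.* a | p ℕ.+ q ℕ.+ r ℕ.≟ D
        ... | no p≮ | _ = trans (proj₁ f∈N p q r out) (sym (proj₁ l∈N p q r out))
          where out = inBox-false a p q r (p≮ ∘ proj₁)
        ... | yes _ | no ≢D = trans (proj₂ (proj₂ (proj₂ f∈N)) p q r ≢D) (sym (proj₂ (proj₂ (proj₂ l∈N)) p q r ≢D))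
        ... | yes p< | yes ≡D with complete p q r a′ b′ p< ≡D
        ...   | t , refl , refl , refl = begin
          f (I t) (J t) (K t) ≡⟨ cancel-sign (K t) _ ⟨
          f (I t) (J t) (K t) * sign (K t) * sign (K t) ≡⟨ cong (_* sign (K t)) (ℤ.*-comm (f (I t) (J t) (K t)) (sign (K t))) ⟩
          coef t f * sign (K t) ≡⟨ signed-δ c t ⟨
          lin c basis (I t) (J t) (K t) ∎

    coef-basis : ∀ s t → coef s (basis t) ≡ δ t s
    coef-basis s t = begin
      sign (K s) * basis t (I s) (J s) (K s) ≡⟨ cong (sign (K s) *_) (basis-on t s) ⟩
      sign (K s) * (sign (K t) * δ t s) ≡⟨ lem ⟩
      δ t s ∎
      where
      lem : sign (K s) * (sign (K t) * δ t s) ≡ δ t s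
      lem with t Fin.≟ s
      ... | yes refl rewrite δ-refl t = trans (cong (sign (K t) *_) (ℤ.*-identityʳ (sign (K t)))) (sign² (K t))
      ... | no t≢s rewrite δ-≢ t≢s | ℤ.*-zeroʳ (sign (K t)) = ℤ.*-zeroʳ (sign (K s))

    coef-cong : ∀ t {f g} → f ≈ g → coef t f ≡ coef t g
    coef-cong t e = cong (sign (K t) *_) (e (I t) (J t) (K t))

    coef-lin : ∀ {m} t (c : Fin m → ℤ) (B : Fin m → Poly) → coef t (lin c B) ≡ sumFin m (λ s → coef t (B s) * c s)
    coef-lin {m} t c B = trans (sym (sumFin-*ˡ m (sign (K t)) (λ s → c s * B s (I t) (J t) (K t))))
      (sumFin-cong m (λ s → alg (sign (K t)) (c s) (B s (I t) (J t) (K t))))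
      where
      alg : ∀ s c b → s * (c * b) ≡ s * b * c
      alg = solve-∀

    pick-zero : ∀ f q r p → (∀ t → q ≡ J t → r ≡ K t → ⊥) → f p q r ≡ 0ℤ →
                sumFin n (λ t → ind q (J t) * ind r (K t) * coef t f) ≡ sign r * f p q r
    pick-zero f q r p ¬e z = trans
      (trans (sumFin-cong n (λ t → cong (_* coef t f) (off t))) (sumFin-zero n))
      (sym (trans (cong (sign r *_) z) (ℤ.*-zeroʳ (sign r))))
      where
      off : ∀ t → ind q (J t) * ind r (K t) ≡ 0ℤ
      off t with q ℕ.≟ J t | r ℕ.≟ K t
      ... | no x  | _     rewrite ind-≢ x = refl
      ... | yes _ | no y  rewrite ind-≢ y = ℤ.*-zeroʳ (ind q (J t))
      ... | yes x | yes y = ⊥-elim (¬e t x y)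

    -- Coefficients at weakly decreasing exponents are read off from the list: off the list they vanish.
    coef-pick : ∀ {f} → InN a D f → ∀ p q r → q ≤ p → r ≤ q → p < 2 ℕ.* a → p ℕ.+ q ℕ.+ r ≡ D →
                sumFin n (λ t → ind q (J t) * ind r (K t) * coef t f) ≡ sign r * f p q r
    coef-pick {f} f∈N p q r q≤p r≤q p< deg with q ℕ.<? p | r ℕ.<? q
    ... | yes q<p | yes r<q with complete p q r q<p r<q p< deg
    ...   | t , refl , refl , refl = trans (sumFin-cong n (λ s → cong (_* coef s f) (ind-δ s))) (sumFin-δʳ n (λ s → coef s f) t)
      where
      ind-δ : ∀ s → ind (J t) (J s) * ind (K t) (K s) ≡ δ t s
      ind-δ s with t Fin.≟ s
      ... | yes refl rewrite ind-refl (J t) | ind-refl (K t) | δ-refl t = refl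
      ... | no t≢s with J t ℕ.≟ J s
      ...   | no J≢ rewrite ind-≢ J≢ | δ-≢ t≢s = refl
      ...   | yes J≡ rewrite ind-≢ {K t} {K s} (t≢s ∘ injective J≡) | δ-≢ t≢s = ℤ.*-zeroʳ (ind (J t) (J s))
    coef-pick {f} f∈N p q r q≤p r≤q p< deg | yes _ | no r≮q =
      pick-zero f q r p (λ { t refl refl → r≮q (K<J t) }) (vanish (ℕ.≤-antisym (ℕ.≮⇒≥ r≮q) r≤q))
      where
      vanish : q ≡ r → f p q r ≡ 0ℤ
      vanish refl = x≡-x⇒x≡0 _ (proj₁ (proj₂ (proj₂ f∈N)) p q q)
    coef-pick {f} f∈N p q r q≤p r≤q p< deg | no q≮p | _ = pick-zero f q r p
      (λ { t refl refl → q≮p (subst (J t <_)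
        (ℕ.+-cancelʳ-≡ (J t) (I t) p (ℕ.+-cancelʳ-≡ (K t) _ _ (trans (degree t) (sym deg)))) (J<I t)) })
      (vanish (ℕ.≤-antisym (ℕ.≮⇒≥ q≮p) q≤p))
      where
      vanish : p ≡ q → f p q r ≡ 0ℤ
      vanish refl = trans (sym (cyc p p r)) (trans (sym (cyc p r p)) (x≡-x⇒x≡0 _ (proj₁ (proj₂ (proj₂ f∈N)) r p p)))
        where cyc = proj₁ (proj₂ f∈N)

  module _ {a D : ℕ} where

    -- `P` and `Q` express each basis in the other. Independence of `B` turns Q ⊡ P into the
    -- identity, and `⊡-δ⇒≤` applies.
    basis-≤ : ∀ {m n} {B : Fin m → Poly} {C : Fin n → Poly} → IsBasis a D m B → IsBasis a D n C → m ≤ n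
    basis-≤ {m} {n} {B} {C} (B∈N , ind-B , span-B) (C∈N , _ , span-C) = ⊡-δ⇒≤ m n Q P QP≡δ
      where
      P : Fin n → Fin m → ℤ
      P s t = proj₁ (span-C (B t) (B∈N t)) s
      Q : Fin m → Fin n → ℤ
      Q u s = proj₁ (span-B (C s) (C∈N s)) u
      QP≡δ : ∀ u t → (Q ⊡ P) u t ≡ δ u t
      QP≡δ u t = ℤ.i-j≡0⇒i≡j _ _ (ind-B (λ u → (Q ⊡ P) u t - δ u t) zero-comb u)
        where
        zero-comb : lin (λ u → (Q ⊡ P) u t - δ u t) B ≈ zeroP
        zero-comb i j k = begin
          sumFin m (λ u → ((Q ⊡ P) u t - δ u t) * b u)
            ≡⟨ sumFin-cong m (λ u → alg ((Q ⊡ P) u t) (δ u t) (b u)) ⟩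
          sumFin m (λ u → (Q ⊡ P) u t * b u + - (b u * δ u t))
            ≡⟨ sumFin-+ m (λ u → (Q ⊡ P) u t * b u) (λ u → - (b u * δ u t)) ⟩
          sumFin m (λ u → (Q ⊡ P) u t * b u) + sumFin m (λ u → - (b u * δ u t))
            ≡⟨ cong₂ _+_ first (trans (sumFin-neg m (λ u → b u * δ u t)) (cong -_ (sumFin-δˡ m b t))) ⟩
          b t - b t
            ≡⟨ ℤ.+-inverseʳ (b t) ⟩
          0ℤ ∎
          where
          b : Fin m → ℤ
          b u = B u i j k
          alg : ∀ x d b → (x - d) * b ≡ x * b + - (b * d)
          alg = solve-∀
          first : sumFin m (λ u → (Q ⊡ P) u t * b u) ≡ b t
          first = begin
            sumFin m (λ u → (Q ⊡ P) u t * b u)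
              ≡⟨ sumFin-cong m (λ u → sym (sumFin-*ʳ n (b u) (λ s → Q u s * P s t))) ⟩
            sumFin m (λ u → sumFin n (λ s → Q u s * P s t * b u))
              ≡⟨ sumFin-swap m n (λ u s → Q u s * P s t * b u) ⟩
            sumFin n (λ s → sumFin m (λ u → Q u s * P s t * b u))
              ≡⟨ sumFin-cong n (λ s → trans (sumFin-cong m (λ u → alg₂ (Q u s) (P s t) (b u)))
                   (trans (sumFin-*ˡ m (P s t) (λ u → Q u s * b u)) (cong (P s t *_) (sym (proj₂ (span-B (C s) (C∈N s)) i j k))))) ⟩
            sumFin n (λ s → P s t * C s i j k)
              ≡⟨ proj₂ (span-C (B t) (B∈N t)) i j k ⟨
            b t ∎
            where
            alg₂ : ∀ q p b → q * p * b ≡ p * (q * b)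
            alg₂ = solve-∀

    basis-card : ∀ {m n} {B : Fin m → Poly} {C : Fin n → Poly} → IsBasis a D m B → IsBasis a D n C → m ≡ n
    basis-card b c = ℕ.≤-antisym (basis-≤ b c) (basis-≤ c b)

    -- The monomial basis, written in terms of `B`, gives an integer right inverse of the
    -- coefficient matrix.
    coef-unimodular : ∀ {n} (E : Exponents a D n) {B : Fin n → Poly} → IsBasis a D n B →
                      ∣ det n (λ s t → Exponents.coef E s (B t)) ∣ ≡ 1
    coef-unimodular {n} E {B} (B∈N , _ , span-B) = det-unit n _ (λ t u → proj₁ (span-B (basis u) (basis-InN u)) t) λ s u → begin
      sumFin n (λ t → coef s (B t) * proj₁ (span-B (basis u) (basis-InN u)) t)
        ≡⟨ coef-lin s _ B ⟨
      coef s (lin (proj₁ (span-B (basis u) (basis-InN u))) B)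
        ≡⟨ coef-cong s (proj₂ (span-B (basis u) (basis-InN u))) ⟨
      coef s (basis u)
        ≡⟨ coef-basis s u ⟩
      δ u s
        ≡⟨ δ-sym u s ⟩
      δ s u ∎
      where open Exponents E

-- The shape of the region, and multiplication by x + y + z as its adjacency matrix.

module Regions where

  open LinearArithmetic
  open Determinants
  open RowExpansion
  open Interlacing
  open AlternatingPolynomials
  open import Data.Nat using (_∸_; _+_; _*_)
  import Data.Integer.Tactic.RingSolver as ℤ
  open import Data.Fin using (Fin; zero; suc)
  open import Data.List using (lookup; tabulate)
  open import Data.List.Relation.Unary.All as All using (All; []; _∷_)
  import Data.List.Relation.Unary.All.Properties as All
  open import Data.List.Relation.Unary.Any as Any using (here; there)
  import Data.List.Relation.Unary.Any.Properties as Any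
  open import Data.List.Membership.Propositional using (_∈_)
  open import Data.List.Membership.Propositional.Properties
  open import Data.List.Relation.Unary.Unique.Propositional using (Unique; []; _∷_)
  import Data.List.Relation.Unary.Unique.Propositional.Properties as Unique
  open import Data.Sum using (_⊎_; inj₁; inj₂)

  run-bounds : ∀ lo n → All (λ k → lo ≤ k × k < lo + n) (run lo n)
  run-bounds lo zero    = []
  run-bounds lo (suc n) = (ℕ.≤-refl , ℕ.m<m+n lo (s≤s z≤n)) ∷
    All.map (λ {k} → λ { (p , q) → ℕ.<⇒≤ p , subst (k <_) (sym (ℕ.+-suc lo n)) q }) (run-bounds (suc lo) n)

  run-complete : ∀ lo n {k} → lo ≤ k → k < lo + n → k ∈ run lo n
  run-complete lo zero    p q = ⊥-elim (ℕ.<⇒≱ q (subst (_≤ _) (sym (ℕ.+-identityʳ lo)) p))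
  run-complete lo (suc n) {k} p q with lo ℕ.≟ k
  ... | yes refl = here refl
  ... | no lo≢k  = there (run-complete (suc lo) n (ℕ.≤∧≢⇒< p lo≢k) (subst (k <_) (ℕ.+-suc lo n) q))

  run-unique : ∀ lo n → Unique (run lo n)
  run-unique lo zero    = []
  run-unique lo (suc n) = All.map ℕ.<⇒≢ (run-≥ (suc lo) n) ∷ run-unique (suc lo) n

  row-unique : ∀ q {ks vs} → Unique ks → Below (suc q) vs → Unique vs → Unique (map (suc q ,_) ks ++ vs)
  row-unique q {ks} {vs} u b u′ = Unique.++⁺ (Unique.map⁺ (cong proj₂) u) u′ disjoint
    where
    disjoint : ∀ {v} → v ∈ map (suc q ,_) ks × v ∈ vs → ⊥
    disjoint (p , p′) with ∈-map⁻ (suc q ,_) p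
    ... | k , _ , refl = ℕ.1+n≰n (All.lookup b p′)

  module _ (S : ℕ → List ℕ) where

    shrinkRows-all : ∀ (P : Vertex → Set) c T → (∀ q s → q + suc s ≡ T → suc s ≤ c → All (λ k → P (suc q , k)) (S s)) →
                     ∀ q s → q + s ≡ T → s ≤ c → All P (shrinkRows S q s)
    shrinkRows-all P c T f q zero    e l = []
    shrinkRows-all P c T f q (suc s) e l = All.++⁺ (All.map⁺ (f q s e l))
      (shrinkRows-all P c T f (suc q) s (trans (sym (ℕ.+-suc q s)) e) (ℕ.≤-trans (ℕ.n≤1+n s) l))

    shrinkRows-∈ : ∀ q x s {k} → k ∈ S s → (suc (q + x) , k) ∈ shrinkRows S q (x + suc s)
    shrinkRows-∈ q zero    s p rewrite ℕ.+-identityʳ q = ∈-++⁺ˡ (∈-map⁺ (suc q ,_) p)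
    shrinkRows-∈ q (suc x) s p rewrite ℕ.+-suc q x = ∈-++⁺ʳ (map (suc q ,_) (S (x + suc s))) (shrinkRows-∈ (suc q) x s p)

    shrinkRows-unique : (∀ s → Unique (S s)) → ∀ q s → Unique (shrinkRows S q s)
    shrinkRows-unique u q zero    = []
    shrinkRows-unique u q (suc s) = row-unique q (u s) (shrinkRows-below S (suc q) s) (shrinkRows-unique u (suc q) s)

  module _ (S : ℕ → List ℕ) (G : ℕ → ℕ → List ℕ) where

    growRows-all : ∀ (P : Vertex → Set) c → (∀ q s → q + suc s ≡ c + c → suc s ≤ c → All (λ k → P (suc q , k)) (S s)) →
                   (∀ q lo → q + suc lo ≡ c → All (λ k → P (suc q , k)) (G q lo)) →
                   ∀ q g → q + g ≡ c → All P (growRows S G c q g)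
    growRows-all P c f h q zero e = shrinkRows-all S P c (c + c) f q c (cong (_+ c) (trans (sym (ℕ.+-identityʳ q)) e)) ℕ.≤-refl
    growRows-all P c f h q (suc lo) e = All.++⁺ (All.map⁺ (h q lo e)) (growRows-all P c f h (suc q) lo (trans (sym (ℕ.+-suc q lo)) e))

    growRows-∈ : ∀ c q x lo {k} → k ∈ G (q + x) lo → (suc (q + x) , k) ∈ growRows S G c q (x + suc lo)
    growRows-∈ c q zero    lo p rewrite ℕ.+-identityʳ q = ∈-++⁺ˡ (∈-map⁺ (suc q ,_) p)
    growRows-∈ c q (suc x) lo p rewrite ℕ.+-suc q x = ∈-++⁺ʳ (map (suc q ,_) (G q (x + suc lo))) (growRows-∈ c (suc q) x lo p)

    growRows-turn : ∀ c q g {v} → v ∈ shrinkRows S (q + g) c → v ∈ growRows S G c q g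
    growRows-turn c q zero    p rewrite ℕ.+-identityʳ q = p
    growRows-turn c q (suc g) p rewrite ℕ.+-suc q g = ∈-++⁺ʳ (map (suc q ,_) (G q g)) (growRows-turn c (suc q) g p)

    growRows-unique : (∀ s → Unique (S s)) → (∀ q lo → Unique (G q lo)) → ∀ c q g → Unique (growRows S G c q g)
    growRows-unique u u′ c q zero     = shrinkRows-unique S u q c
    growRows-unique u u′ c q (suc lo) = row-unique q (u′ q lo) (growRows-below S G c (suc q) lo) (growRows-unique u u′ c (suc q) lo)

  length-run : ∀ lo n → length (run lo n) ≡ n
  length-run lo zero    = refl
  length-run lo (suc n) = cong suc (length-run (suc lo) n)

  length-row : ∀ q lo n (vs : List Vertex) → length (map (q ,_) (run lo n) ++ vs) ≡ n + length vs
  length-row q lo n vs = trans (L.length-++ (map (q ,_) (run lo n)))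
    (cong (_+ length vs) (trans (L.length-map (q ,_) (run lo n)) (length-run lo n)))

  shrink-lengths : ∀ q s → length (shrinkBlacks q s) + s ≡ length (shrinkWhites q s)
  shrink-lengths q zero    = refl
  shrink-lengths q (suc s) = begin
    length (shrinkBlacks q (suc s)) + suc s ≡⟨ cong (_+ suc s) (length-row (suc q) 0 (s + s) (shrinkBlacks (suc q) s)) ⟩
    s + s + b + suc s ≡⟨ shrink-count s b ⟩
    s + s + 1 + (b + s) ≡⟨ cong (s + s + 1 +_) (shrink-lengths (suc q) s) ⟩
    s + s + 1 + length (shrinkWhites (suc q) s) ≡⟨ length-row (suc q) 0 (s + s + 1) (shrinkWhites (suc q) s) ⟨
    length (shrinkWhites q (suc s)) ∎
    where
    open ≡-Reasoning
    b = length (shrinkBlacks (suc q) s)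

  -- A growing row has one black more than whites, a shrinking row one white more than blacks. For
  -- `g = c` the two effects cancel.
  grow-lengths : ∀ c q g → length (growBlacks c q g) + c ≡ length (growWhites c q g) + g
  grow-lengths c q zero     = trans (shrink-lengths q c) (sym (ℕ.+-identityʳ _))
  grow-lengths c q (suc lo) = begin
    length (growBlacks c q (suc lo)) + c ≡⟨ cong (_+ c) (length-row (suc q) lo (suc (q + q)) (growBlacks c (suc q) lo)) ⟩
    suc (q + q) + b + c ≡⟨ ℕ.+-assoc (suc (q + q)) b c ⟩
    suc (q + q) + (b + c) ≡⟨ cong (suc (q + q) +_) (grow-lengths c (suc q) lo) ⟩
    suc (q + q) + (w + lo) ≡⟨ grow-count q w lo ⟩
    q + q + 0 + w + suc lo ≡⟨ cong (_+ suc lo) (length-row (suc q) (suc lo) (q + q + 0) (growWhites c (suc q) lo)) ⟨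
    length (growWhites c q (suc lo)) + suc lo ∎
    where
    open ≡-Reasoning
    b = length (growBlacks c (suc q) lo)
    w = length (growWhites c (suc q) lo)

  blacks≡whites : ∀ c → length (growWhites c 0 c) ≡ length (growBlacks c 0 c)
  blacks≡whites c = sym (ℕ.+-cancelʳ-≡ c _ _ (grow-lengths c 0 c))

  -- The length enters through an equation, so that the whites can be indexed by the number of
  -- blacks.
  vertex : ∀ {n} (vs : List Vertex) → length vs ≡ n → Fin n → Vertex
  vertex vs refl = lookup vs

  tabulate-vertex : ∀ {n} vs (e : length vs ≡ n) → tabulate (vertex vs e) ≡ vs
  tabulate-vertex vs refl = L.tabulate-lookup vs

  vertex-all : ∀ {n} {P : Vertex → Set} vs (e : length vs ≡ n) → All P vs → ∀ t → P (vertex vs e t)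
  vertex-all vs refl ps t = All.lookup ps (∈-lookup {xs = vs} t)

  vertex-∈ : ∀ {n v} vs (e : length vs ≡ n) → v ∈ vs → Σ (Fin n) λ t → v ≡ vertex vs e t
  vertex-∈ vs refl p = Any.index p , Any.lookup-index p

  vertex-injective : ∀ {n} vs (e : length vs ≡ n) → Unique vs → ∀ {s t} → vertex vs e s ≡ vertex vs e t → s ≡ t
  vertex-injective vs refl u {s} {t} = go vs u s t
    where
    go : ∀ vs → Unique vs → ∀ s t → lookup vs s ≡ lookup vs t → s ≡ t
    go (v ∷ vs) (p ∷ u) zero    zero    e = refl
    go (v ∷ vs) (p ∷ u) zero    (suc t) e = ⊥-elim (All.lookup p (∈-lookup {xs = vs} t) e)
    go (v ∷ vs) (p ∷ u) (suc s) zero    e = ⊥-elim (All.lookup p (∈-lookup {xs = vs} s) (sym e))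
    go (v ∷ vs) (p ∷ u) (suc s) (suc t) e = cong suc (go vs u s t e)

  ind-+ : ∀ m x y → ind (m + x) (m + y) ≡ ind x y
  ind-+ zero    x y = refl
  ind-+ (suc m) x y = ind-+ m x y

  mulL-inBox : ∀ a f i j k → inBox a i j k ≡ true →
    mulL a f i j k ≡ prev (λ i′ → f i′ j k) i ℤ.+ prev (λ j′ → f i j′ k) j ℤ.+ prev (λ k′ → f i j k′) k
  mulL-inBox a f i j k e rewrite e = refl

  -- White rows are given as successors: the y-neighbour of the white `w` lies in row `rowW w`.
  module Multiplication {a D n : ℕ} (black : Exponents a D n) (white : Exponents a (suc D) n) (o : ℕ)
    (rowB rowW : Fin n → ℕ) (J-black : ∀ b → Exponents.J black b ≡ o + rowB b)
    (J-white : ∀ w → Exponents.J white w ≡ o + suc (rowW w)) where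

    private
      module B = Exponents black
      module W = Exponents white

    -- The coefficient collects `f` at the exponents with one entry lowered. These are only weakly
    -- decreasing in general, which is why `coef-pick` covers that case. The x-exponent is fixed by
    -- the degree and does not occur in `adj`.
    coef-mulL : ∀ {f} → InN a D f → ∀ w →
      W.coef w (mulL a f) ≡ sumFin n (λ b → adj (suc (rowW w) , W.K w) (rowB b , B.K b) ℤ.* B.coef b f)
    coef-mulL {f} f∈N w = trans
      (cong (sign (W.K w) ℤ.*_) (mulL-inBox a f (W.I w) (W.J w) (W.K w)
        (inBox-true a (W.I<2a w) (ℕ.<-trans (W.J<I w) (W.I<2a w)) (ℕ.<-trans (W.K<J w) (ℕ.<-trans (W.J<I w) (W.I<2a w))))))
      (go (W.I w) (rowW w) (W.J w) (W.K w) (trans (J-white w) (ℕ.+-suc o (rowW w))) (W.J<I w) (W.K<J w) (W.I<2a w) (W.degree w))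
      where
      open ≡-Reasoning
      go : ∀ i r j k → j ≡ suc (o + r) → j < i → k < j → i < 2 * a → i + j + k ≡ suc D →
        sign k ℤ.* (prev (λ i′ → f i′ j k) i ℤ.+ prev (λ j′ → f i j′ k) j ℤ.+ prev (λ k′ → f i j k′) k)
        ≡ sumFin n (λ b → adj (suc r , k) (rowB b , B.K b) ℤ.* B.coef b f)
      go (suc i) r _ k refl h₁ h₂ h₃ e = sym (begin
        sumFin n (λ b → adj (suc r , k) (rowB b , B.K b) ℤ.* X b)
          ≡⟨ sumFin-cong n (λ b → alg₁ (ind (suc r) (rowB b)) (ind k (B.K b)) (ind r (rowB b)) (ind k (suc (B.K b))) (X b)) ⟩
        sumFin n (λ b → x b ℤ.+ y b ℤ.+ - z b)
          ≡⟨ trans (sumFin-+ n (λ b → x b ℤ.+ y b) (λ b → - z b)) (cong₂ ℤ._+_ (sumFin-+ n x y) (sumFin-neg n z)) ⟩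
        sumFin n x ℤ.+ sumFin n y ℤ.+ - sumFin n z
          ≡⟨ cong₂ ℤ._+_ (cong₂ ℤ._+_ x-sum y-sum) (z-sum k e h₂) ⟩
        sign k ℤ.* f i (suc (o + r)) k ℤ.+ sign k ℤ.* f (suc i) (o + r) k ℤ.+ sign k ℤ.* prev (λ k′ → f (suc i) (suc (o + r)) k′) k
          ≡⟨ alg₂ (sign k) (f i (suc (o + r)) k) (f (suc i) (o + r) k) _ ⟩
        sign k ℤ.* (f i (suc (o + r)) k ℤ.+ f (suc i) (o + r) k ℤ.+ prev (λ k′ → f (suc i) (suc (o + r)) k′) k) ∎)
        where
        X x y z : Fin n → ℤ
        X b = B.coef b f
        x b = ind (suc r) (rowB b) ℤ.* ind k (B.K b) ℤ.* X b
        y b = ind r (rowB b) ℤ.* ind k (B.K b) ℤ.* X b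
        z b = ind (suc r) (rowB b) ℤ.* ind k (suc (B.K b)) ℤ.* X b
        alg₁ : ∀ p q r s x → (p ℤ.* q ℤ.+ r ℤ.* q ℤ.- p ℤ.* s) ℤ.* x ≡ p ℤ.* q ℤ.* x ℤ.+ r ℤ.* q ℤ.* x ℤ.+ - (p ℤ.* s ℤ.* x)
        alg₁ = ℤ.solve-∀
        alg₂ : ∀ s u v w → s ℤ.* u ℤ.+ s ℤ.* v ℤ.+ s ℤ.* w ≡ s ℤ.* (u ℤ.+ v ℤ.+ w)
        alg₂ = ℤ.solve-∀
        pick : ∀ p r′ j′ k′ → j′ ≡ o + r′ → j′ ≤ p → k′ ≤ j′ → p < 2 * a → p + j′ + k′ ≡ D →
               sumFin n (λ b → ind r′ (rowB b) ℤ.* ind k′ (B.K b) ℤ.* X b) ≡ sign k′ ℤ.* f p j′ k′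
        pick p r′ _ k′ refl l₁ l₂ l₃ d = trans
          (sumFin-cong n (λ b → cong (λ u → u ℤ.* ind k′ (B.K b) ℤ.* X b)
            (trans (sym (ind-+ o r′ (rowB b))) (cong (ind (o + r′)) (sym (J-black b))))))
          (B.coef-pick f∈N p (o + r′) k′ l₁ l₂ l₃ d)
        x-sum : sumFin n x ≡ sign k ℤ.* f i (suc (o + r)) k
        x-sum = pick i (suc r) (suc (o + r)) k (sym (ℕ.+-suc o r)) (ℕ.≤-pred h₁) (ℕ.<⇒≤ h₂) (ℕ.<-trans (ℕ.n<1+n i) h₃) (ℕ.suc-injective e)
        y-sum : sumFin n y ≡ sign k ℤ.* f (suc i) (o + r) k
        y-sum = pick (suc i) r (o + r) k refl (ℕ.≤-trans (ℕ.n≤1+n _) (ℕ.<⇒≤ h₁)) (ℕ.≤-pred h₂) h₃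
          (ℕ.suc-injective (trans (cong (λ u → suc u + k) (sym (ℕ.+-suc i (o + r)))) e))
        z-sum : ∀ k → suc i + suc (o + r) + k ≡ suc D → k < suc (o + r) →
          - sumFin n (λ b → ind (suc r) (rowB b) ℤ.* ind k (suc (B.K b)) ℤ.* X b)
          ≡ sign k ℤ.* prev (λ k′ → f (suc i) (suc (o + r)) k′) k
        -- There is nothing to divide by z: `prev` is 0, and so is `ind 0 (suc _)`.
        z-sum zero _ _ = cong -_ (trans
          (sumFin-cong n (λ b → cong (ℤ._* X b) (ℤ.*-zeroʳ (ind (suc r) (rowB b))))) (sumFin-zero n))
        -- The -1 of the z-edge is absorbed by the difference between `sign k` and `sign (suc k)`.
        z-sum (suc k) e h = begin
          - sumFin n (λ b → ind (suc r) (rowB b) ℤ.* ind k (B.K b) ℤ.* X b)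
            ≡⟨ cong -_ (pick (suc i) (suc r) (suc (o + r)) k (sym (ℕ.+-suc o r)) (ℕ.<⇒≤ h₁) (ℕ.<⇒≤ (ℕ.<-trans (ℕ.n<1+n k) h)) h₃
                   (ℕ.suc-injective (trans (sym (ℕ.+-suc _ k)) e))) ⟩
          - (sign k ℤ.* f (suc i) (suc (o + r)) k)
            ≡⟨ ℤ.neg-distribˡ-* (sign k) (f (suc i) (suc (o + r)) k) ⟩
          - sign k ℤ.* f (suc i) (suc (o + r)) k
            ≡⟨ cong (ℤ._* f (suc i) (suc (o + r)) k) (sign-suc k) ⟨
          sign (suc k) ℤ.* f (suc i) (suc (o + r)) k ∎

    adjacency : Fin n → Fin n → ℤ
    adjacency w b = adj (suc (rowW w) , W.K w) (rowB b , B.K b)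

    -- With `X` and `Y` the coefficient matrices of `B` and `C`, which are unimodular, both sides
    -- compute the coefficients of the products: Y ⊡ M = adjacency ⊡ X.
    ∣det-mulL∣ : ∀ (B C : Fin n → Poly) (M : Fin n → Fin n → ℤ) → IsBasis a D n B → IsBasis a (suc D) n C →
      (∀ t → mulL a (B t) ≈ lin (λ s → M s t) C) → ∣ det n M ∣ ≡ ∣ det n adjacency ∣
    ∣det-mulL∣ B C M bB bC e = begin
      ∣ det n M ∣ ≡⟨ ℕ.*-identityˡ _ ⟨
      1 * ∣ det n M ∣ ≡⟨ cong (_* ∣ det n M ∣) (coef-unimodular white bC) ⟨
      ∣ det n Y ∣ * ∣ det n M ∣ ≡⟨ ℤ.abs-* (det n Y) (det n M) ⟨
      ∣ det n Y ℤ.* det n M ∣ ≡⟨ cong ∣_∣ (det-⊡ n Y M) ⟨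
      ∣ det n (Y ⊡ M) ∣ ≡⟨ cong ∣_∣ (det-cong n same) ⟩
      ∣ det n (adjacency ⊡ X) ∣ ≡⟨ cong ∣_∣ (det-⊡ n adjacency X) ⟩
      ∣ det n adjacency ℤ.* det n X ∣ ≡⟨ ℤ.abs-* (det n adjacency) (det n X) ⟩
      ∣ det n adjacency ∣ * ∣ det n X ∣ ≡⟨ cong (∣ det n adjacency ∣ *_) (coef-unimodular black bB) ⟩
      ∣ det n adjacency ∣ * 1 ≡⟨ ℕ.*-identityʳ _ ⟩
      ∣ det n adjacency ∣ ∎
      where
      open ≡-Reasoning
      X Y : Fin n → Fin n → ℤ
      X b t = B.coef b (B t)
      Y w s = W.coef w (C s)
      same : ∀ w t → (Y ⊡ M) w t ≡ (adjacency ⊡ X) w t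
      same w t = begin
        sumFin n (λ s → W.coef w (C s) ℤ.* M s t) ≡⟨ W.coef-lin w (λ s → M s t) C ⟨
        W.coef w (lin (λ s → M s t) C) ≡⟨ W.coef-cong w (e t) ⟨
        W.coef w (mulL a (B t)) ≡⟨ coef-mulL (proj₁ bB t) w ⟩
        sumFin n (λ b → adjacency w b ℤ.* X b t) ∎

  -- The vertex (r , k) stands for the monomial with y-exponent c - 1 + r and z-exponent k, where a = 2c;
  -- the degree is 3a - 2 + d, with d = 0 for blacks and d = 1 for whites.
  module Region (c′ : ℕ) where

    c a : ℕ
    c = suc c′
    a = c + c

    Degree : ℕ → ℕ
    Degree d = d + (6 * c′ + 4)

    Fits : ℕ → Vertex → Set
    Fits d (r , k) = Σ ℕ λ i → i + (c′ + r) + k ≡ Degree d × c′ + r < i × k < c′ + r × i < 2 * a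

    -- Once the degree determines i, the three hypotheses are equivalent to k < j, j < i and i < 2a.
    fits : ∀ d r k → k < c′ + r → k + (r + r) < 4 * c + d → c′ + d < r + k → Fits d (r , k)
    fits d r k h₁ h₂ h₃ = i , deg , j<i i r k h₂ deg , h₁ , i<2a i r k h₃ deg
      where
      open Bounds c′ d
      i = Degree d ∸ ((c′ + r) + k)
      deg : i + (c′ + r) + k ≡ Degree d
      deg = trans (ℕ.+-assoc i (c′ + r) k) (ℕ.m∸n+n≡m (small r k h₂))

    fits-grow : ∀ d q lo k → q + suc lo ≡ c → lo + d ≤ k → k < lo + suc (q + q) → Fits d (suc q , k)
    fits-grow d q lo k e h₁ h₂ with ℕ.suc-injective (trans (sym (ℕ.+-suc q lo)) e)
    ... | refl = fits d (suc q) k (grow₁ k h₂) (grow₂ k h₂) (grow₃ k h₁)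
      where open GrowBounds q lo d

    fits-shrink : ∀ d q s k → q + suc s ≡ c + c → suc s ≤ c → k < s + s + d → d ≤ 1 → Fits d (suc q , k)
    fits-shrink d q s k e s≤ h d≤1 = fits d (suc q) k (shrink₁ q s k e s≤ h d≤1) (shrink₂ q s k e h) (shrink₃ q s k e s≤ d≤1)
      where open Bounds c′ d

    -- The row j = c + q is growing for q < c and shrinking afterwards. In a growing row i < 2a
    -- bounds k from below and k < j from above; in a shrinking row the upper bound on k comes from
    -- j < i.
    locate : ∀ d → d ≤ 1 → ∀ i j k → j < i → k < j → i < 2 * a → i + j + k ≡ Degree d →
      (Σ ℕ λ q → Σ ℕ λ lo → q + suc lo ≡ c × j ≡ c′ + suc q × lo + d ≤ k × k < lo + suc (q + q)) ⊎
      (Σ ℕ λ q → Σ ℕ λ s → q + suc s ≡ c × j ≡ c′ + suc (c + q) × k < s + s + d)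
    locate d d≤1 i j k h₁ h₂ h₃ e with ℕ.m≤n⇒∃[o]m+o≡n (Bounds.c≤j c′ d i j k h₂ h₃ e)
    ... | q , refl with q ℕ.≤? c′
    ...   | yes q≤ with ℕ.m≤n⇒∃[o]m+o≡n q≤
    ...     | lo , e′ = inj₁ (q , lo , trans (ℕ.+-suc q lo) (cong suc e′) , sym (ℕ.+-suc c′ q)
        , Bounds.lower c′ d i q lo k e′ h₃ e , Bounds.upper c′ d q lo k e′ h₂)
    locate d d≤1 i j k h₁ h₂ h₃ e | q , refl | no q≰ with ℕ.m≤n⇒∃[o]m+o≡n (ℕ.≰⇒> q≰)
    ... | x , refl with ℕ.m≤n⇒∃[o]m+o≡n {suc x} {c} (Bounds.late c′ d i x k d≤1 h₁ e)
    ...   | s , e″ = inj₂ (x , s , trans (ℕ.+-suc x s) e″ , sym (ℕ.+-suc c′ (c + x)) , Bounds.last c′ d i x s k e″ h₁ e)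

    record Layout (d : ℕ) (vs : List Vertex) : Set where
      field
        all-fit    : All (Fits d) vs
        unique     : Unique vs
        exhaustive : ∀ i j k → j < i → k < j → i < 2 * a → i + j + k ≡ Degree d →
                     Σ ℕ λ r → j ≡ c′ + r × (r , k) ∈ vs

    layout : ∀ d → d ≤ 1 → (S : ℕ → List ℕ) (G : ℕ → ℕ → List ℕ) →
      (∀ s → All (λ k → k < s + s + d) (S s)) → (∀ s k → k < s + s + d → k ∈ S s) → (∀ s → Unique (S s)) →
      (∀ q lo → All (λ k → lo + d ≤ k × k < lo + suc (q + q)) (G q lo)) →
      (∀ q lo k → lo + d ≤ k → k < lo + suc (q + q) → k ∈ G q lo) → (∀ q lo → Unique (G q lo)) →
      Layout d (growRows S G c 0 c)
    layout d d≤1 S G S-all S-∈ S-unique G-all G-∈ G-unique = record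
      { all-fit = growRows-all S G (Fits d) c
          (λ q s e l → All.map (λ h → fits-shrink d q s _ e l h d≤1) (S-all s))
          (λ q lo e → All.map (λ { (h , h′) → fits-grow d q lo _ e h h′ }) (G-all q lo)) 0 c refl
      ; unique = growRows-unique S G S-unique G-unique c 0 c
      ; exhaustive = λ i j k h₁ h₂ h₃ e → find k (locate d d≤1 i j k h₁ h₂ h₃ e)
      }
      where
      find : ∀ {j} k → _ ⊎ _ → Σ ℕ λ r → j ≡ c′ + r × (r , k) ∈ growRows S G c 0 c
      find k (inj₁ (q , lo , e , e′ , h , h′)) = suc q , e′ ,
        subst (λ z → (suc q , k) ∈ growRows S G c 0 z) e (growRows-∈ S G c 0 q lo (G-∈ q lo k h h′))
      find k (inj₂ (q , s , e , e′ , h)) = suc (c + q) , e′ ,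
        growRows-turn S G c 0 c (subst (λ z → (suc (c + q) , k) ∈ shrinkRows S c z) e (shrinkRows-∈ S c q s (S-∈ s k h)))

    blackLayout : Layout 0 (growBlacks c 0 c)
    blackLayout = layout 0 z≤n shrinkBlack growBlack
      (λ s → All.map (λ {k} p → subst (k <_) (sym (ℕ.+-identityʳ (s + s))) (proj₂ p)) (run-bounds 0 (s + s)))
      (λ s k h → run-complete 0 (s + s) z≤n (subst (k <_) (ℕ.+-identityʳ (s + s)) h))
      (λ s → run-unique 0 (s + s))
      (λ q lo → All.map (λ {k} p → subst (_≤ k) (sym (ℕ.+-identityʳ lo)) (proj₁ p) , proj₂ p) (run-bounds lo (suc (q + q))))
      (λ q lo k h h′ → run-complete lo (suc (q + q)) (subst (_≤ k) (ℕ.+-identityʳ lo) h) h′)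
      (λ q lo → run-unique lo (suc (q + q)))

    whiteLayout : Layout 1 (growWhites c 0 c)
    whiteLayout = layout 1 ℕ.≤-refl shrinkWhite growWhite
      (λ s → All.map proj₂ (run-bounds 0 (s + s + 1)))
      (λ s k h → run-complete 0 (s + s + 1) z≤n h)
      (λ s → run-unique 0 (s + s + 1))
      (λ q lo → All.map (λ {k} p → subst (_≤ k) (ℕ.+-comm 1 lo) (proj₁ p) , subst (k <_) (white-count q lo) (proj₂ p)) (run-bounds (suc lo) (q + q + 0)))
      (λ q lo k h h′ → run-complete (suc lo) (q + q + 0) (subst (_≤ k) (ℕ.+-comm lo 1) h) (subst (k <_) (sym (white-count q lo)) h′))
      (λ q lo → run-unique (suc lo) (q + q + 0))

    exponents : ∀ {n d vs} → Layout d vs → length vs ≡ n → Exponents a (Degree d) n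
    exponents {n} {d} {vs} lay e = record
      { I = λ t → proj₁ (fit t)
      ; J = λ t → c′ + proj₁ (vertex vs e t)
      ; K = λ t → proj₂ (vertex vs e t)
      ; J<I = λ t → proj₁ (proj₂ (proj₂ (fit t)))
      ; K<J = λ t → proj₁ (proj₂ (proj₂ (proj₂ (fit t))))
      ; I<2a = λ t → proj₂ (proj₂ (proj₂ (proj₂ (fit t))))
      ; degree = λ t → proj₁ (proj₂ (fit t))
      ; complete = λ i j k h₁ h₂ h₃ deg → comp i j k deg (exhaustive i j k h₁ h₂ h₃ deg)
      ; injective = λ p q → vertex-injective vs e unique (cong₂ _,_ (ℕ.+-cancelˡ-≡ c′ _ _ p) q)
      }
      where
      open Layout lay
      fit : ∀ t → Fits d (vertex vs e t)
      fit = vertex-all vs e all-fit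
      comp : ∀ i j k → i + j + k ≡ Degree d → (Σ ℕ λ r → j ≡ c′ + r × (r , k) ∈ vs) →
             Σ (Fin n) λ t → i ≡ proj₁ (fit t) × j ≡ c′ + proj₁ (vertex vs e t) × k ≡ proj₂ (vertex vs e t)
      comp i j k deg (r , refl , p) with vertex-∈ vs e p
      ... | t , refl = t , ℕ.+-cancelʳ-≡ (c′ + r) i _ (ℕ.+-cancelʳ-≡ k _ _ (trans deg (sym (proj₁ (proj₂ (fit t)))))) , refl , refl

    size : ℕ
    size = length (growBlacks c 0 c)

    blackVertex whiteVertex : Fin size → Vertex
    blackVertex = vertex (growBlacks c 0 c) refl
    whiteVertex = vertex (growWhites c 0 c) (blacks≡whites c)

    blackExponents : Exponents a (Degree 0) size
    blackExponents = exponents blackLayout refl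

    whiteExponents : Exponents a (Degree 1) size
    whiteExponents = exponents whiteLayout (blacks≡whites c)

    -- Row 0 would have j = c - 1, which `c≤j` excludes.
    whiteRow : ∀ w → Σ ℕ λ r → proj₁ (whiteVertex w) ≡ suc r
    whiteRow w = positive _ (Bounds.c≤j c′ 1 (W.I w) (W.J w) (W.K w) (W.K<J w) (W.I<2a w) (W.degree w))
      where
      module W = Exponents whiteExponents
      positive : ∀ r → c ≤ c′ + r → Σ ℕ λ r′ → r ≡ suc r′
      positive zero    p = ⊥-elim (ℕ.1+n≰n (subst (c ≤_) (ℕ.+-identityʳ c′) p))
      positive (suc r) p = r , refl

    module M = Multiplication blackExponents whiteExponents c′ (proj₁ ∘ blackVertex) (proj₁ ∘ whiteRow)
      (λ _ → refl) (λ w → cong (c′ +_) (proj₂ (whiteRow w)))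

    ∣det-adjacency∣ : ∣ det size M.adjacency ∣ ≡ length (growChains c 0 c [])
    ∣det-adjacency∣ = begin
      ∣ det size M.adjacency ∣
        ≡⟨ cong ∣_∣ (det-cong size (λ w b → cong (λ r → adj (r , proj₂ (whiteVertex w)) (blackVertex b)) (sym (proj₂ (whiteRow w))))) ⟩
      ∣ det size (λ w b → adj (whiteVertex w) (blackVertex b)) ∣
        ≡⟨ cong ∣_∣ (det-detL size (adj ∘ whiteVertex) blackVertex) ⟩
      ∣ detL (tabulate (adj ∘ whiteVertex)) (tabulate blackVertex) ∣
        ≡⟨ cong₂ (λ ws bs → ∣ detL ws bs ∣) (sym (L.map-tabulate whiteVertex adj)) (tabulate-vertex (growBlacks c 0 c) refl) ⟩
      ∣ detA (tabulate whiteVertex) (growBlacks c 0 c) ∣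
        ≡⟨ cong (λ ws → ∣ detA ws (growBlacks c 0 c) ∣) (tabulate-vertex (growWhites c 0 c) (blacks≡whites c)) ⟩
      ∣ detA (growWhites c 0 c) (growBlacks c 0 c) ∣
        ≡⟨ ∣detA∣ c ⟩
      length (growChains c 0 c []) ∎
      where open ≡-Reasoning

-- Cyclically symmetric transpose complementary plane partitions and their c × c block.

module PlanePartitions where

  open LinearArithmetic
  open import Data.Nat using (_∸_; _+_; _<ᵇ_)
  open import Data.Bool using (not; if_then_else_)
  open import Data.Bool.Properties using (not-involutive)
  open import Data.Fin using (Fin; toℕ; fromℕ<; opposite)
  import Data.Fin.Properties as Fin
  import Data.Vec as Vec
  import Data.Vec.Properties as Vec
  open import Function.Bundles using (mk⇔; module Equivalence)

  bool-ext : ∀ {x y} → (x ≡ true → y ≡ true) → (y ≡ true → x ≡ true) → x ≡ y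
  bool-ext {true}  {y}     f g = sym (f refl)
  bool-ext {false} {false} f g = refl
  bool-ext {false} {true}  f g = g refl

  <ᵇ-reflect : ∀ {k k′ m m′ a} → suc (k + k′) ≡ a → m + m′ ≡ a → (k <ᵇ m) ≡ not (k′ <ᵇ m′)
  <ᵇ-reflect {k} {k′} {m} {m′} refl e with k′ <ᵇ m′ in t
  ... | false = <⇒<ᵇ-true (ℕ.+-cancelʳ-< k′ k m (ℕ.≤-trans (ℕ.≤-reflexive (sym e)) (ℕ.+-monoʳ-≤ m (<ᵇ-false⇒≥ {k′} t))))
  ... | true = ≥⇒<ᵇ-false (ℕ.+-cancelʳ-≤ (suc k′) m k (ℕ.≤-trans (ℕ.+-monoʳ-≤ m (<ᵇ-true⇒< {k′} t))
                 (ℕ.≤-reflexive (trans e (sym (ℕ.+-suc k k′))))))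

  -- The length of the initial run of `true`, which is the height of a column of cubes because
  -- columns are closed downwards.
  count : (ℕ → Bool) → ℕ → ℕ
  count P zero    = 0
  count P (suc n) = if P zero then suc (count (P ∘ suc) n) else 0

  count-≤ : ∀ P n → count P n ≤ n
  count-≤ P zero = z≤n
  count-≤ P (suc n) with P zero
  ... | true  = s≤s (count-≤ (P ∘ suc) n)
  ... | false = z≤n

  count-sound : ∀ P n k → k < count P n → P k ≡ true
  count-sound P (suc n) k p with P zero in e
  count-sound P (suc n) zero    p       | true = e
  count-sound P (suc n) (suc k) (s≤s p) | true = count-sound (P ∘ suc) n k p

  count-complete : ∀ P n k → k < n → (∀ i → i ≤ k → P i ≡ true) → k < count P n
  count-complete P (suc n) k p f with P zero in e
  count-complete P (suc n) k p f | false with trans (sym e) (f 0 z≤n)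
  ... | ()
  count-complete P (suc n) zero    p       f | true = s≤s z≤n
  count-complete P (suc n) (suc k) (s≤s p) f | true = s≤s (count-complete (P ∘ suc) n k p (λ i q → f (suc i) (s≤s q)))

  threshold-≤ : ∀ {m n a} → m ≤ a → (∀ k → k < a → k < m → k < n) → m ≤ n
  threshold-≤ {zero}  p f = z≤n
  threshold-≤ {suc m} p f = f m p ℕ.≤-refl

  -- The 0-based form of i ↦ a + 1 - i.
  inv : ℕ → ℕ → ℕ
  inv a x = a ∸ suc x

  inv-sum : ∀ {a x} → x < a → suc (x + inv a x) ≡ a
  inv-sum {a} {x} p = ℕ.m+[n∸m]≡n p

  inv-< : ∀ {a x} → x < a → inv a x < a
  inv-< {a} {x} p = ℕ.≤-trans (s≤s (ℕ.m≤n+m (inv a x) x)) (ℕ.≤-reflexive (inv-sum p))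

  inv-inv : ∀ {a x} → x < a → inv a (inv a x) ≡ x
  inv-inv {a} {x} p = ℕ.+-cancelˡ-≡ (inv a x) _ _ (ℕ.suc-injective
    (trans (inv-sum (inv-< p)) (trans (sym (inv-sum p)) (cong suc (ℕ.+-comm x (inv a x))))))

  inv-anti : ∀ {a x y} → x ≤ y → inv a y ≤ inv a x
  inv-anti {a} p = ℕ.∸-monoʳ-≤ a (s≤s p)

  -- The conditions of `IsCSTC` for arrays indexed by ℕ. For `cyclic` one implication is stored;
  -- applying it twice gives the converse.
  record Symmetric (a : ℕ) (e : ℕ → ℕ → ℕ) : Set where
    field
      bound  : ∀ {i j} → i < a → j < a → e i j ≤ a
      mono₁  : ∀ {i i′ j} → i ≤ i′ → i′ < a → j < a → e i′ j ≤ e i j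
      mono₂  : ∀ {i j j′} → i < a → j ≤ j′ → j′ < a → e i j′ ≤ e i j
      cyclic : ∀ {i j k} → i < a → j < a → k < a → k < e i j → i < e j k
      compl  : ∀ {i j} → i < a → j < a → e j i ≡ a ∸ e (inv a i) (inv a j)

  module _ {a : ℕ} where

    height : Matrix a → ℕ → ℕ → ℕ
    height π i j with i ℕ.<? a | j ℕ.<? a
    ... | yes p | yes q = entry π (fromℕ< p) (fromℕ< q)
    ... | _     | _     = 0

    height-< : ∀ π {i j} (p : i < a) (q : j < a) → height π i j ≡ entry π (fromℕ< p) (fromℕ< q)
    height-< π {i} {j} p q with i ℕ.<? a | j ℕ.<? a
    ... | yes p′ | yes q′ = cong₂ (entry π) (Fin.fromℕ<-cong i i refl p′ p) (Fin.fromℕ<-cong j j refl q′ q)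
    ... | no ¬p | _ = ⊥-elim (¬p p)
    ... | yes _ | no ¬q = ⊥-elim (¬q q)

    height-toℕ : ∀ π i j → height π (toℕ i) (toℕ j) ≡ entry π i j
    height-toℕ π i j = trans (height-< π (Fin.toℕ<n i) (Fin.toℕ<n j)) (cong₂ (entry π) (Fin.fromℕ<-toℕ i _) (Fin.fromℕ<-toℕ j _))

    toℕ-opposite : ∀ (i : Fin a) → toℕ (opposite i) ≡ inv a (toℕ i)
    toℕ-opposite = Fin.opposite-prop

    fromArray : (ℕ → ℕ → ℕ) → Matrix a
    fromArray e = Vec.tabulate (λ i → Vec.tabulate (λ j → e (toℕ i) (toℕ j)))

    entry-fromArray : ∀ e i j → entry (fromArray e) i j ≡ e (toℕ i) (toℕ j)
    entry-fromArray e i j = trans (cong (λ v → Vec.lookup v j) (Vec.lookup∘tabulate _ i)) (Vec.lookup∘tabulate _ j)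

    height-fromArray : ∀ e {i j} → i < a → j < a → height (fromArray e) i j ≡ e i j
    height-fromArray e p q = trans (height-< (fromArray e) p q)
      (trans (entry-fromArray e _ _) (cong₂ e (Fin.toℕ-fromℕ< p) (Fin.toℕ-fromℕ< q)))

    fromArray-height : ∀ π e → (∀ {i j} → i < a → j < a → e i j ≡ height π i j) → fromArray e ≡ π
    fromArray-height π e f = trans (Vec.tabulate-cong (λ i → trans
        (Vec.tabulate-cong (λ j → trans (f (Fin.toℕ<n i) (Fin.toℕ<n j)) (height-toℕ π i j)))
        (Vec.tabulate∘lookup (Vec.lookup π i))))
      (Vec.tabulate∘lookup π)

    CSTC⇒symmetric : ∀ π → IsCSTC a π → Symmetric a (height π)
    CSTC⇒symmetric π ((bd , m₁ , m₂) , cs , tc) = record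
      { bound = λ p q → subst (_≤ a) (sym (height-< π p q)) (bd _ _)
      ; mono₁ = λ {i} {i′} l p q → subst₂ _≤_ (sym (height-< π p q)) (sym (height-< π (ℕ.≤-<-trans l p) q))
                  (m₁ _ _ _ (subst₂ _≤_ (sym (Fin.toℕ-fromℕ< (ℕ.≤-<-trans l p))) (sym (Fin.toℕ-fromℕ< p)) l))
      ; mono₂ = λ {i} {j} {j′} p l q → subst₂ _≤_ (sym (height-< π p q)) (sym (height-< π p (ℕ.≤-<-trans l q)))
                  (m₂ _ _ _ (subst₂ _≤_ (sym (Fin.toℕ-fromℕ< (ℕ.≤-<-trans l q))) (sym (Fin.toℕ-fromℕ< q)) l))
      ; cyclic = λ {i} {j} {k} p q r h → subst₂ _≤_ (cong suc (Fin.toℕ-fromℕ< p)) (sym (height-< π q r))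
                  (Equivalence.to (cs (fromℕ< p) (fromℕ< q) (fromℕ< r))
                    (subst₂ _≤_ (cong suc (sym (Fin.toℕ-fromℕ< r))) (height-< π p q) h))
      ; compl = λ {i} {j} p q → trans (height-< π q p) (trans (tc (fromℕ< p) (fromℕ< q))
                  (cong (a ∸_) (trans (sym (height-toℕ π _ _)) (cong₂ (height π)
                    (trans (toℕ-opposite (fromℕ< p)) (cong (inv a) (Fin.toℕ-fromℕ< p)))
                    (trans (toℕ-opposite (fromℕ< q)) (cong (inv a) (Fin.toℕ-fromℕ< q)))))))
      }

    symmetric⇒CSTC : ∀ e → Symmetric a e → IsCSTC a (fromArray e)
    symmetric⇒CSTC e s =
        ( (λ i j → subst (_≤ a) (sym (entry-fromArray e i j)) (bound (Fin.toℕ<n i) (Fin.toℕ<n j)))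
        , (λ i i′ j l → subst₂ _≤_ (sym (entry-fromArray e i′ j)) (sym (entry-fromArray e i j)) (mono₁ l (Fin.toℕ<n i′) (Fin.toℕ<n j)))
        , (λ i j j′ l → subst₂ _≤_ (sym (entry-fromArray e i j′)) (sym (entry-fromArray e i j)) (mono₂ (Fin.toℕ<n i) l (Fin.toℕ<n j′))))
      , (λ i j k → mk⇔ (cyc i j k) (cyc k i j ∘ cyc j k i))
      , (λ i j → trans (entry-fromArray e j i) (trans (compl (Fin.toℕ<n i) (Fin.toℕ<n j))
          (cong (a ∸_) (sym (trans (entry-fromArray e (opposite i) (opposite j)) (cong₂ e (toℕ-opposite i) (toℕ-opposite j)))))))
      where
      open Symmetric s
      cyc : ∀ i j k → InS (fromArray e) i j k → InS (fromArray e) j k i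
      cyc i j k h = subst (toℕ i <_) (sym (entry-fromArray e j k))
        (cyclic (Fin.toℕ<n i) (Fin.toℕ<n j) (Fin.toℕ<n k) (subst (toℕ k <_) (entry-fromArray e i j) h))

  module Extension (c : ℕ) where

    a : ℕ
    a = c + c

    small : ℕ → Bool
    small x = x <ᵇ c

    small-inv : ∀ {x} → x < a → small x ≡ not (small (inv a x))
    small-inv {x} p = <ᵇ-reflect {x} {inv a x} {c} {c} (inv-sum p) refl

    record Block (β : ℕ → ℕ → ℕ) : Set where
      field
        β-bound : ∀ {i j} → i < c → j < c → β i j ≤ a
        β-mono₁ : ∀ {i i′ j} → i ≤ i′ → i′ < c → j < c → β i′ j ≤ β i j
        β-mono₂ : ∀ {i j j′} → i < c → j ≤ j′ → j′ < c → β i j′ ≤ β i j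
        β-low₁  : ∀ {i j} → i < c → j < c → a ≤ β i j + i
        β-low₂  : ∀ {i j} → i < c → j < c → a ≤ β i j + j

    -- The first three flags tell which coordinates of a cube are below c. The tests `p`, `q`, `r`
    -- belong to the pairs (i, j), (j, k), (k, i). Three small coordinates always give a cube of the
    -- partition, since the entries of the block exceed c; three large ones form the complementary
    -- case.
    choose : Bool → Bool → Bool → Bool → Bool → Bool → Bool
    choose true  true  true  p q r = true
    choose false false false p q r = false
    choose true  true  false p q r = p
    choose false false true  p q r = p
    choose true  false false p q r = q
    choose false true  true  p q r = q
    choose true  false true  p q r = r
    choose false true  false p q r = r

    choose-cyclic : ∀ x y z p q r → choose x y z p q r ≡ choose y z x q r p
    choose-cyclic true  true  true  p q r = refl
    choose-cyclic false false false p q r = refl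
    choose-cyclic true  true  false p q r = refl
    choose-cyclic false false true  p q r = refl
    choose-cyclic true  false false p q r = refl
    choose-cyclic false true  true  p q r = refl
    choose-cyclic true  false true  p q r = refl
    choose-cyclic false true  false p q r = refl

    -- Transposition exchanges the pairs (j, k) and (k, i), hence `q` is compared with `r′` and `r`
    -- with `q′`.
    choose-compl : ∀ x y z {p q r p′ q′ r′} → (x ≡ y → p ≡ not p′) → (x ≡ z → q ≡ not r′) → (y ≡ z → r ≡ not q′) →
                   choose y x z p q r ≡ not (choose (not x) (not y) (not z) p′ q′ r′)
    choose-compl true  true  true  f g h = refl
    choose-compl false false false f g h = refl
    choose-compl true  true  false f g h = f refl
    choose-compl false false true  f g h = f refl
    choose-compl true  false false f g h = h refl
    choose-compl false true  true  f g h = h refl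
    choose-compl true  false true  f g h = g refl
    choose-compl false true  false f g h = g refl

    -- When the third coordinate drops from large to small, the pair on one side of c may change
    -- from (j, k) to (k₀, i), or from (k, i) to (j, k₀). The two hypotheses with four equations are
    -- for these crossings.
    choose-mono : ∀ x y z z₀ {p q r p₀ q₀ r₀} → (z ≡ true → z₀ ≡ true) → (p ≡ true → p₀ ≡ true) →
      (y ≡ z → y ≡ z₀ → q ≡ true → q₀ ≡ true) → (z ≡ x → z₀ ≡ x → r ≡ true → r₀ ≡ true) →
      (x ≡ true → y ≡ false → z ≡ false → z₀ ≡ true → q ≡ true → r₀ ≡ true) →
      (x ≡ false → y ≡ true → z ≡ false → z₀ ≡ true → r ≡ true → q₀ ≡ true) →
      choose x y z p q r ≡ true → choose x y z₀ p₀ q₀ r₀ ≡ true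
    choose-mono _     _     true  false hz hp hq hr hqr hrq t with () ← hz refl
    choose-mono true  true  _     true  hz hp hq hr hqr hrq t = refl
    choose-mono true  true  false false hz hp hq hr hqr hrq t = hp t
    choose-mono false false true  true  hz hp hq hr hqr hrq t = hp t
    choose-mono true  false true  true  hz hp hq hr hqr hrq t = hr refl refl t
    choose-mono true  false false false hz hp hq hr hqr hrq t = hq refl refl t
    choose-mono true  false false true  hz hp hq hr hqr hrq t = hqr refl refl refl refl t
    choose-mono false true  true  true  hz hp hq hr hqr hrq t = hq refl refl t
    choose-mono false true  false false hz hp hq hr hqr hrq t = hr refl refl t
    choose-mono false true  false true  hz hp hq hr hqr hrq t = hrq refl refl refl refl t

    module _ (β : ℕ → ℕ → ℕ) where

      -- β extended to pairs of indices that are both at least c, by transpose-complementarity.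
      ext : ℕ → ℕ → ℕ
      ext x y = if small x then β x y else a ∸ β (inv a y) (inv a x)

      -- Two of the three indices lie on the same side of c; cyclic symmetry reduces to that pair.
      cube : ℕ → ℕ → ℕ → Bool
      cube i j k = choose (small i) (small j) (small k) (k <ᵇ ext i j) (i <ᵇ ext j k) (j <ᵇ ext k i)

      extend : ℕ → ℕ → ℕ
      extend i j = count (cube i j) a

      cube-cyclic : ∀ i j k → cube i j k ≡ cube j k i
      cube-cyclic i j k = choose-cyclic (small i) (small j) (small k) _ _ _

      module _ (block : Block β) where
        open Block block

        private
          big-inv : ∀ {x} → x < a → small x ≡ false → inv a x < c
          big-inv {x} p e = <ᵇ-true⇒< (trans (sym (not-involutive _)) (cong not (trans (sym (small-inv p)) e)))

        ext-small : ∀ {x} y → small x ≡ true → ext x y ≡ β x y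
        ext-small y e rewrite e = refl

        ext-big : ∀ {x} y → small x ≡ false → ext x y ≡ a ∸ β (inv a y) (inv a x)
        ext-big y e rewrite e = refl

        ext-compl : ∀ {x y} → x < a → y < a → small x ≡ small y → ext y x + ext (inv a x) (inv a y) ≡ a
        ext-compl {x} {y} p q e with small x in ex
        ... | true = begin
          ext y x + ext (inv a x) (inv a y)
            ≡⟨ cong₂ _+_ (ext-small x (sym e)) (ext-big (inv a y) (trans (sym (not-involutive _)) (cong not (trans (sym (small-inv p)) ex)))) ⟩
          β y x + (a ∸ β (inv a (inv a y)) (inv a (inv a x)))
            ≡⟨ cong₂ (λ u v → β y x + (a ∸ β u v)) (inv-inv q) (inv-inv p) ⟩
          β y x + (a ∸ β y x)
            ≡⟨ ℕ.m+[n∸m]≡n (β-bound (<ᵇ-true⇒< {y} (sym e)) (<ᵇ-true⇒< {x} ex)) ⟩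
          a ∎
          where open ≡-Reasoning
        ... | false = begin
          ext y x + ext (inv a x) (inv a y)
            ≡⟨ cong₂ _+_ (ext-big x (sym e)) (ext-small (inv a y) (<⇒<ᵇ-true (big-inv p ex))) ⟩
          a ∸ β (inv a x) (inv a y) + β (inv a x) (inv a y)
            ≡⟨ ℕ.m∸n+n≡m (β-bound (big-inv p ex) (big-inv q (sym e))) ⟩
          a ∎
          where open ≡-Reasoning

        cube-compl : ∀ {i j k} → i < a → j < a → k < a → cube j i k ≡ not (cube (inv a i) (inv a j) (inv a k))
        cube-compl {i} {j} {k} p q r = trans
          (choose-compl (small i) (small j) (small k)
            (λ e → <ᵇ-reflect {k} {inv a k} {ext j i} {ext (inv a i) (inv a j)} (inv-sum r) (ext-compl p q e))
            (λ e → <ᵇ-reflect {j} {inv a j} {ext i k} {ext (inv a k) (inv a i)} (inv-sum q) (ext-compl r p (sym e)))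
            (λ e → <ᵇ-reflect {i} {inv a i} {ext k j} {ext (inv a j) (inv a k)} (inv-sum p) (ext-compl q r e)))
          (cong not (trans (cong (λ x → choose x (not (small j)) (not (small k)) P Q R) (flip p))
            (trans (cong (λ x → choose (small (inv a i)) x (not (small k)) P Q R) (flip q))
                   (cong (λ x → choose (small (inv a i)) (small (inv a j)) x P Q R) (flip r)))))
          where
          P = inv a k <ᵇ ext (inv a i) (inv a j)
          Q = inv a i <ᵇ ext (inv a j) (inv a k)
          R = inv a j <ᵇ ext (inv a k) (inv a i)
          flip : ∀ {x} → x < a → not (small x) ≡ small (inv a x)
          flip p = trans (cong not (small-inv p)) (not-involutive _)

        private
          -- The bound on `b′` gives x < inv a y, that is x + y < a - 1, whence y < a - x ≤ b. This
          -- is how the lower bounds on the block yield monotonicity across the middle.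
          crossing : ∀ {x y b b′} → y < a → a ≤ b + x → a ≤ b′ + inv a y → x < a ∸ b′ → y < b
          crossing {x} {y} {b} {b′} y<a l l′ h = ℕ.+-cancelʳ-< x y b (ℕ.<-≤-trans
            (ℕ.≤-trans (ℕ.+-monoʳ-< y (ℕ.<-≤-trans h (ℕ.m≤n+o⇒m∸n≤o a b′ l′))) (ℕ.≤-trans (ℕ.n≤1+n _) (ℕ.≤-reflexive (inv-sum y<a)))) l)

        ext-mono₁ : ∀ {x x′ y} → x ≤ x′ → x′ < a → y < a → small x ≡ small y → small x′ ≡ small y → ext x′ y ≤ ext x y
        ext-mono₁ {x} {x′} {y} l p q e e′ with small y in ey
        ... | true  = subst₂ _≤_ (sym (ext-small y e′)) (sym (ext-small y e)) (β-mono₁ l (<ᵇ-true⇒< {x′} e′) (<ᵇ-true⇒< {y} ey))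
        ... | false = subst₂ _≤_ (sym (ext-big y e′)) (sym (ext-big y e))
          (ℕ.∸-monoʳ-≤ a (β-mono₂ (big-inv q ey) (inv-anti {a} l) (big-inv (ℕ.≤-<-trans l p) e)))

        ext-mono₂ : ∀ {x y y′} → x < a → y ≤ y′ → y′ < a → small x ≡ small y → small x ≡ small y′ → ext x y′ ≤ ext x y
        ext-mono₂ {x} {y} {y′} q l p e e′ with small x in ex
        ... | true  = β-mono₂ (<ᵇ-true⇒< {x} ex) l (<ᵇ-true⇒< {y′} (sym e′))
        ... | false = ℕ.∸-monoʳ-≤ a (β-mono₁ (inv-anti {a} l) (big-inv (ℕ.≤-<-trans l p) (sym e)) (big-inv q ex))

        -- Only the third coordinate is treated; `cube-cyclic` rotates the others into its place.
        cube-mono : ∀ {i j k₀ k} → i < a → j < a → k₀ ≤ k → k < a → cube i j k ≡ true → cube i j k₀ ≡ true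
        cube-mono {i} {j} {k₀} {k} i<a j<a k₀≤k k<a = choose-mono (small i) (small j) (small k) (small k₀)
          (λ e → <⇒<ᵇ-true {k₀} {c} (ℕ.≤-<-trans k₀≤k (<ᵇ-true⇒< {k} e)))
          (λ t → <⇒<ᵇ-true {k₀} {ext i j} (ℕ.≤-<-trans k₀≤k (<ᵇ-true⇒< {k} t)))
          (λ e e₀ t → <⇒<ᵇ-true (ℕ.<-≤-trans (<ᵇ-true⇒< {i} t) (ext-mono₂ j<a k₀≤k k<a e₀ e)))
          (λ e e₀ t → <⇒<ᵇ-true (ℕ.<-≤-trans (<ᵇ-true⇒< {j} t) (ext-mono₁ k₀≤k k<a i<a e₀ e)))
          (λ ei ej ek e₀ t → <⇒<ᵇ-true (subst (j <_) (sym (ext-small i e₀))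
            (crossing j<a (β-low₂ (<ᵇ-true⇒< {k₀} e₀) (<ᵇ-true⇒< {i} ei))
              (β-low₂ (big-inv k<a ek) (big-inv j<a ej)) (subst (i <_) (ext-big k ej) (<ᵇ-true⇒< {i} t)))))
          (λ ei ej ek e₀ t → <⇒<ᵇ-true (subst (i <_) (sym (ext-small k₀ ej))
            (crossing i<a (β-low₁ (<ᵇ-true⇒< {j} ej) (<ᵇ-true⇒< {k₀} e₀))
              (β-low₁ (big-inv i<a ei) (big-inv k<a ek)) (subst (j <_) (ext-big i ek) (<ᵇ-true⇒< {j} t)))))

        extend-sound : ∀ {i j k} → k < extend i j → cube i j k ≡ true
        extend-sound {i} {j} {k} = count-sound (cube i j) a k

        extend-complete : ∀ {i j k} → i < a → j < a → k < a → cube i j k ≡ true → k < extend i j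
        extend-complete {i} {j} {k} p q r t = count-complete (cube i j) a k r (λ x l → cube-mono p q l r t)

        extend-symmetric : Symmetric a extend
        extend-symmetric = record
          { bound  = λ {i} {j} _ _ → count-≤ (cube i j) a
          ; mono₁  = λ {i} {i′} {j} l p q → threshold-≤ (count-≤ (cube i′ j) a) (λ k r h → extend-complete (ℕ.≤-<-trans l p) q r
                       (trans (cube-cyclic i j k) (cube-mono q r l p (trans (sym (cube-cyclic i′ j k)) (extend-sound h)))))
          ; mono₂  = λ {i} {j} {j′} p l q → threshold-≤ (count-≤ (cube i j′) a) (λ k r h → extend-complete p (ℕ.≤-<-trans l q) r
                       (trans (sym (cube-cyclic k i j)) (cube-mono r p l q (trans (cube-cyclic k i j′) (extend-sound h)))))
          ; cyclic = λ {i} {j} {k} p q r h → extend-complete q r p (trans (sym (cube-cyclic i j k)) (extend-sound h))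
          ; compl  = λ {i} {j} p q → ℕ.≤-antisym
              (threshold-≤ (count-≤ (cube j i) a) (λ k r h → flip-< {k} {extend (inv a i) (inv a j)} r (λ h′ → true≢false
                (trans (sym (extend-sound h)) (trans (cube-compl p q r) (cong not (extend-sound h′)))))))
              (threshold-≤ (ℕ.m∸n≤m a (extend (inv a i) (inv a j))) (λ k r h → extend-complete q p r (trans (cube-compl p q r) (cong not (¬true
                (λ t → unflip-< {k} {extend (inv a i) (inv a j)} r h (extend-complete (inv-< p) (inv-< q) (inv-< r) t)))))))
          }
          where
          true≢false : true ≢ false
          true≢false ()
          ¬true : ∀ {x} → ¬ (x ≡ true) → x ≡ false
          ¬true {true}  f = ⊥-elim (f refl)
          ¬true {false} f = refl
          flip-< : ∀ {k m} → k < a → ¬ (inv a k < m) → k < a ∸ m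
          flip-< {k} {m} r f = ℕ.m+n≤o⇒m≤o∸n (suc k) (ℕ.≤-trans (ℕ.+-monoʳ-≤ (suc k) (ℕ.≮⇒≥ f)) (ℕ.≤-reflexive (inv-sum r)))
          unflip-< : ∀ {k m} → k < a → k < a ∸ m → ¬ (inv a k < m)
          unflip-< {k} {m} r h h′ = ℕ.<⇒≱ h (ℕ.m≤n+o⇒m∸n≤o a m (ℕ.≤-trans (ℕ.≤-reflexive (trans (sym (inv-sum r)) (cong suc (ℕ.+-comm k (inv a k))))) (ℕ.+-monoˡ-≤ k h′)))

        extend-block : ∀ {i j} → i < c → j < c → extend i j ≡ β i j
        extend-block {i} {j} p q = ℕ.≤-antisym
          (threshold-≤ (count-≤ (cube i j) a) (λ k r h → to k (extend-sound h)))
          (threshold-≤ (β-bound p q) (λ k r h → extend-complete (up p) (up q) r (from k h)))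
          where
          up : ∀ {x} → x < c → x < a
          up r = ℕ.<-≤-trans r (ℕ.m≤m+n c c)
          -- Follows from a ≤ β i j + i and i < c. Hence all cubes over the block with k < c are
          -- present, as the first clause of `choose` asserts.
          c<β : c < β i j
          c<β = ℕ.+-cancelʳ-< i c (β i j) (ℕ.<-≤-trans (ℕ.+-monoʳ-< c p) (β-low₁ p q))
          to : ∀ k → cube i j k ≡ true → k < β i j
          to k t with small k in ek
          ... | true  = ℕ.<-trans (<ᵇ-true⇒< {k} ek) c<β
          ... | false rewrite <⇒<ᵇ-true p | <⇒<ᵇ-true q = <ᵇ-true⇒< t
          from : ∀ k → k < β i j → cube i j k ≡ true
          from k h rewrite <⇒<ᵇ-true p | <⇒<ᵇ-true q with small k
          ... | true  = refl
          ... | false = <⇒<ᵇ-true h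

    module _ {e : ℕ → ℕ → ℕ} (s : Symmetric a e) where
      open Symmetric s

      private
        up : ∀ {x} → x < c → x < a
        up r = ℕ.<-≤-trans r (ℕ.m≤m+n c c)

        cyclic⁻ : ∀ {i j k} → i < a → j < a → k < a → i < e j k → k < e i j
        cyclic⁻ p q r h = cyclic r p q (cyclic q r p h)

        inv-≤ : ∀ {x m} → x < a → m ≤ inv a x → x < a ∸ m
        inv-≤ {x} p h = ℕ.m+n≤o⇒m≤o∸n (suc x) (ℕ.≤-trans (ℕ.+-monoʳ-≤ (suc x) h) (ℕ.≤-reflexive (inv-sum p)))

        c<a : ∀ {x} → x < c → c < a
        c<a p = ℕ.m<m+n c (ℕ.≤-<-trans z≤n p)

        inv-c : ∀ {x} → x < c → suc (inv a c) ≡ c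
        inv-c p = ℕ.+-cancelˡ-≡ c _ _ (trans (ℕ.+-suc c (inv a c)) (inv-sum (c<a p)))

        inv-c<c : ∀ {x} → x < c → inv a c < c
        inv-c<c p = ℕ.≤-reflexive (inv-c p)

      -- If (i , c - 1 , inv i) were not in the partition, its complement (c , inv i , i), and hence the
      -- rotation (i , c , inv i), would be, contradicting monotonicity.
      last-column : ∀ {i} → i < c → inv a i < e i (inv a c)
      last-column {i} p = ℕ.≰⇒> λ le → ℕ.<⇒≱
        (ℕ.<-≤-trans (cyclic⁻ (up p) (c<a p) (inv-< (up p))
          (subst (i <_) (sym (trans (compl (inv-< (up p)) (c<a p)) (cong (λ x → a ∸ e x (inv a c)) (inv-inv (up p))))) (inv-≤ (up p) le)))
          (mono₂ (up p) (ℕ.≤-trans (ℕ.n≤1+n _) (inv-c<c p)) (c<a p))) le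

      -- The same contradiction with rows and columns exchanged, and with the rotation in the
      -- opposite direction.
      last-row : ∀ {j} → j < c → inv a j < e (inv a c) j
      last-row {j} p = ℕ.≰⇒> λ le → ℕ.<⇒≱
        (ℕ.<-≤-trans (cyclic (inv-< (up p)) (c<a p) (up p)
          (subst (j <_) (sym (trans (compl (c<a p) (inv-< (up p))) (cong (λ x → a ∸ e (inv a c) x) (inv-inv (up p))))) (inv-≤ (up p) le)))
          (mono₁ (ℕ.≤-trans (ℕ.n≤1+n _) (inv-c<c p)) (c<a p) (up p))) le

      symmetric-block : Block e
      symmetric-block = record
        { β-bound = λ p q → bound (up p) (up q)
        ; β-mono₁ = λ l p q → mono₁ l (up p) (up q)
        ; β-mono₂ = λ p l q → mono₂ (up p) l (up q)
        ; β-low₁  = λ {i} {j} p q → low p (ℕ.<-≤-trans (last-column p) (mono₂ (up p) (below q) (up (inv-c<c p))))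
        ; β-low₂  = λ {i} {j} p q → low q (ℕ.<-≤-trans (last-row q) (mono₁ (below p) (up (inv-c<c p)) (up q)))
        }
        where
        below : ∀ {x} → x < c → x ≤ inv a c
        below p = ℕ.≤-pred (ℕ.≤-trans p (ℕ.≤-reflexive (sym (inv-c p))))
        low : ∀ {x m} → x < c → inv a x < m → a ≤ m + x
        low {x} {m} p h = ℕ.≤-trans (ℕ.≤-reflexive (trans (sym (inv-sum (up p))) (cong suc (ℕ.+-comm x (inv a x))))) (ℕ.+-monoˡ-≤ x h)

      module _ {β : ℕ → ℕ → ℕ} (block : Block β) (agree : ∀ {i j} → i < c → j < c → β i j ≡ e i j) where

        private
          big : ∀ {x} → x < a → small x ≡ false → inv a x < c
          big {x} p t = <ᵇ-true⇒< (trans (sym (not-involutive _)) (cong not (trans (sym (small-inv p)) t)))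

          c<e : ∀ {i j} → i < c → j < c → c < e i j
          c<e {i} {j} p q = ℕ.+-cancelʳ-< i c (e i j) (ℕ.<-≤-trans (ℕ.+-monoʳ-< c p) (Block.β-low₁ symmetric-block p q))

          ext-agree : ∀ {x y} → x < a → y < a → small x ≡ small y → ext β x y ≡ e x y
          ext-agree {x} {y} p q t with small x in ex
          ... | true  = agree (<ᵇ-true⇒< {x} ex) (<ᵇ-true⇒< {y} (sym t))
          ... | false = trans (cong (a ∸_) (agree (big q (sym t)) (big p ex))) (sym (compl q p))

          choose-same : ∀ x y z {p q r t} → (x ≡ y → p ≡ t) → (y ≡ z → q ≡ t) → (z ≡ x → r ≡ t) →
            (x ≡ true → y ≡ true → z ≡ true → t ≡ true) → (x ≡ false → y ≡ false → z ≡ false → t ≡ false) →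
            choose x y z p q r ≡ t
          choose-same true  true  true  hp hq hr ht hf = sym (ht refl refl refl)
          choose-same false false false hp hq hr ht hf = sym (hf refl refl refl)
          choose-same true  true  false hp hq hr ht hf = hp refl
          choose-same false false true  hp hq hr ht hf = hp refl
          choose-same true  false false hp hq hr ht hf = hq refl
          choose-same false true  true  hp hq hr ht hf = hq refl
          choose-same true  false true  hp hq hr ht hf = hr refl
          choose-same false true  false hp hq hr ht hf = hr refl

        cube-agree : ∀ {i j k} → i < a → j < a → k < a → cube β i j k ≡ (k <ᵇ e i j)
        cube-agree {i} {j} {k} p q r = choose-same (small i) (small j) (small k)
          (λ t → cong (k <ᵇ_) (ext-agree p q t))
          (λ t → trans (cong (i <ᵇ_) (ext-agree q r t))
            (bool-ext (λ h → <⇒<ᵇ-true (cyclic⁻ p q r (<ᵇ-true⇒< {i} h))) (λ h → <⇒<ᵇ-true (cyclic p q r (<ᵇ-true⇒< {k} h)))))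
          (λ t → trans (cong (j <ᵇ_) (ext-agree r p t))
            (bool-ext (λ h → <⇒<ᵇ-true (cyclic r p q (<ᵇ-true⇒< {j} h))) (λ h → <⇒<ᵇ-true (cyclic⁻ r p q (<ᵇ-true⇒< {k} h)))))
          -- For three small coordinates the height exceeds c. For three large ones, the next
          -- argument, complementation turns this into a height of at most c.
          (λ ei ej ek → <⇒<ᵇ-true (ℕ.<-trans (<ᵇ-true⇒< {k} ek) (c<e (<ᵇ-true⇒< {i} ei) (<ᵇ-true⇒< {j} ej))))
          (λ ei ej ek → ≥⇒<ᵇ-false (ℕ.≤-trans (subst (_≤ c) (sym (compl q p)) (ℕ.m≤n+o⇒m∸n≤o a _
            (ℕ.+-monoˡ-≤ c (ℕ.<⇒≤ (c<e (big q ej) (big p ei)))))) (<ᵇ-false⇒≥ {k} ek)))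

        extend-unique : ∀ {i j} → i < a → j < a → extend β i j ≡ e i j
        extend-unique {i} {j} p q = ℕ.≤-antisym
          (threshold-≤ (count-≤ (cube β i j) a) (λ k r h → <ᵇ-true⇒< {k} (trans (sym (cube-agree p q r)) (extend-sound β block h))))
          (threshold-≤ (bound p q) (λ k r h → extend-complete β block p q r (trans (cube-agree p q r) (<⇒<ᵇ-true h))))

-- Chains of interlacing sets as the diagonals of a square array.

module Patterns where

  open Interlacing
  open import Data.Nat using (_∸_; _+_; _⊓_)

  nth : {A : Set} → A → List A → ℕ → A
  nth x []       n       = x
  nth x (y ∷ ys) zero    = y
  nth x (y ∷ ys) (suc n) = nth x ys n

  diag : (ℕ → ℕ → ℕ) → ℕ → ℕ → ℕ → List ℕ
  diag μ i j zero    = []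
  diag μ i j (suc n) = μ i j ∷ diag μ (suc i) (suc j) n

  -- The last diagonal in the list is empty: it is the set of size 0 after the last row of the
  -- region.
  shrinkDiags : (ℕ → ℕ → ℕ) → ℕ → ℕ → Chain
  shrinkDiags μ i zero    = []
  shrinkDiags μ i (suc s) = diag μ (suc i) 0 s ∷ shrinkDiags μ (suc i) s

  growDiags : (ℕ → ℕ → ℕ) → ℕ → ℕ → ℕ → Chain
  growDiags μ c q zero     = shrinkDiags μ 0 c
  growDiags μ c q (suc lo) = diag μ 0 lo (suc q) ∷ growDiags μ c (suc q) lo

  nth-diag : ∀ μ i j n d → d < n → nth 0 (diag μ i j n) d ≡ μ (i + d) (j + d)
  nth-diag μ i j (suc n) zero    p       = cong₂ μ (sym (ℕ.+-identityʳ i)) (sym (ℕ.+-identityʳ j))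
  nth-diag μ i j (suc n) (suc d) (s≤s p) = trans (nth-diag μ (suc i) (suc j) n d p) (cong₂ μ (sym (ℕ.+-suc i d)) (sym (ℕ.+-suc j d)))

  nth-shrinkDiags : ∀ μ i s y s′ → s ≡ y + suc s′ → nth [] (shrinkDiags μ i s) y ≡ diag μ (suc (i + y)) 0 s′
  nth-shrinkDiags μ i _ zero    s′ refl rewrite ℕ.+-identityʳ i = refl
  nth-shrinkDiags μ i _ (suc y) s′ refl rewrite ℕ.+-suc i y = nth-shrinkDiags μ (suc i) (y + suc s′) y s′ refl

  nth-growDiags : ∀ μ c q g x lo → g ≡ x + suc lo → nth [] (growDiags μ c q g) x ≡ diag μ 0 lo (suc (q + x))
  nth-growDiags μ c q _ zero    lo refl rewrite ℕ.+-identityʳ q = refl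
  nth-growDiags μ c q _ (suc x) lo refl rewrite ℕ.+-suc q x = nth-growDiags μ c (suc q) (x + suc lo) x lo refl

  nth-growDiags-turn : ∀ μ c q g y → nth [] (growDiags μ c q g) (g + y) ≡ nth [] (shrinkDiags μ 0 c) y
  nth-growDiags-turn μ c q zero    y = refl
  nth-growDiags-turn μ c q (suc g) y = nth-growDiags-turn μ c (suc q) g y

  diag-rebuild : ∀ μ i j n xs → length xs ≡ n → (∀ d → d < n → μ (i + d) (j + d) ≡ nth 0 xs d) → diag μ i j n ≡ xs
  diag-rebuild μ i j _ []       refl f = refl
  diag-rebuild μ i j _ (x ∷ xs) refl f = cong₂ _∷_
    (trans (cong₂ μ (sym (ℕ.+-identityʳ i)) (sym (ℕ.+-identityʳ j))) (f 0 (s≤s z≤n)))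
    (diag-rebuild μ (suc i) (suc j) _ xs refl (λ d p → trans (cong₂ μ (sym (ℕ.+-suc i d)) (sym (ℕ.+-suc j d))) (f (suc d) (s≤s p))))

  -- The chain forces the lengths of its sets, so agreement of the entries is enough.
  shrinkDiags-rebuild : ∀ μ i {s U C} → ShrinkChain s U C → length U ≡ s →
    (∀ y s′ d → s ≡ y + suc s′ → d < s′ → μ (suc (i + y) + d) d ≡ nth 0 (nth [] C y) d) → shrinkDiags μ i s ≡ C
  shrinkDiags-rebuild μ i nil e f = refl
  shrinkDiags-rebuild μ i (cons {s} {U} {V} af ch) e f = cong₂ _∷_
    (diag-rebuild μ (suc i) 0 s V |V| (λ d p → trans (cong (λ z → μ (suc z + d) d) (sym (ℕ.+-identityʳ i))) (f 0 s d refl p)))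
    (shrinkDiags-rebuild μ (suc i) ch |V| (λ y s′ d e p → trans (cong (λ z → μ (suc z + d) d) (sym (ℕ.+-suc i y))) (f (suc y) s′ d (cong suc e) p)))
    where
    |V| : length V ≡ s
    |V| = ℕ.suc-injective (trans (after-length af) e)

  growDiags-rebuild : ∀ μ {c q g U C} → GrowChain c q g U C → length U ≡ q → q + g ≡ c →
    (∀ x lo d → g ≡ x + suc lo → d < suc (q + x) → μ d (lo + d) ≡ nth 0 (nth [] C x) d) →
    (∀ y s d → c ≡ y + suc s → d < s → μ (suc y + d) d ≡ nth 0 (nth [] C (g + y)) d) → growDiags μ c q g ≡ C
  growDiags-rebuild μ (turn ch) |U| e f h = shrinkDiags-rebuild μ 0 ch (trans |U| (trans (sym (ℕ.+-identityʳ _)) e)) h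
  growDiags-rebuild μ (cons {q} {lo} {U} {V} i ch) |U| e f h = cong₂ _∷_
    (diag-rebuild μ 0 lo (suc q) V |V| (λ d p → f 0 lo d refl (subst (λ z → d < suc z) (sym (ℕ.+-identityʳ q)) p)))
    (growDiags-rebuild μ ch |V| (trans (sym (ℕ.+-suc q lo)) e)
      (λ x lo′ d e p → f (suc x) lo′ d (cong suc e) (subst (λ z → d < suc z) (sym (ℕ.+-suc q x)) p)) h)
    where
    |V| : length V ≡ suc q
    |V| = trans (inter-length-grow i) (cong suc |U|)

  grow-at : ∀ μ c q g x lo → GrowChain c q g (diag μ 0 g q) (growDiags μ c q g) → g ≡ x + suc lo →
    Inter false (lo + ((q + x) + (q + x))) lo (diag μ 0 (suc lo) (q + x)) (diag μ 0 lo (suc (q + x)))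
  grow-at μ c q _ zero    lo (cons i _)  refl rewrite ℕ.+-identityʳ q = i
  grow-at μ c q _ (suc x) lo (cons _ ch) refl rewrite ℕ.+-suc q x = grow-at μ c (suc q) (x + suc lo) x lo ch refl

  turn-at : ∀ μ c q g → GrowChain c q g (diag μ 0 g q) (growDiags μ c q g) → q + g ≡ c → ShrinkChain c (diag μ 0 0 c) (shrinkDiags μ 0 c)
  turn-at μ c q zero    (turn ch)   e = subst (λ z → ShrinkChain c (diag μ 0 0 z) _) (trans (sym (ℕ.+-identityʳ q)) e) ch
  turn-at μ c q (suc g) (cons _ ch) e = turn-at μ c (suc q) g ch (trans (sym (ℕ.+-suc q g)) e)

  shrink-at : ∀ μ i s y s′ → ShrinkChain s (diag μ i 0 s) (shrinkDiags μ i s) → s ≡ y + suc s′ →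
    After true (s′ + s′) 0 (diag μ (i + y) 0 (suc s′)) (diag μ (suc (i + y)) 0 s′)
  shrink-at μ i _ zero    s′ (cons af _) refl rewrite ℕ.+-identityʳ i = af
  shrink-at μ i _ (suc y) s′ (cons _ ch) refl rewrite ℕ.+-suc i y = shrink-at μ (suc i) (y + suc s′) y s′ ch refl

  module _ (μ : ℕ → ℕ → ℕ) where

    private
      shift : ∀ (R : ℕ → ℕ → Set) (i j i′ j′ d : ℕ) → R (μ (suc i + d) (suc j + d)) (μ (suc i′ + d) (suc j′ + d)) →
              R (μ (i + suc d) (j + suc d)) (μ (i′ + suc d) (j′ + suc d))
      shift R i j i′ j′ d = subst₂ R (cong₂ μ (sym (ℕ.+-suc i d)) (sym (ℕ.+-suc j d))) (cong₂ μ (sym (ℕ.+-suc i′ d)) (sym (ℕ.+-suc j′ d)))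

      start : ∀ (R : ℕ → ℕ → Set) (i j i′ j′ : ℕ) → R (μ i j) (μ i′ j′) → R (μ (i + 0) (j + 0)) (μ (i′ + 0) (j′ + 0))
      start R i j i′ j′ = subst₂ R (cong₂ μ (sym (ℕ.+-identityʳ i)) (sym (ℕ.+-identityʳ j))) (cong₂ μ (sym (ℕ.+-identityʳ i′)) (sym (ℕ.+-identityʳ j′)))

    inter-lo : ∀ {hi L i j n} → Inter false hi L (diag μ i (suc j) n) (diag μ i j (suc n)) → L ≤ μ i j
    inter-lo {n = zero}  (grow p _)     = p
    inter-lo {n = suc n} (step p _ _ _) = p

    -- In v₁ < u₁ ≤ v₂ < u₂ ≤ ... the strict inequalities compare neighbours in a row of `μ`, the
    -- weak ones neighbours in a column. The next lemmas read them off in turn.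
    grow-strict : ∀ {hi L} i j n → Inter false hi L (diag μ i (suc j) n) (diag μ i j (suc n)) →
                  ∀ d → d < n → μ (i + d) (j + d) < μ (i + d) (suc j + d)
    grow-strict i j (suc n) (step p q r x) zero    _       = start _<_ i j i (suc j) q
    grow-strict i j (suc n) (step p q r x) (suc d) (s≤s l) = shift _<_ i j i (suc j) d (grow-strict (suc i) (suc j) n x d l)

    grow-weak : ∀ {hi L} i j n → Inter false hi L (diag μ i (suc j) n) (diag μ i j (suc n)) →
                ∀ d → d < n → μ (i + d) (suc j + d) ≤ μ (suc i + d) (suc j + d)
    grow-weak i j (suc n) (step p q r x) zero    _       = start _≤_ i (suc j) (suc i) (suc j) (inter-lo x)
    grow-weak i j (suc n) (step p q r x) (suc d) (s≤s l) = shift _≤_ i (suc j) (suc i) (suc j) d (grow-weak (suc i) (suc j) n x d l)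

    grow-last : ∀ {hi L} i j n → Inter false hi L (diag μ i (suc j) n) (diag μ i j (suc n)) → μ (i + n) (j + n) ≤ hi
    grow-last {hi} i j zero    (grow _ q)     = subst (_≤ hi) (cong₂ μ (sym (ℕ.+-identityʳ i)) (sym (ℕ.+-identityʳ j))) q
    grow-last {hi} i j (suc n) (step p q r x) = subst (_≤ hi) (cong₂ μ (sym (ℕ.+-suc i n)) (sym (ℕ.+-suc j n))) (grow-last (suc i) (suc j) n x)

    -- `L` bounds the entry just above the head of the lower diagonal; after one step it is equal to
    -- that entry.
    shrink-weak : ∀ {hi L} i j n → Inter true hi L (diag μ (suc i) (suc j) n) (diag μ (suc i) j n) → (0 < n → μ i j ≤ L) →
                  ∀ d → d < n → μ (i + d) (j + d) ≤ μ (suc i + d) (j + d)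
    shrink-weak i j (suc n) (step p q r x) l zero    _       = start _≤_ i j (suc i) j (ℕ.≤-trans (l (s≤s z≤n)) p)
    shrink-weak i j (suc n) (step p q r x) l (suc d) (s≤s m) = shift _≤_ i j (suc i) j d
      (shrink-weak (suc i) (suc j) n x (λ _ → ℕ.≤-refl) d m)

    shrink-strict : ∀ {hi L} i j n → Inter true hi L (diag μ i (suc j) n) (diag μ i j n) →
                    ∀ d → d < n → μ (i + d) (j + d) < μ (i + d) (suc j + d)
    shrink-strict i j (suc n) (step p q r x) zero    _       = start _<_ i j i (suc j) q
    shrink-strict i j (suc n) (step p q r x) (suc d) (s≤s l) = shift _<_ i j i (suc j) d (shrink-strict (suc i) (suc j) n x d l)

    shrink-last : ∀ {hi L} i j n → Inter true hi L (diag μ (suc i) (suc j) n) (diag μ (suc i) j n) → μ i j ≤ hi → μ (i + n) (j + n) ≤ hi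
    shrink-last {hi} i j zero    shrink         l = subst (_≤ hi) (cong₂ μ (sym (ℕ.+-identityʳ i)) (sym (ℕ.+-identityʳ j))) l
    shrink-last {hi} i j (suc n) (step p q r x) l = subst (_≤ hi) (cong₂ μ (sym (ℕ.+-suc i n)) (sym (ℕ.+-suc j n))) (shrink-last (suc i) (suc j) n x r)

  module _ (c′ : ℕ) where

    private
      c = suc c′

    -- For the c × c corner of a plane partition π in the box of side 2c, μ i j = 2c + j - π i j.
    -- The diagonals of μ, read from the top right to the bottom left corner, form a chain.
    record Pattern (μ : ℕ → ℕ → ℕ) : Set where
      field
        lower  : ∀ {i j} → i < c → j < c → j ≤ μ i j
        strict : ∀ {i j} → i < c → suc j < c → μ i j < μ i (suc j)
        weak   : ∀ {i j} → suc i < c → j < c → μ i j ≤ μ (suc i) j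
        -- In terms of π these two bounds say 2c - i ≤ π and 2c - j ≤ π. They are imposed on the
        -- last column and the last row, where they are the `hi` of the chain; monotonicity extends
        -- them to `upper₁` and `upper₂`.
        right  : ∀ {i} → i < c → μ i c′ ≤ c′ + i
        bottom : ∀ {j} → j < c → μ c′ j ≤ j + j

      gap : ∀ {i} d {j} → i < c → d + j ≤ c′ → d + μ i j ≤ μ i (d + j)
      gap zero    p q = ℕ.≤-refl
      gap (suc d) p q = ℕ.≤-trans (s≤s (gap d p (ℕ.≤-trans (ℕ.n≤1+n _) q))) (strict p (s≤s q))

      upper₁ : ∀ {i j} → i < c → j < c → μ i j ≤ j + i
      upper₁ {i} {j} p (s≤s q) = ℕ.+-cancelˡ-≤ (c′ ∸ j) _ _ (ℕ.≤-trans (gap (c′ ∸ j) p (ℕ.≤-reflexive e))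
        (subst (λ z → μ i z ≤ c′ ∸ j + (j + i)) (sym e) (ℕ.≤-trans (right p) (ℕ.≤-reflexive (trans (cong (_+ i) (sym e)) (ℕ.+-assoc (c′ ∸ j) j i))))))
        where
        e : c′ ∸ j + j ≡ c′
        e = ℕ.m∸n+n≡m q

      descend : ∀ d {i j} → d + i ≤ c′ → j < c → μ i j ≤ μ (d + i) j
      descend zero    p q = ℕ.≤-refl
      descend (suc d) p q = ℕ.≤-trans (descend d (ℕ.≤-trans (ℕ.n≤1+n _) p) q) (weak (s≤s p) q)

      upper₂ : ∀ {i j} → i < c → j < c → μ i j ≤ j + j
      upper₂ {i} {j} (s≤s p) q = ℕ.≤-trans (descend (c′ ∸ i) (ℕ.≤-reflexive e) q) (subst (λ z → μ z j ≤ j + j) (sym e) (bottom q))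
        where
        e : c′ ∸ i + i ≡ c′
        e = ℕ.m∸n+n≡m p

    -- Counted from the top right corner, the diagonal through (i , j) has number c′ - j + i, and (i
    -- , j) is its entry number min(i , j), both starting at 0.
    muOf : Chain → ℕ → ℕ → ℕ
    muOf C i j = nth 0 (nth [] C (c′ ∸ j + i)) (i ⊓ j)

    chainOf : (ℕ → ℕ → ℕ) → Chain
    chainOf μ = growDiags μ c 0 c

    private
      upIndex : ∀ x lo d → c ≡ x + suc lo → d ≤ x → c′ ∸ (lo + d) + d ≡ x
      upIndex x lo d e d≤x = begin
        c′ ∸ (lo + d) + d ≡⟨ cong (λ z → z ∸ (lo + d) + d) (ℕ.suc-injective (trans e (ℕ.+-suc x lo))) ⟩
        (x + lo) ∸ (lo + d) + d ≡⟨ cong (λ z → z ∸ (lo + d) + d) (ℕ.+-comm x lo) ⟩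
        (lo + x) ∸ (lo + d) + d ≡⟨ cong (_+ d) (ℕ.[m+n]∸[m+o]≡n∸o lo x d) ⟩
        (x ∸ d) + d ≡⟨ ℕ.m∸n+n≡m d≤x ⟩
        x ∎
        where open ≡-Reasoning

      downIndex : ∀ y d → d ≤ c′ → c′ ∸ d + (suc y + d) ≡ c + y
      downIndex y d d≤c′ = begin
        c′ ∸ d + (suc y + d) ≡⟨ cong (c′ ∸ d +_) (ℕ.+-comm (suc y) d) ⟩
        c′ ∸ d + (d + suc y) ≡⟨ ℕ.+-assoc (c′ ∸ d) d (suc y) ⟨
        c′ ∸ d + d + suc y ≡⟨ cong (_+ suc y) (ℕ.m∸n+n≡m d≤c′) ⟩
        c′ + suc y ≡⟨ ℕ.+-suc c′ y ⟩
        c + y ∎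
        where open ≡-Reasoning

      split : ∀ {m n} → m ≤ n → Σ ℕ λ o → n ≡ o + m
      split {m} {n} p = n ∸ m , sym (ℕ.m∸n+n≡m p)

    muOf-chainOf : ∀ μ {i j} → i < c → j < c → muOf (chainOf μ) i j ≡ μ i j
    muOf-chainOf μ {i} {j} p q with i ℕ.≤? j
    ... | yes i≤j with split i≤j
    ...   | lo , refl with split (ℕ.≤-<-trans (ℕ.m≤m+n lo i) q)
    ...     | x , e = begin
      nth 0 (nth [] (chainOf μ) (c′ ∸ (lo + i) + i)) (i ⊓ (lo + i))
        ≡⟨ cong₂ (λ u v → nth 0 (nth [] (chainOf μ) u) v) (upIndex x lo i e i≤x) (ℕ.m≤n⇒m⊓n≡m (ℕ.m≤n+m i lo)) ⟩
      nth 0 (nth [] (chainOf μ) x) i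
        ≡⟨ cong (λ V → nth 0 V i) (nth-growDiags μ c 0 c x lo e) ⟩
      nth 0 (diag μ 0 lo (suc x)) i
        ≡⟨ nth-diag μ 0 lo (suc x) i (s≤s i≤x) ⟩
      μ i (lo + i) ∎
      where
      open ≡-Reasoning
      i≤x : i ≤ x
      i≤x = ℕ.+-cancelˡ-≤ lo i x (ℕ.≤-trans (ℕ.≤-pred q) (ℕ.≤-reflexive (trans (ℕ.suc-injective (trans e (ℕ.+-suc x lo))) (ℕ.+-comm x lo))))
    muOf-chainOf μ {i} {j} p q | no i≰j with split (ℕ.≰⇒> i≰j)
    ... | y , e₁ with trans e₁ (ℕ.+-suc y j)
    ...   | refl with split (ℕ.≤-<-trans (ℕ.≤-trans (ℕ.m≤m+n y j) (ℕ.n≤1+n _)) p)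
    ...     | s , e = begin
      nth 0 (nth [] (chainOf μ) (c′ ∸ j + (suc y + j))) ((suc y + j) ⊓ j)
        ≡⟨ cong₂ (λ u v → nth 0 (nth [] (chainOf μ) u) v) (downIndex y j (ℕ.≤-pred q)) (ℕ.m≥n⇒m⊓n≡n (ℕ.m≤n+m j (suc y))) ⟩
      nth 0 (nth [] (chainOf μ) (c + y)) j
        ≡⟨ cong (λ V → nth 0 V j) (trans (nth-growDiags-turn μ c 0 c y) (nth-shrinkDiags μ 0 c y s e′)) ⟩
      nth 0 (diag μ (suc y) 0 s) j
        ≡⟨ nth-diag μ (suc y) 0 s j (ℕ.+-cancelˡ-≤ y (suc j) s (ℕ.≤-trans (ℕ.≤-reflexive (ℕ.+-suc y j)) (ℕ.≤-trans (ℕ.≤-pred p) (ℕ.≤-reflexive (ℕ.suc-injective (trans e′ (ℕ.+-suc y s))))))) ⟩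
      μ (suc y + j) j ∎
      where
      open ≡-Reasoning
      e′ : c ≡ y + suc s
      e′ = trans e (trans (ℕ.+-suc s y) (trans (cong suc (ℕ.+-comm s y)) (sym (ℕ.+-suc y s))))

    chainOf-unique : ∀ {C μ} → GrowChain c 0 c [] C → (∀ {i j} → i < c → j < c → μ i j ≡ muOf C i j) → chainOf μ ≡ C
    chainOf-unique {C} {μ} ch agree = growDiags-rebuild μ ch refl refl
      (λ x lo d e p →
        let row : x + lo ≡ c′
            row = sym (ℕ.suc-injective (trans e (ℕ.+-suc x lo)))
            j≤ : lo + d ≤ c′
            j≤ = ℕ.≤-trans (ℕ.+-monoʳ-≤ lo (ℕ.≤-pred p)) (ℕ.≤-reflexive (trans (ℕ.+-comm lo x) row))
        in trans (agree (s≤s (ℕ.≤-trans (ℕ.m≤n+m d lo) j≤)) (s≤s j≤))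
          (cong₂ (λ u v → nth 0 (nth [] C u) v) (upIndex x lo d e (ℕ.≤-pred p)) (ℕ.m≤n⇒m⊓n≡m (ℕ.m≤n+m d lo))))
      (λ y s d e p →
        let i≤ : suc y + d ≤ c′
            i≤ = ℕ.≤-trans (ℕ.≤-reflexive (sym (ℕ.+-suc y d))) (ℕ.≤-trans (ℕ.+-monoʳ-≤ y p) (ℕ.≤-reflexive (sym (ℕ.suc-injective (trans e (ℕ.+-suc y s))))))
            d≤ : d ≤ c′
            d≤ = ℕ.≤-trans (ℕ.m≤n+m d (suc y)) i≤
        in trans (agree (s≤s i≤) (s≤s d≤))
          (cong₂ (λ u v → nth 0 (nth [] C u) v) (downIndex y d d≤) (ℕ.m≥n⇒m⊓n≡n (ℕ.m≤n+m d (suc y)))))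

    pattern⇒chain : ∀ {μ} → Pattern μ → GrowChain c 0 c [] (chainOf μ)
    pattern⇒chain {μ} pat = growing 0 c refl
      where
      open Pattern pat
      -- `hi` stays fixed along the diagonal, because its last entry is always the one at (i + n ,
      -- c′), where `right` applies.
      growRow : ∀ i j n hi {L} → j + n ≡ c′ → i + n < c → hi ≡ c′ + (i + n) → L ≤ μ i j →
                Inter false hi L (diag μ i (suc j) n) (diag μ i j (suc n))
      growRow i j zero hi e p h l with trans (sym (ℕ.+-identityʳ j)) e
      ... | refl = grow l (subst (μ i c′ ≤_) (trans (cong (c′ +_) (sym (ℕ.+-identityʳ i))) (sym h)) (right (subst (_< c) (ℕ.+-identityʳ i) p)))
      growRow i j (suc n) hi e p h l = step l (strict i<c j<c)
        (ℕ.≤-trans (upper₁ i<c j<c) (ℕ.≤-trans (ℕ.+-mono-≤ (ℕ.≤-pred j<c) (ℕ.m≤m+n i (suc n))) (ℕ.≤-reflexive (sym h))))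
        (growRow (suc i) (suc j) n hi (trans (sym (ℕ.+-suc j n)) e) p′ (trans h (cong (c′ +_) (ℕ.+-suc i n)))
          (weak (ℕ.≤-<-trans (ℕ.m≤m+n (suc i) n) p′) j<c))
        where
        p′ : suc i + n < c
        p′ = subst (_< c) (ℕ.+-suc i n) p
        i<c : i < c
        i<c = ℕ.≤-<-trans (ℕ.m≤m+n i (suc n)) p
        j<c : suc j < c
        j<c = s≤s (ℕ.≤-trans (ℕ.m≤m+n (suc j) n) (ℕ.≤-reflexive (trans (sym (ℕ.+-suc j n)) e)))
      -- The last premise is guarded because for n = 0 the index `suc i` equals c and leaves the
      -- block.
      shrinkRow : ∀ i j n hi {L} → i + n ≡ c′ → j + n < c → hi ≡ (j + n) + (j + n) → (0 < n → L ≤ μ (suc i) j) →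
                  Inter true hi L (diag μ (suc i) (suc j) n) (diag μ (suc i) j n)
      shrinkRow i j zero hi e p h l = shrink
      shrinkRow i j (suc n) hi e p h l = step (l (s≤s z≤n)) (strict i<c j<c)
        (ℕ.≤-trans (upper₂ i<c j<c) (ℕ.≤-trans (ℕ.+-mono-≤ j≤ j≤) (ℕ.≤-reflexive (sym h))))
        (shrinkRow (suc i) (suc j) n hi e′ (subst (_< c) (ℕ.+-suc j n) p)
          (trans h (cong₂ _+_ (ℕ.+-suc j n) (ℕ.+-suc j n)))
          (λ 0<n → weak (s≤s (ℕ.≤-trans (ℕ.m<m+n (suc i) 0<n) (ℕ.≤-reflexive e′))) j<c))
        where
        e′ : suc i + n ≡ c′
        e′ = trans (sym (ℕ.+-suc i n)) e
        i<c : suc i < c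
        i<c = s≤s (ℕ.≤-trans (ℕ.m≤m+n (suc i) n) (ℕ.≤-reflexive e′))
        j≤ : suc j ≤ j + suc n
        j≤ = ℕ.≤-trans (ℕ.m≤m+n (suc j) n) (ℕ.≤-reflexive (sym (ℕ.+-suc j n)))
        j<c : suc j < c
        j<c = ℕ.≤-<-trans j≤ p
      shrinking : ∀ i s → i + s ≡ c → ShrinkChain s (diag μ i 0 s) (shrinkDiags μ i s)
      shrinking i zero    e = nil
      shrinking i (suc s) e = cons
        (next z≤n (ℕ.≤-trans (upper₂ (s≤s (ℕ.≤-trans (ℕ.m≤m+n i s) (ℕ.≤-reflexive e′))) (s≤s z≤n)) z≤n)
          (shrinkRow i 0 s (s + s) e′ (s≤s (ℕ.≤-trans (ℕ.m≤n+m s i) (ℕ.≤-reflexive e′))) refl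
            (λ 0<s → weak (s≤s (ℕ.≤-trans (ℕ.m<m+n i 0<s) (ℕ.≤-reflexive e′))) (s≤s z≤n))))
        (shrinking (suc i) s (cong suc e′))
        where
        e′ : i + s ≡ c′
        e′ = ℕ.suc-injective (trans (sym (ℕ.+-suc i s)) e)
      growing : ∀ q g → q + g ≡ c → GrowChain c q g (diag μ 0 g q) (growDiags μ c q g)
      growing q zero     e = turn (subst (λ z → ShrinkChain c (diag μ 0 0 z) (shrinkDiags μ 0 c)) (sym (trans (sym (ℕ.+-identityʳ q)) e)) (shrinking 0 c refl))
      growing q (suc lo) e = cons
        (growRow 0 lo q (lo + (q + q)) (trans (ℕ.+-comm lo q) e′) (s≤s (ℕ.≤-trans (ℕ.m≤m+n q lo) (ℕ.≤-reflexive e′)))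
          (trans (sym (ℕ.+-assoc lo q q)) (cong (_+ q) (trans (ℕ.+-comm lo q) e′)))
          (lower (s≤s z≤n) (s≤s (ℕ.≤-trans (ℕ.m≤n+m lo q) (ℕ.≤-reflexive e′)))))
        (growing (suc q) lo (cong suc e′))
        where
        e′ : q + lo ≡ c′
        e′ = ℕ.suc-injective (trans (sym (ℕ.+-suc q lo)) e)

    chain⇒pattern : ∀ {μ} → GrowChain c 0 c [] (chainOf μ) → Pattern μ
    chain⇒pattern {μ} ch = record { lower = low _ ; strict = str ; weak = wk ; right = rgt ; bottom = bot }
      where
      up : ∀ lo → lo ≤ c′ → Σ ℕ λ x → c ≡ x + suc lo × Inter false (lo + (x + x)) lo (diag μ 0 (suc lo) x) (diag μ 0 lo (suc x))
      up lo p with split (s≤s p)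
      ... | x , e = x , e , grow-at μ c 0 c x lo ch e
      down : ∀ y → y ≤ c′ → Σ ℕ λ s → c ≡ y + suc s × μ y 0 ≤ s + s × Inter true (s + s) (μ y 0) (diag μ (suc y) 1 s) (diag μ (suc y) 0 s)
      down y p with split (s≤s p)
      ... | s , e with trans e (trans (ℕ.+-suc s y) (trans (cong suc (ℕ.+-comm s y)) (sym (ℕ.+-suc y s))))
      ...   | e′ with shrink-at μ 0 c y s (turn-at μ c 0 c ch refl) e′
      ...     | next _ h i = s , e′ , h , i
      room : ∀ {x lo i} → c ≡ x + suc lo → suc (lo + i) < c → i < x
      room {x} {lo} {i} e p = ℕ.+-cancelʳ-< lo i x (ℕ.≤-trans (ℕ.≤-reflexive (cong suc (ℕ.+-comm i lo)))
        (ℕ.≤-trans (ℕ.≤-pred p) (ℕ.≤-reflexive (ℕ.suc-injective (trans e (ℕ.+-suc x lo))))))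
      room′ : ∀ {y s j} → c ≡ y + suc s → suc (y + j) < c → j < s
      room′ {y} {s} {j} e p = ℕ.+-cancelˡ-≤ y (suc j) s (ℕ.≤-trans (ℕ.≤-reflexive (ℕ.+-suc y j))
        (ℕ.≤-trans (ℕ.≤-pred p) (ℕ.≤-reflexive (ℕ.suc-injective (trans e (ℕ.+-suc y s))))))
      str : ∀ {i j} → i < c → suc j < c → μ i j < μ i (suc j)
      str {i} {j} p q with i ℕ.≤? j
      ... | yes i≤j with split i≤j
      ...   | lo , refl with up lo (ℕ.≤-trans (ℕ.m≤m+n lo i) (ℕ.≤-trans (ℕ.n≤1+n _) (ℕ.≤-pred q)))
      ...     | x , e , I = grow-strict μ 0 lo x I i (room e q)
      str {i} {j} p q | no i≰j with split (ℕ.≰⇒> i≰j)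
      ... | y , e₁ with trans e₁ (ℕ.+-suc y j)
      ...   | refl with down y (ℕ.≤-trans (ℕ.m≤m+n y j) (ℕ.≤-trans (ℕ.n≤1+n _) (ℕ.≤-pred p)))
      ...     | s , e , _ , I = shrink-strict μ (suc y) 0 s I j (room′ e p)
      wk : ∀ {i j} → suc i < c → j < c → μ i j ≤ μ (suc i) j
      wk {i} {j} p q with suc i ℕ.≤? j
      ... | yes i<j with split i<j
      ...   | lo , e₁ with trans e₁ (ℕ.+-suc lo i)
      ...     | refl with up lo (ℕ.≤-trans (ℕ.m≤m+n lo i) (ℕ.≤-trans (ℕ.n≤1+n _) (ℕ.≤-pred q)))
      ...       | x , e , I = grow-weak μ 0 lo x I i (room e q)
      wk {i} {j} p q | no i≮j with split (ℕ.≮⇒≥ i≮j)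
      ... | y , refl with down y (ℕ.≤-trans (ℕ.m≤m+n y j) (ℕ.≤-trans (ℕ.n≤1+n _) (ℕ.≤-pred p)))
      ...   | s , e , _ , I = shrink-weak μ y 0 s I (λ _ → ℕ.≤-refl) j (room′ e p)
      low : ∀ i {j} → i < c → j < c → j ≤ μ i j
      -- In the top row the bound is the first black position of a growing row; `wk` carries it down
      -- the columns.
      low zero    p (s≤s q) = inter-lo μ (proj₂ (proj₂ (up _ q)))
      low (suc i) p q       = ℕ.≤-trans (low i (ℕ.<-trans (ℕ.n<1+n i) p) q) (wk p q)
      rgt : ∀ {i} → i < c → μ i c′ ≤ c′ + i
      rgt {i} (s≤s p) with split p
      ... | lo , e = subst (λ z → μ i z ≤ z + i) (sym e) (subst (μ i (lo + i) ≤_) (sym (ℕ.+-assoc lo i i))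
        (grow-last μ 0 lo i (grow-at μ c 0 c i lo ch (trans (cong suc (trans e (ℕ.+-comm lo i))) (sym (ℕ.+-suc i lo))))))
      bot : ∀ {j} → j < c → μ c′ j ≤ j + j
      bot {j} (s≤s p) with split p
      ... | y , e with shrink-at μ 0 c y j (turn-at μ c 0 c ch refl) (trans (cong suc e) (sym (ℕ.+-suc y j)))
      ...   | next _ h I = subst (λ z → μ z j ≤ j + j) (sym e) (shrink-last μ y 0 j I h)

-- The bijection between chains and plane partitions, and the final assembly.

open Interlacing
open AlternatingPolynomials
open Regions
open PlanePartitions
open Patterns
open import Data.Nat using (_∸_; _+_; _*_)
open import Data.Nat.Divisibility using (_∣_; divides)
open import Data.Nat.Tactic.RingSolver using (solve-∀)
open import Data.Fin using (Fin)
open import Data.List.Membership.Propositional using (_∈_)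
open import Data.List.Membership.Propositional.Properties using (∈-map⁺; ∈-map⁻)
open import Data.List.Relation.Unary.Any using (here; there)
open import Data.List.Relation.Unary.All as All using (All; []; _∷_)
import Data.List.Relation.Unary.All.Properties as All
open import Data.List.Relation.Unary.Unique.Propositional using (Unique; []; _∷_)
open import Function.Bundles using (mk⇔)

map-unique : ∀ {A B : Set} (f : A → B) (g : B → A) {xs} → (∀ {x} → x ∈ xs → g (f x) ≡ x) → Unique xs → Unique (map f xs)
map-unique f g {[]}     inv []      = []
map-unique f g {x ∷ xs} inv (p ∷ u) =
  All.map⁺ (All.tabulate λ {y} y∈ e → All.lookup p y∈ (trans (sym (inv (here refl))) (trans (cong g e) (inv (there y∈)))))
  ∷ map-unique f g (inv ∘ there) u

NumberIs-bijection : ∀ {A B : Set} {P : B → Set} (xs : List A) (f : A → B) (g : B → A) → Unique xs →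
  (∀ {x} → x ∈ xs → P (f x)) → (∀ {x} → x ∈ xs → g (f x) ≡ x) →
  (∀ {y} → P y → g y ∈ xs) → (∀ {y} → P y → f (g y) ≡ y) → NumberIs P (length xs)
NumberIs-bijection {P = P} xs f g u to gf from fg =
    map f xs , map-unique f g gf u , (λ y → mk⇔ fwd (λ p → subst (_∈ map f xs) (fg p) (∈-map⁺ f (from p)))) , L.length-map f xs
  where
  fwd : ∀ {y} → y ∈ map f xs → P y
  fwd y∈ with ∈-map⁻ f y∈
  ... | x , x∈ , refl = to x∈

module Count (c′ : ℕ) where

  private
    c = suc c′
  open Extension c

  -- An involution on arrays with entries at most `a + j`, so one formula serves both directions.
  complement : (ℕ → ℕ → ℕ) → ℕ → ℕ → ℕ
  complement h i j = (a + j) ∸ h i j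

  pattern⇒block : ∀ {μ} → Pattern c′ μ → Block (complement μ)
  pattern⇒block {μ} pat = record
    { β-bound = λ {i} {j} p q → ℕ.m≤n+o⇒m∸n≤o (a + j) (μ i j) (ℕ.≤-trans (ℕ.+-monoʳ-≤ a (lower p q)) (ℕ.≤-reflexive (ℕ.+-comm a (μ i j))))
    ; β-mono₁ = λ {i} {i′} {j} l p q → ℕ.∸-monoʳ-≤ (a + j)
        (subst (λ z → μ i j ≤ μ z j) (ℕ.m∸n+n≡m l) (descend (i′ ∸ i) (subst (_≤ c′) (sym (ℕ.m∸n+n≡m l)) (ℕ.≤-pred p)) q))
    ; β-mono₂ = mono₂
    ; β-low₁ = λ {i} p q → low i (upper₁ p q)
    ; β-low₂ = λ {_} {j} p q → low j (upper₂ p q)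
    }
    where
    open Pattern pat
    mono₂ : ∀ {i j j′} → i < c → j ≤ j′ → j′ < c → complement μ i j′ ≤ complement μ i j
    mono₂ {i} {j} {j′} p l q = ℕ.≤-trans (ℕ.∸-monoʳ-≤ (a + j′) gap′)
      (ℕ.≤-reflexive (trans (cong (_∸ (d + μ i j)) e) (ℕ.[m+n]∸[m+o]≡n∸o d (a + j) (μ i j))))
      where
      d = j′ ∸ j
      gap′ : d + μ i j ≤ μ i j′
      gap′ = subst (λ z → d + μ i j ≤ μ i z) (ℕ.m∸n+n≡m l) (gap d p (subst (_≤ c′) (sym (ℕ.m∸n+n≡m l)) (ℕ.≤-pred q)))
      e : a + j′ ≡ d + (a + j)
      e = trans (cong (a +_) (sym (ℕ.m∸n+n≡m l))) (trans (sym (ℕ.+-assoc a d j)) (trans (cong (_+ j) (ℕ.+-comm a d)) (ℕ.+-assoc d a j)))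
    low : ∀ {i j} x → μ i j ≤ j + x → a ≤ complement μ i j + x
    low {i} {j} x h = ℕ.+-cancelʳ-≤ j a _ (ℕ.≤-trans (ℕ.m≤n+m∸n (a + j) (μ i j))
      (ℕ.≤-trans (ℕ.+-monoˡ-≤ (complement μ i j) h) (ℕ.≤-reflexive (rearrange j x (complement μ i j)))))
      where
      rearrange : ∀ j x m → j + x + m ≡ m + x + j
      rearrange = solve-∀

  block⇒pattern : ∀ {β} → Block β → Pattern c′ (complement β)
  block⇒pattern {β} blk = record
    { lower = λ {i} {j} p q → ℕ.m+n≤o⇒m≤o∸n j (ℕ.≤-trans (ℕ.+-monoʳ-≤ j (β-bound p q)) (ℕ.≤-reflexive (ℕ.+-comm j a)))
    ; strict = λ {i} {j} p q → subst (complement β i j <_)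
        (trans (sym (ℕ.+-∸-assoc 1 (ℕ.≤-trans (β-bound p q) (ℕ.m≤m+n a j)))) (cong (_∸ β i (suc j)) (sym (ℕ.+-suc a j))))
        (s≤s (ℕ.∸-monoʳ-≤ (a + j) (β-mono₂ p (ℕ.n≤1+n j) q)))
    ; weak = λ {i} {j} p q → ℕ.∸-monoʳ-≤ (a + j) (β-mono₁ (ℕ.n≤1+n i) p q)
    ; right = λ {i} p → high i (β-low₁ p ℕ.≤-refl)
    ; bottom = λ {j} q → high j (β-low₂ ℕ.≤-refl q)
    }
    where
    open Block blk
    high : ∀ {i j} x → a ≤ β i j + x → complement β i j ≤ j + x
    high {i} {j} x h = ℕ.m≤n+o⇒m∸n≤o (a + j) (β i j) (ℕ.≤-trans (ℕ.+-monoˡ-≤ j h) (ℕ.≤-reflexive (rearrange (β i j) x j)))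
      where
      rearrange : ∀ b x j → b + x + j ≡ b + (j + x)
      rearrange = solve-∀

  toMatrix : Chain → Matrix a
  toMatrix C = fromArray (extend (complement (muOf c′ C)))

  toChain : Matrix a → Chain
  toChain π = chainOf c′ (complement (height π))

  private
    chainPattern : ∀ {C} → GrowChain c 0 c [] C → Pattern c′ (muOf c′ C)
    -- `chain⇒pattern` speaks of chains of the form `chainOf μ`, so `C` is first rewritten as the
    -- chain of its own array.
    chainPattern {C} ch = chain⇒pattern c′ (subst (GrowChain c 0 c []) (sym (chainOf-unique c′ ch (λ _ _ → refl))) ch)

    up : ∀ {x} → x < c → x < a
    up p = ℕ.<-≤-trans p (ℕ.m≤m+n c c)

    matrixChain : ∀ {π} → IsCSTC a π → GrowChain c 0 c [] (toChain π)
    matrixChain {π} cs = pattern⇒chain c′ (block⇒pattern (symmetric-block (CSTC⇒symmetric π cs)))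

    toMatrix-CSTC : ∀ {C} → GrowChain c 0 c [] C → IsCSTC a (toMatrix C)
    toMatrix-CSTC {C} ch = symmetric⇒CSTC _ (extend-symmetric _ (pattern⇒block (chainPattern ch)))

    toChain-toMatrix : ∀ {C} → GrowChain c 0 c [] C → toChain (toMatrix C) ≡ C
    toChain-toMatrix {C} ch = chainOf-unique c′ ch λ {i} {j} p q → begin
      (a + j) ∸ height (toMatrix C) i j ≡⟨ cong ((a + j) ∸_) (height-fromArray (extend (complement μ)) (up p) (up q)) ⟩
      (a + j) ∸ extend (complement μ) i j ≡⟨ cong ((a + j) ∸_) (extend-block (complement μ) (pattern⇒block pat) p q) ⟩
      (a + j) ∸ ((a + j) ∸ μ i j) ≡⟨ ℕ.m∸[m∸n]≡n (ℕ.≤-trans (Pattern.upper₂ pat p q) (ℕ.+-monoˡ-≤ j (ℕ.<⇒≤ (up q)))) ⟩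
      μ i j ∎
      where
      open ≡-Reasoning
      μ = muOf c′ C
      pat = chainPattern ch

    toMatrix-toChain : ∀ {π} → IsCSTC a π → toMatrix (toChain π) ≡ π
    toMatrix-toChain {π} cs = fromArray-height π _
      (extend-unique sy (pattern⇒block (chainPattern (matrixChain {π} cs))) λ {i} {j} p q → begin
        (a + j) ∸ muOf c′ (toChain π) i j ≡⟨ cong ((a + j) ∸_) (muOf-chainOf c′ _ p q) ⟩
        (a + j) ∸ ((a + j) ∸ height π i j) ≡⟨ ℕ.m∸[m∸n]≡n (ℕ.≤-trans (Symmetric.bound sy (up p) (up q)) (ℕ.m≤m+n a j)) ⟩
        height π i j ∎)
      where
      open ≡-Reasoning
      sy = CSTC⇒symmetric π cs

  chains-count-CSTC : NumberIs (IsCSTC a) (length (growChains c 0 c []))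
  chains-count-CSTC = NumberIs-bijection (growChains c 0 c []) toMatrix toChain (growChains-unique c 0 c [])
    (λ p → toMatrix-CSTC (growChains-sound c 0 c [] p))
    (λ p → toChain-toMatrix (growChains-sound c 0 c [] p))
    (λ cs → growChains-complete (matrixChain cs))
    toMatrix-toChain

-- Side and degree are variables, so that the result for `suc c′ + suc c′` and `6 * c′ + 4` can be
-- transported along equations to `a` and `3 * a ∸ 2`.
Claim : ℕ → ℕ → Set
Claim a m =
  (Σ ℕ λ n → Σ (Fin n → Poly) λ B → Σ (Fin n → Poly) λ C → IsBasis a m n B × IsBasis a (suc m) n C)
  × (∀ n₁ n₂ (B : Fin n₁ → Poly) (C : Fin n₂ → Poly) → IsBasis a m n₁ B → IsBasis a (suc m) n₂ C → n₁ ≡ n₂)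
  × (∀ n (B C : Fin n → Poly) (M : Fin n → Fin n → ℤ) → IsBasis a m n B → IsBasis a (suc m) n C →
     (∀ t → mulL a (B t) ≈ lin (λ s → M s t) C) → NumberIs (IsCSTC a) ∣ det n M ∣)

-- `determinant` concerns the size of the monomial basis; `basis-card` identifies the size of any
-- given basis with it.
claim : ∀ {a m n k} (black : Exponents a m n) (white : Exponents a (suc m) n) →
  (∀ (B C : Fin n → Poly) (M : Fin n → Fin n → ℤ) → IsBasis a m n B → IsBasis a (suc m) n C →
   (∀ t → mulL a (B t) ≈ lin (λ s → M s t) C) → ∣ det n M ∣ ≡ k) →
  NumberIs (IsCSTC a) k → Claim a m
claim {a} {m} {n} black white determinant number =
    (n , B₀.basis , C₀.basis , B₀.isBasis , C₀.isBasis)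
  , (λ n₁ n₂ B C b c → trans (basis-card {a} {m} b B₀.isBasis) (basis-card {a} {suc m} C₀.isBasis c))
  , λ n′ B C M b c e → number-of n′ B C M b c e (basis-card {a} {m} b B₀.isBasis)
  where
  module B₀ = Exponents black
  module C₀ = Exponents white
  number-of : ∀ n′ (B C : Fin n′ → Poly) (M : Fin n′ → Fin n′ → ℤ) → IsBasis a m n′ B → IsBasis a (suc m) n′ C →
     (∀ t → mulL a (B t) ≈ lin (λ s → M s t) C) → n′ ≡ n → NumberIs (IsCSTC a) ∣ det n′ M ∣
  number-of _ B C M b c e refl = subst (NumberIs (IsCSTC a)) (sym (determinant B C M b c e)) number

claim-even : ∀ c′ → Claim (suc c′ + suc c′) (6 * c′ + 4)
claim-even c′ = claim blackExponents whiteExponents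
  (λ B C M b c e → trans (M.∣det-mulL∣ B C M b c e) ∣det-adjacency∣) (Count.chains-count-CSTC c′)
  where open Region c′

private
  half : ∀ c′ → suc c′ + suc c′ ≡ suc c′ * 2
  half = solve-∀

  degree : ∀ c′ → 3 * (suc c′ * 2) ≡ 2 + (6 * c′ + 4)
  degree = solve-∀

theorem1p5 : (a : ℕ) → 0 < a → 2 ∣ a →
    (Σ ℕ λ n → Σ (Fin n → Poly) λ B → Σ (Fin n → Poly) λ C →
    IsBasis a (3 * a ∸ 2) n B × IsBasis a (suc (3 * a ∸ 2)) n C)
    × (∀ n₁ n₂ (B : Fin n₁ → Poly) (C : Fin n₂ → Poly) →
    IsBasis a (3 * a ∸ 2) n₁ B → IsBasis a (suc (3 * a ∸ 2)) n₂ C → n₁ ≡ n₂)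
    × (∀ n (B C : Fin n → Poly) (M : Fin n → Fin n → ℤ) →
    IsBasis a (3 * a ∸ 2) n B → IsBasis a (suc (3 * a ∸ 2)) n C →
    (∀ t → mulL a (B t) ≈ lin (λ s → M s t) C) →
    NumberIs (IsCSTC a) ∣ det n M ∣)
theorem1p5 a 0<a (divides zero refl) with () ← 0<a
theorem1p5 a 0<a (divides (suc c′) refl) =
  subst₂ Claim (half c′) (sym (trans (cong (_∸ 2) (degree c′)) (ℕ.m+n∸m≡n 2 (6 * c′ + 4)))) (claim-even c′)
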